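{- (i) Let $S\equiv\pm\{1, 5, 9, 12, 13, 14, 16, 23, 27, 31, 34, 35\}\pmod{72}$ and $T\equiv\pm\{1, 4, 9, 11, 13, 14, 23, 25, 27, 30, 32, 35\}\pmod{72}$. Then $p(S,n)=p(T,n-1)$ for all $n\geq 1$. (ii) Let $S\equiv\pm\{2, 5, 6, 7, 9, 16, 17, 19, 20, 27, 29, 31\}\pmod{72}$ and $T\equiv\pm\{2, 5, 7, 8, 9, 11, 12, 25, 26, 27, 29, 31\}\pmod{72}$. Then $p(S,n)=p(T,n)$ for all integers $n\ge0$ with $n\neq 6$. (iii) Let $S\equiv\pm\{5, 6, 7, 8, 9, 17, 19, 26, 27, 28, 29, 31\}\pmod{72}$ and $T\equiv\pm\{1, 7, 9, 12, 17, 19, 22, 26, 27, 29, 32, 35\}\pmod{72}$. Then $p(S,n)=p(T,n-5)$ for all $n\geq 5$. (iv) Let $S\equiv\pm\{1, 9, 10, 11, 12, 14, 17, 19, 25, 27, 32, 35\}\pmod{72}$ and $T\equiv\pm\{1, 8, 9, 10, 11, 13, 23, 25, 27, 28, 30, 35\}\pmod{72}$. Then $p(S,n)=p(T,n-1)$ for all $n\geq 1$. (v) Let $S\equiv\pm\{7, 8, 9, 10, 11, 12, 13, 23, 25, 27, 29, 34\}\pmod{72}$ and $T\equiv\pm\{1, 9, 11, 13, 16, 20, 23, 25, 27, 30, 34, 35\}\pmod{72}$. Then $p(S,n)=p(T,n-7)$ for all $n\geq 7$. (vi) Let $S\equiv\pm\{4, 5, 6, 7, 9, 17, 19, 22, 27,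 29, 31, 32\}\pmod{72}$ and $T\equiv\pm\{2, 5, 9, 12, 13, 16, 17, 19, 22, 23, 27, 31\}\pmod{72}$. Then $p(S,n)=p(T,n)$ for all integers $n\ge0$ with $n\neq 2$.
   Context: For a set $S$ of positive integers and an integer $n\ge 0$, $p(S,n)$ denotes the number of partitions of $n$ into parts belonging to $S$ (so $p(S,0)=1$). The notation $S\equiv\pm\{r_1,\dots,r_k\}\pmod M$ means that $S$ is the set of all positive integers $n$ such that $n\equiv r_i$ or $n\equiv -r_i\pmod M$ for some $i$. -}

module Defs where

open import Data.Nat using (ℕ; zero; suc; _+_; _∸_; _≤ᵇ_; _%_; _≡ᵇ_)
open import Data.Bool using (Bool; true; false; _∧_; _∨_; not)
open import Data.List using (List; []; _∷_; map; length; filter; concatMap; upTo)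
open import Data.Bool.ListAction using (any; all)
open import Data.Bool using (T)
open import Relation.Nullary.Decidable using (T?)

-- A set S of positive integers is represented by its (decidable)
-- characteristic function ℕ → Bool (only its values on positive integers matter).

-- Residue-class sets: S ≡ ±{r₁,…,r_k} (mod M) is the set of positive n with
-- n ≡ rᵢ or n ≡ -rᵢ (mod M) for some i.
-- n ≡ -r (mod 72)  ⇔  (n + r) % 72 ≡ 0.
pmSet72 : List ℕ → ℕ → Bool
pmSet72 rs n = not (n ≡ᵇ 0) ∧ any (λ r → ((n % 72) ≡ᵇ (r % 72)) ∨ (((n + r) % 72) ≡ᵇ 0)) rs

-- partitionsBounded f m n : list of all partitions of n (as non-increasing lists
-- of positive parts) whose largest part is ≤ m.  The fuel f must be ≥ n;
-- each part is ≥ 1 so n strictly decreases and fuel n suffices.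
partitionsBounded : ℕ → ℕ → ℕ → List (List ℕ)
partitionsBounded _ _ zero = [] ∷ []
partitionsBounded zero _ (suc _) = []
partitionsBounded (suc f) m (suc n) =
  concatMap (λ k → map (λ p → suc k ∷ p) (partitionsBounded f (suc k) (suc n ∸ suc k)))
            (filter (λ k → T? ((suc k ≤ᵇ m) ∧ (suc k ≤ᵇ suc n))) (upTo (suc n)))

partitions : ℕ → List (List ℕ)
partitions n = partitionsBounded n n n

p : (ℕ → Bool) → ℕ → ℕ
p S n = length (filter (λ λs → T? (all S λs)) (partitions n))

-- With denominators cleared, each of the six identities says that a sum of three monomials in the products
-- (q^t; q^72)_∞ vanishes.  It is a linear combination of three instances of Weierstrass' three-term relation
-- for the theta function (z, q^36/z; q^36)_∞ at points z = ± q^a; these instances were found by computer search,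
-- and checking that they combine as required only means comparing multisets of residues.
-- The three-term relation itself holds in every commutative ring in which q is nilpotent: by the triple product
-- identity, j(xz) j(x/z) is, up to a constant, a double series, which summed along the diagonals becomes a
-- 2 × 2 determinant in values depending on x alone and z alone, so that the relation is a Plücker relation.
-- Applying this to ℤ[[q]]/(q^N) for every N gives the identities of generating functions.
module Submission where

open import Algebra using (CommutativeMonoid; CommutativeRing)
open import Data.Bool using (Bool; T; true; false; if_then_else_; _∧_; _∨_)
open import Data.Bool.ListAction using (all; any)
open import Data.Empty using (⊥-elim)
open import Data.Integer as ℤ using (ℤ)
import Data.Integer.Properties as ℤₚ
open import Data.Integer.Tactic.RingSolver using (solve-∀)
open import Data.List using (List; []; _∷_; _++_; map; length; filter; concatMap; upTo; applyUpTo)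
open import Data.List.Properties using (filter-++; length-++)
open import Data.Nat as ℕ using (ℕ; zero; suc; _<_; _≤_; z≤n; s≤s; _∸_; _≤ᵇ_; _%_)
open import Data.Nat.DivMod using ([m+kn]%n≡m%n)
open import Data.Nat.ListAction using (sum)
import Data.Nat.Properties as ℕₚ
open import Data.Nat.Tactic.RingSolver using () renaming (solve-∀ to solveℕ)
open import Data.Product using (∃; _,_; _×_)
open import Data.Sign using (Sign) renaming (+ to pos; - to neg; _*_ to _·_; opposite to flip)
open import Data.Sum using (inj₁; inj₂)
open import Data.Unit using (tt)
open import Function using (_∘_; id)
open import Level using (0ℓ)
open import Relation.Binary.PropositionalEquality as ≡ using (_≡_; _≢_)
open import Relation.Nullary.Decidable using (T?; yes; no; dec-true; dec-false)
open import Defs using (partitionsBounded; p; pmSet72)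

-- A nilpotent `q` makes every theta series a finite sum, but it is not invertible, so x/z or Q/x²
-- cannot be formed by division. The relation at points x, y, z, w is therefore written in the
-- ratios m₁ = z/w, m₂ = y/z, m₃ = x/y and in W = w², V = Q/x²; all other arguments are products of
-- these, and Q = m₁² m₂² m₃² W V. The price is truncation: summation windows have to survive shifts
-- and rotations, which works because the terms outside them vanish. The constant 1/(Q; Q)_∞ of the
-- triple product is represented by a central Gaussian binomial coefficient C and never evaluated:
-- an infinite product is C times a theta value, so the relation is simply multiplied by a power of
-- C. Points of negative sign explain why base q^36 leads to modulus 72: (-q^u; q^36)_∞ = (q^(2u);
-- q^72)_∞ / (q^u; q^36)_∞. They also introduce denominators, which are cross-multiplied.

-- Finite sums and products in a commutative monoid.

module Fold (M : CommutativeMonoid 0ℓ 0ℓ) where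

  open CommutativeMonoid M
  open import Algebra.Properties.CommutativeSemigroup commutativeSemigroup using (interchange)
  open import Relation.Binary.Reasoning.Setoid setoid

  fold : ℕ → (ℕ → Carrier) → Carrier
  fold zero    f = ε
  fold (suc n) f = fold n f ∙ f n

  fold-cong< : ∀ n {f g} → (∀ k → k < n → f k ≈ g k) → fold n f ≈ fold n g
  fold-cong< zero    h = refl
  fold-cong< (suc n) h = ∙-cong (fold-cong< n (λ k k<n → h k (ℕₚ.m<n⇒m<1+n k<n))) (h n ℕₚ.≤-refl)

  fold-cong : ∀ n {f g} → (∀ k → f k ≈ g k) → fold n f ≈ fold n g
  fold-cong n h = fold-cong< n (λ k _ → h k)

  fold-ε : ∀ n {f} → (∀ k → k < n → f k ≈ ε) → fold n f ≈ ε
  fold-ε zero    h = refl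
  fold-ε (suc n) h = trans (∙-cong (fold-ε n (λ k k<n → h k (ℕₚ.m<n⇒m<1+n k<n))) (h n ℕₚ.≤-refl)) (identityˡ ε)

  fold-∙ : ∀ n f g → fold n (λ k → f k ∙ g k) ≈ fold n f ∙ fold n g
  fold-∙ zero    f g = sym (identityˡ ε)
  fold-∙ (suc n) f g = trans (∙-congʳ (fold-∙ n f g)) (interchange _ _ _ _)

  fold-swap : ∀ m n (f : ℕ → ℕ → Carrier) →
              fold m (λ i → fold n (f i)) ≈ fold n (λ j → fold m (λ i → f i j))
  fold-swap zero    n f = sym (fold-ε n (λ _ _ → refl))
  fold-swap (suc m) n f = trans (∙-congʳ (fold-swap m n f)) (sym (fold-∙ n _ _))

  fold-+ : ∀ m n f → fold (m ℕ.+ n) f ≈ fold m f ∙ fold n (λ k → f (m ℕ.+ k))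
  fold-+ m zero    f rewrite ℕₚ.+-identityʳ m = sym (identityʳ _)
  fold-+ m (suc n) f rewrite ℕₚ.+-suc m n = trans (∙-congʳ (fold-+ m n f)) (assoc _ _ _)

  fold-cons : ∀ n f → fold (suc n) f ≈ f 0 ∙ fold n (f ∘ suc)
  fold-cons n f = trans (fold-+ 1 n f) (∙-congʳ (identityˡ _))

  fold-evenOdd : ∀ n f → fold (n ℕ.+ n) f ≈ fold n (λ k → f (k ℕ.+ k)) ∙ fold n (λ k → f (suc (k ℕ.+ k)))
  fold-evenOdd zero    f = sym (identityˡ ε)
  fold-evenOdd (suc n) f rewrite ℕₚ.+-suc n n = begin
    fold (n ℕ.+ n) f ∙ f (n ℕ.+ n) ∙ f (suc (n ℕ.+ n))            ≈⟨ assoc _ _ _ ⟩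
    fold (n ℕ.+ n) f ∙ (f (n ℕ.+ n) ∙ f (suc (n ℕ.+ n)))          ≈⟨ ∙-congʳ (fold-evenOdd n f) ⟩
    (fold n (λ k → f (k ℕ.+ k)) ∙ fold n (λ k → f (suc (k ℕ.+ k)))) ∙ (f (n ℕ.+ n) ∙ f (suc (n ℕ.+ n))) ≈⟨ interchange _ _ _ _ ⟩
    _ ∎

  fold-* : ∀ m n f → fold (m ℕ.* n) f ≈ fold m (λ i → fold n (λ j → f (i ℕ.* n ℕ.+ j)))
  fold-* zero    n f = refl
  fold-* (suc m) n f rewrite ℕₚ.+-comm n (m ℕ.* n) = trans (fold-+ (m ℕ.* n) n f) (∙-congʳ (fold-* m n f))

  fold-middle : ∀ p n r f → (∀ k → k < p → f k ≈ ε) → (∀ k → f (p ℕ.+ n ℕ.+ k) ≈ ε) →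
                fold (p ℕ.+ n ℕ.+ r) f ≈ fold n (λ k → f (p ℕ.+ k))
  fold-middle p n r f below above = begin
    fold (p ℕ.+ n ℕ.+ r) f                              ≈⟨ fold-+ (p ℕ.+ n) r f ⟩
    fold (p ℕ.+ n) f ∙ fold r _                         ≈⟨ ∙-cong (fold-+ p n f) (fold-ε r (λ k _ → above k)) ⟩
    (fold p f ∙ fold n _) ∙ ε                           ≈⟨ identityʳ _ ⟩
    fold p f ∙ fold n _                                 ≈⟨ ∙-congʳ (fold-ε p below) ⟩
    ε ∙ fold n _                                        ≈⟨ identityˡ _ ⟩
    fold n (λ k → f (p ℕ.+ k))                          ∎

-- Two-sided finite sums: parity splitting, translation, rotation.

module BilateralFold (M : CommutativeMonoid 0ℓ 0ℓ) where

  open import Data.Integer using (+_; -[1+_]; ∣_∣)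
  open CommutativeMonoid M
  open Fold M
  open import Relation.Binary.Reasoning.Setoid setoid

  -- The index runs over - n ≤ i < n.
  bil : ℕ → (ℤ → Carrier) → Carrier
  bil n f = fold (n ℕ.+ n) (λ k → f (+ k ℤ.- + n))

  VanishesFrom : ℕ → (ℤ → Carrier) → Set
  VanishesFrom b f = ∀ i → b ≤ ∣ i ∣ → f i ≈ ε

  private
    ∣k-n∣≤n : ∀ k n → k < n ℕ.+ n → ∣ + k ℤ.- + n ∣ ≤ n
    ∣k-n∣≤n k n k<2n rewrite ℤₚ.m-n≡m⊖n k n with ℕₚ.≤-total k n
    ... | inj₁ k≤n rewrite ℤₚ.∣⊖∣-≤ k≤n = ℕₚ.m∸n≤m n k
    ... | inj₂ n≤k rewrite ℤₚ.⊖-≥ n≤k =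
      ℕₚ.≤-trans (ℕₚ.∸-monoˡ-≤ n (ℕₚ.<⇒≤ k<2n)) (ℕₚ.≤-reflexive (ℕₚ.m+n∸n≡m n n))

  bil-cong≤ : ∀ n {f g} → (∀ i → ∣ i ∣ ≤ n → f i ≈ g i) → bil n f ≈ bil n g
  bil-cong≤ n h = fold-cong< (n ℕ.+ n) (λ k k< → h _ (∣k-n∣≤n k n k<))

  bil-cong : ∀ n {f g} → (∀ i → f i ≈ g i) → bil n f ≈ bil n g
  bil-cong n h = fold-cong (n ℕ.+ n) (λ k → h _)

  bil-swap : ∀ m n (f : ℤ → ℤ → Carrier) → bil m (λ i → bil n (f i)) ≈ bil n (λ j → bil m (λ i → f i j))
  bil-swap m n f = fold-swap (m ℕ.+ m) (n ℕ.+ n) _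

  bil-∙ : ∀ n f g → bil n (λ i → f i ∙ g i) ≈ bil n f ∙ bil n g
  bil-∙ n f g = fold-∙ (n ℕ.+ n) _ _

  -- A half-open window -2n ≤ i < 2n consists of exactly two copies of -n ≤ i < n, one for even and
  -- one for odd indices; a window symmetric about 0 would not split this way.
  bil-evenOdd : ∀ n f → bil (n ℕ.+ n) f ≈ bil n (λ i → f (i ℤ.+ i)) ∙ bil n (λ i → f (i ℤ.+ i ℤ.+ + 1))
  bil-evenOdd n f = trans (fold-evenOdd (n ℕ.+ n) _)
    (∙-cong (fold-cong (n ℕ.+ n) (λ k → reflexive (≡.cong f (even k))))
            (fold-cong (n ℕ.+ n) (λ k → reflexive (≡.cong f (odd k)))))
    where
    r₁ : ∀ k n → k ℤ.+ k ℤ.- (n ℤ.+ n) ≡ k ℤ.- n ℤ.+ (k ℤ.- n)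
    r₁ = solve-∀
    r₂ : ∀ k n → + 1 ℤ.+ (k ℤ.+ k) ℤ.- (n ℤ.+ n) ≡ k ℤ.- n ℤ.+ (k ℤ.- n) ℤ.+ + 1
    r₂ = solve-∀
    even : ∀ k → + (k ℕ.+ k) ℤ.- + (n ℕ.+ n) ≡ + k ℤ.- + n ℤ.+ (+ k ℤ.- + n)
    even k = r₁ (+ k) (+ n)
    odd : ∀ k → + suc (k ℕ.+ k) ℤ.- + (n ℕ.+ n) ≡ + k ℤ.- + n ℤ.+ (+ k ℤ.- + n) ℤ.+ + 1
    odd k = r₂ (+ k) (+ n)

  private
    middle : ∀ p b r lo f → VanishesFrom b f → lo ≡ ℤ.- + (p ℕ.+ b) →
             fold (p ℕ.+ (b ℕ.+ b) ℕ.+ r) (λ k → f (+ k ℤ.+ lo)) ≈ bil b f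
    middle p b r lo f van ≡.refl = trans (fold-middle p (b ℕ.+ b) r _ below above)
      (fold-cong (b ℕ.+ b) (λ k → reflexive (≡.cong f (shift (+ p) (+ k) (+ b)))))
      where
      shift : ∀ p k b → p ℤ.+ k ℤ.+ ℤ.- (p ℤ.+ b) ≡ k ℤ.- b
      shift = solve-∀
      far : ∀ p b k → p ℤ.+ (b ℤ.+ b) ℤ.+ k ℤ.+ ℤ.- (p ℤ.+ b) ≡ b ℤ.+ k
      far = solve-∀
      near : ∀ p b k → k ℤ.+ ℤ.- (k ℤ.+ p ℤ.+ b) ≡ ℤ.- (p ℤ.+ b)
      near = solve-∀
      above : ∀ k → f (+ (p ℕ.+ (b ℕ.+ b) ℕ.+ k) ℤ.+ ℤ.- + (p ℕ.+ b)) ≈ ε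
      above k rewrite far (+ p) (+ b) (+ k) = van _ (ℕₚ.m≤m+n b k)
      below : ∀ k → k < p → f (+ k ℤ.+ ℤ.- + (p ℕ.+ b)) ≈ ε
      below k k<p with ℕₚ.m≤n⇒∃[o]m+o≡n (ℕₚ.<⇒≤ k<p)
      ... | o , ≡.refl rewrite near (+ o) (+ b) (+ k) =
        van _ (≡.subst (b ≤_) (≡.sym (ℤₚ.∣-i∣≡∣i∣ (+ (o ℕ.+ b)))) (ℕₚ.m≤n+m b o))

  private
    translate : ∀ m b p r f e → VanishesFrom b f → m ℕ.+ m ≡ p ℕ.+ (b ℕ.+ b) ℕ.+ r →
                ℤ.- + m ℤ.+ e ≡ ℤ.- + (p ℕ.+ b) → bil m (λ i → f (i ℤ.+ e)) ≈ bil b f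
    translate m b p r f e van len lo = begin
      fold (m ℕ.+ m) (λ k → f (+ k ℤ.- + m ℤ.+ e))
        ≈⟨ fold-cong (m ℕ.+ m) (λ k → reflexive (≡.cong f (ℤₚ.+-assoc (+ k) (ℤ.- + m) e))) ⟩
      fold (m ℕ.+ m) (λ k → f (+ k ℤ.+ (ℤ.- + m ℤ.+ e)))
        ≈⟨ reflexive (≡.cong (λ n → fold n (λ k → f (+ k ℤ.+ (ℤ.- + m ℤ.+ e)))) len) ⟩
      fold (p ℕ.+ (b ℕ.+ b) ℕ.+ r) (λ k → f (+ k ℤ.+ (ℤ.- + m ℤ.+ e)))
        ≈⟨ middle p b r _ f van lo ⟩
      bil b f ∎

  -- The window moved by `e` still covers -b ≤ i < b, outside of which `f` vanishes. With slack `o`,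
  -- one side is padded by `o` terms and the other by 2|e| + `o`.
  bil-translate : ∀ m b f e → VanishesFrom b f → ∣ e ∣ ℕ.+ b ≤ m → bil m (λ i → f (i ℤ.+ e)) ≈ bil b f
  bil-translate m b f (+ k) van le with ℕₚ.m≤n⇒∃[o]m+o≡n le
  ... | o , ≡.refl = translate m b o (k ℕ.+ k ℕ.+ o) f (+ k) van (len k b o) (lo (+ k) (+ b) (+ o))
    where
    len : ∀ k b o → k ℕ.+ b ℕ.+ o ℕ.+ (k ℕ.+ b ℕ.+ o) ≡ o ℕ.+ (b ℕ.+ b) ℕ.+ (k ℕ.+ k ℕ.+ o)
    len = solveℕ
    lo : ∀ k b o → ℤ.- (k ℤ.+ b ℤ.+ o) ℤ.+ k ≡ ℤ.- (o ℤ.+ b)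
    lo = solve-∀
  bil-translate m b f -[1+ k ] van le with ℕₚ.m≤n⇒∃[o]m+o≡n le
  ... | o , ≡.refl = translate m b (suc k ℕ.+ suc k ℕ.+ o) o f -[1+ k ] van (len (suc k) b o) (lo (+ suc k) (+ b) (+ o))
    where
    len : ∀ k b o → k ℕ.+ b ℕ.+ o ℕ.+ (k ℕ.+ b ℕ.+ o) ≡ k ℕ.+ k ℕ.+ o ℕ.+ (b ℕ.+ b) ℕ.+ o
    len = solveℕ
    lo : ∀ k b o → ℤ.- (k ℤ.+ b ℤ.+ o) ℤ.+ ℤ.- k ≡ ℤ.- (k ℤ.+ k ℤ.+ o ℤ.+ b)
    lo = solve-∀

  bil-extend : ∀ m b f → VanishesFrom b f → b ≤ m → bil m f ≈ bil b f
  bil-extend m b f van b≤m = trans (bil-cong m (λ i → reflexive (≡.cong f (≡.sym (ℤₚ.+-identityʳ i)))))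
                                   (bil-translate m b f (+ 0) van b≤m)

  -- Pairs (i , j) are indexed by (s - e , s + e) if i + j is even and by (s - e , s + e + 1) if it is odd.
  bil-rotate : ∀ b (g : ℤ → ℤ → Carrier) → (∀ i → VanishesFrom b (g i)) → (∀ j → VanishesFrom b (λ i → g i j)) →
    bil b (λ i → bil b (g i)) ≈
    bil b (λ e → bil (b ℕ.+ b) (λ s → g (s ℤ.- e) (s ℤ.+ e)) ∙ bil (b ℕ.+ b) (λ s → g (s ℤ.- e) (s ℤ.+ e ℤ.+ + 1)))
  bil-rotate b g van₂ van₁ = begin
    bil b (λ i → bil b (g i))
      -- The inner variable becomes d = j - i. As |i| ≤ b, half-width 2b suffices for d, and the
      -- parity of d produces the two families.
      ≈⟨ bil-cong≤ b (λ i ∣i∣≤b → sym (bil-translate (b ℕ.+ b) b (g i) i (van₂ i) (ℕₚ.+-monoˡ-≤ b ∣i∣≤b))) ⟩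
    bil b (λ i → bil (b ℕ.+ b) (λ d → g i (d ℤ.+ i)))
      ≈⟨ bil-swap b (b ℕ.+ b) (λ i d → g i (d ℤ.+ i)) ⟩
    bil (b ℕ.+ b) (λ d → bil b (λ i → g i (d ℤ.+ i)))
      ≈⟨ bil-evenOdd b (λ d → bil b (λ i → g i (d ℤ.+ i))) ⟩
    bil b (λ e → bil b (λ i → g i (e ℤ.+ e ℤ.+ i))) ∙ bil b (λ e → bil b (λ i → g i (e ℤ.+ e ℤ.+ + 1 ℤ.+ i)))
      ≈⟨ bil-∙ b (λ e → bil b (λ i → g i (e ℤ.+ e ℤ.+ i))) (λ e → bil b (λ i → g i (e ℤ.+ e ℤ.+ + 1 ℤ.+ i))) ⟨
    bil b (λ e → bil b (λ i → g i (e ℤ.+ e ℤ.+ i)) ∙ bil b (λ i → g i (e ℤ.+ e ℤ.+ + 1 ℤ.+ i)))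
      ≈⟨ bil-cong≤ b (λ e ∣e∣≤b → ∙-cong (shear (e ℤ.+ e) e ∣e∣≤b _ (even e)) (shear (e ℤ.+ e ℤ.+ + 1) e ∣e∣≤b _ (odd e))) ⟩
    _ ∎
    where
    even : ∀ e s → e ℤ.+ e ℤ.+ (s ℤ.- e) ≡ s ℤ.+ e
    even = solve-∀
    odd : ∀ e s → e ℤ.+ e ℤ.+ + 1 ℤ.+ (s ℤ.- e) ≡ s ℤ.+ e ℤ.+ + 1
    odd = solve-∀
    shear : ∀ d e → ∣ e ∣ ≤ b → (h : ℤ → ℤ) → (∀ s → d ℤ.+ (s ℤ.- e) ≡ h s) →
            bil b (λ i → g i (d ℤ.+ i)) ≈ bil (b ℕ.+ b) (λ s → g (s ℤ.- e) (h s))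
    shear d e ∣e∣≤b h eq = trans
      (sym (bil-translate (b ℕ.+ b) b (λ i → g i (d ℤ.+ i)) (ℤ.- e) (λ i → van₁ _ i)
             (ℕₚ.+-monoˡ-≤ b (ℕₚ.≤-trans (ℕₚ.≤-reflexive (ℤₚ.∣-i∣≡∣i∣ e)) ∣e∣≤b))))
      (bil-cong (b ℕ.+ b) (λ s → reflexive (≡.cong (g (s ℤ.- e)) (eq s))))

-- Exponents of theta terms.

module TriangularExponents where

  open import Data.Integer using (+_; -[1+_]; ∣_∣; _+_; _*_; _-_; -_)
  open ≡ using (refl; sym; trans; cong; cong₂; module ≡-Reasoning)

  tri : ℕ → ℕ
  tri zero    = 0
  tri (suc n) = suc n ℕ.+ tri n

  -- i (i + 1) / 2
  Tri : ℤ → ℕ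
  Tri (+ n)    = tri n
  Tri -[1+ n ] = tri n

  -- The exponent of x in A ^ Tri i * B ^ Tri (- i) when A and B contain x ^ a and x ^ b.
  weight : ℤ → ℕ → ℕ → ℕ
  weight i a b = Tri i ℕ.* a ℕ.+ Tri (- i) ℕ.* b

  T-double : ∀ i → + Tri i * + 2 ≡ i * i + i
  T-double (+ n) = tri-double n
    where
    step : ∀ n → (+ 1 + n) * + 2 + (n * n + n) ≡ (+ 1 + n) * (+ 1 + n) + (+ 1 + n)
    step = solve-∀
    tri-double : ∀ n → + tri n * + 2 ≡ + n * + n + + n
    tri-double zero    = refl
    tri-double (suc n) = trans (ℤₚ.*-distribʳ-+ (+ 2) (+ suc n) (+ tri n))
                               (trans (cong (λ z → + suc n * + 2 + z) (tri-double n)) (step (+ n)))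
  T-double -[1+ n ] = trans (T-double (+ n)) (step (+ n))
    where
    step : ∀ n → n * n + n ≡ - (+ 1 + n) * - (+ 1 + n) + - (+ 1 + n)
    step = solve-∀

  -- Triangular numbers hide a division by 2. Doubled and moved to ℤ they are polynomials in the
  -- index, so identities of exponents in ℕ are left to the ring solver.
  undouble : ∀ {m n z} → + m * + 2 ≡ z → + n * + 2 ≡ z → m ≡ n
  undouble {m} {n} p q = ℤₚ.+-injective (ℤₚ.*-cancelʳ-≡ (+ m) (+ n) (+ 2) (trans p (sym q)))

  double-+ : ∀ m n {y z} → + m * + 2 ≡ y → + n * + 2 ≡ z → + (m ℕ.+ n) * + 2 ≡ y + z
  double-+ m n p q = trans (ℤₚ.*-distribʳ-+ (+ 2) (+ m) (+ n)) (cong₂ _+_ p q)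

  weight-double : ∀ i a b → + weight i a b * + 2 ≡ (i * i + i) * + a + (i * i - i) * + b
  weight-double i a b = begin
    (+ (Tri i ℕ.* a) + + (Tri (- i) ℕ.* b)) * + 2        ≡⟨ cong₂ (λ x y → (x + y) * + 2) (ℤₚ.pos-* (Tri i) a) (ℤₚ.pos-* (Tri (- i)) b) ⟩
    (+ Tri i * + a + + Tri (- i) * + b) * + 2            ≡⟨ s₁ (+ Tri i) (+ a) (+ Tri (- i)) (+ b) ⟩
    + Tri i * + 2 * + a + + Tri (- i) * + 2 * + b        ≡⟨ cong₂ (λ x y → x * + a + y * + b) (T-double i) (T-double (- i)) ⟩
    (i * i + i) * + a + (- i * - i + - i) * + b      ≡⟨ s₂ i (+ a) (+ b) ⟩
    (i * i + i) * + a + (i * i - i) * + b            ∎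
    where
    open ≡-Reasoning
    s₁ : ∀ t a u b → (t * a + u * b) * + 2 ≡ t * + 2 * a + u * + 2 * b
    s₁ = solve-∀
    s₂ : ∀ i a b → (i * i + i) * a + (- i * - i + - i) * b ≡ (i * i + i) * a + (i * i - i) * b
    s₂ = solve-∀

  weights-double : ∀ i a b j c d → + (weight i a b ℕ.+ weight j c d) * + 2 ≡
    (i * i + i) * + a + (i * i - i) * + b + ((j * j + j) * + c + (j * j - j) * + d)
  weights-double i a b j c d = double-+ (weight i a b) (weight j c d) (weight-double i a b) (weight-double j c d)

  module _ (e s : ℤ) where

    -- The quadratic part of all these exponents is a multiple of i² + j², which becomes 2s² + 2e²
    -- for i = s - e, j = s + e. Without a mixed term in s and e the summand separates.
    weight-even-c : weight (s - e) 1 1 ℕ.+ weight (s + e) 1 1 ≡ weight s 2 2 ℕ.+ weight e 2 2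
    weight-even-c = undouble (trans (weights-double (s - e) 1 1 (s + e) 1 1) (eq e s)) (weights-double s 2 2 e 2 2)
      where
      eq : ∀ e s → let i = s - e; j = s + e in
        (i * i + i) * + 1 + (i * i - i) * + 1 + ((j * j + j) * + 1 + (j * j - j) * + 1) ≡
        (s * s + s) * + 2 + (s * s - s) * + 2 + ((e * e + e) * + 2 + (e * e - e) * + 2)
      eq = solve-∀

    weight-even-Z : weight (s - e) 0 1 ℕ.+ weight (s + e) 1 0 ≡ weight s 1 1 ℕ.+ weight e 2 0
    weight-even-Z = undouble (trans (weights-double (s - e) 0 1 (s + e) 1 0) (eq e s)) (weights-double s 1 1 e 2 0)
      where
      eq : ∀ e s → let i = s - e; j = s + e in
        (i * i + i) * + 0 + (i * i - i) * + 1 + ((j * j + j) * + 1 + (j * j - j) * + 0) ≡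
        (s * s + s) * + 1 + (s * s - s) * + 1 + ((e * e + e) * + 2 + (e * e - e) * + 0)
      eq = solve-∀

    weight-even-Y : weight (s - e) 0 1 ℕ.+ weight (s + e) 0 1 ≡ weight s 0 2 ℕ.+ weight e 1 1
    weight-even-Y = undouble (trans (weights-double (s - e) 0 1 (s + e) 0 1) (eq e s)) (weights-double s 0 2 e 1 1)
      where
      eq : ∀ e s → let i = s - e; j = s + e in
        (i * i + i) * + 0 + (i * i - i) * + 1 + ((j * j + j) * + 0 + (j * j - j) * + 1) ≡
        (s * s + s) * + 0 + (s * s - s) * + 2 + ((e * e + e) * + 1 + (e * e - e) * + 1)
      eq = solve-∀

    -- For j = s + e + 1 the mixed terms cancel too. The constant 1 left over is the coefficient `c`
    -- of the second summand in `Θ*Θ`, and the index e + 1 puts the second factor back into the form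
    -- of a theta term.
    weight-odd-c : weight (s - e) 1 1 ℕ.+ weight (s + e + + 1) 1 1 ≡ 1 ℕ.+ (weight s 4 0 ℕ.+ weight (e + + 1) 0 4)
    weight-odd-c = undouble (trans (weights-double (s - e) 1 1 (s + e + + 1) 1 1) (eq e s))
                            (double-+ 1 (weight s 4 0 ℕ.+ weight (e + + 1) 0 4) refl (weights-double s 4 0 (e + + 1) 0 4))
      where
      eq : ∀ e s → let i = s - e; j = s + e + + 1; d = e + + 1 in
        (i * i + i) * + 1 + (i * i - i) * + 1 + ((j * j + j) * + 1 + (j * j - j) * + 1) ≡
        + 2 + ((s * s + s) * + 4 + (s * s - s) * + 0 + ((d * d + d) * + 0 + (d * d - d) * + 4))
      eq = solve-∀

    weight-odd-Z : weight (s - e) 0 1 ℕ.+ weight (s + e + + 1) 1 0 ≡ weight s 2 0 ℕ.+ weight (e + + 1) 1 1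
    weight-odd-Z = undouble (trans (weights-double (s - e) 0 1 (s + e + + 1) 1 0) (eq e s)) (weights-double s 2 0 (e + + 1) 1 1)
      where
      eq : ∀ e s → let i = s - e; j = s + e + + 1; d = e + + 1 in
        (i * i + i) * + 0 + (i * i - i) * + 1 + ((j * j + j) * + 1 + (j * j - j) * + 0) ≡
        (s * s + s) * + 2 + (s * s - s) * + 0 + ((d * d + d) * + 1 + (d * d - d) * + 1)
      eq = solve-∀

    weight-odd-Y : weight (s - e) 0 1 ℕ.+ weight (s + e + + 1) 0 1 ≡ weight s 1 1 ℕ.+ weight (e + + 1) 0 2
    weight-odd-Y = undouble (trans (weights-double (s - e) 0 1 (s + e + + 1) 0 1) (eq e s)) (weights-double s 1 1 (e + + 1) 0 2)
      where
      eq : ∀ e s → let i = s - e; j = s + e + + 1; d = e + + 1 in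
        (i * i + i) * + 0 + (i * i - i) * + 1 + ((j * j + j) * + 0 + (j * j - j) * + 1) ≡
        (s * s + s) * + 1 + (s * s - s) * + 1 + ((d * d + d) * + 0 + (d * d - d) * + 2)
      eq = solve-∀

  T-neg-suc : ∀ i → Tri (- (i + + 1)) ≡ Tri i
  T-neg-suc i = undouble (trans (T-double (- (i + + 1))) (step i)) (T-double i)
    where
    step : ∀ i → - (i + + 1) * - (i + + 1) + - (i + + 1) ≡ i * i + i
    step = solve-∀

  n≤tri : ∀ n → n ≤ tri n
  n≤tri zero    = z≤n
  n≤tri (suc n) = ℕₚ.m≤m+n (suc n) (tri n)

  ∣i∣≤1+T : ∀ i → ∣ i ∣ ≤ suc (Tri i)
  ∣i∣≤1+T (+ n)    = ℕₚ.m≤n⇒m≤1+n (n≤tri n)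
  ∣i∣≤1+T -[1+ n ] = s≤s (n≤tri n)

  ∣i∣≤T+T : ∀ i → ∣ i ∣ ≤ Tri i ℕ.+ Tri (- i)
  ∣i∣≤T+T (+ n)    = ℕₚ.≤-trans (n≤tri n) (ℕₚ.m≤m+n (tri n) _)
  ∣i∣≤T+T -[1+ n ] = ℕₚ.m≤n⇒m≤o+n (tri n) (n≤tri (suc n))

  -- `Tri` vanishes at -1, where the bound would fail; hence it starts at 2, and hence the
  -- hypothesis `2 ≤ b` of the theta identities.
  ∣i∣≤T*4 : ∀ i → 2 ≤ ∣ i ∣ → ∣ i ∣ ≤ Tri i ℕ.* 4
  ∣i∣≤T*4 i 2≤∣i∣ with Tri i | ∣i∣≤1+T i
  ... | zero  | ∣i∣≤1 = ⊥-elim (ℕₚ.<-irrefl refl (ℕₚ.≤-trans 2≤∣i∣ ∣i∣≤1))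
  ... | suc t | ∣i∣≤2+t = ℕₚ.≤-trans ∣i∣≤2+t (s≤s (s≤s (ℕₚ.m≤n⇒m≤1+n (ℕₚ.m≤n⇒m≤1+n (ℕₚ.m≤m*n t 4)))))

-- The product of two theta series, summed along diagonals.

module ThetaSeries (R : CommutativeRing 0ℓ 0ℓ) where

  open import Data.Integer using (+_; ∣_∣)
  open CommutativeRing R hiding (zero)
  open import Algebra.Properties.Semiring.Exp semiring
  open import Algebra.Properties.CommutativeSemiring.Exp commutativeSemiring using (^-distrib-*)
  open import Algebra.Properties.CommutativeSemigroup *-commutativeSemigroup using () renaming (interchange to *-interchange)
  open import Algebra.Solver.Ring.NaturalCoefficients.Default commutativeSemiring using (solve; _:=_; _:*_; _:^_)
  open import Relation.Binary.Reasoning.Setoid setoid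
  open Fold +-commutativeMonoid
  open BilateralFold +-commutativeMonoid
  open TriangularExponents

  ^-vanish : ∀ {x b n} → x ^ b ≈ 0# → b ≤ n → x ^ n ≈ 0#
  ^-vanish {x} {b} x^b≈0 b≤n with ℕₚ.m≤n⇒∃[o]m+o≡n b≤n
  ... | o , ≡.refl = trans (^-homo-* x b o) (trans (*-congʳ x^b≈0) (zeroˡ _))

  term : Carrier → Carrier → ℤ → Carrier
  term A B i = A ^ Tri i * B ^ Tri (ℤ.- i)

  -- A truncation of Ramanujan's theta function f(A, B). Taking both A and B as arguments avoids the
  -- inverse in the form j(u) with B = Q/u.
  Θ : ℕ → Carrier → Carrier → Carrier
  Θ n A B = bil n (term A B)

  term-cong : ∀ {A A′ B B′} → A ≈ A′ → B ≈ B′ → ∀ i → term A B i ≈ term A′ B′ i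
  term-cong p q i = *-cong (^-congˡ (Tri i) p) (^-congˡ (Tri (ℤ.- i)) q)

  Θ-cong : ∀ n {A A′ B B′} → A ≈ A′ → B ≈ B′ → Θ n A B ≈ Θ n A′ B′
  Θ-cong n p q = bil-cong n (term-cong p q)

  fold-*ˡ : ∀ n x f → fold n (λ k → x * f k) ≈ x * fold n f
  fold-*ˡ zero    x f = sym (zeroʳ x)
  fold-*ˡ (suc n) x f = trans (+-congʳ (fold-*ˡ n x f)) (sym (distribˡ x _ _))

  bil-*ˡ : ∀ n x f → bil n (λ i → x * f i) ≈ x * bil n f
  bil-*ˡ n x f = fold-*ˡ (n ℕ.+ n) x _

  bil-*ʳ : ∀ n f x → bil n (λ i → f i * x) ≈ bil n f * x
  bil-*ʳ n f x = trans (bil-cong n (λ i → *-comm (f i) x)) (trans (bil-*ˡ n x f) (*-comm x _))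

  -- With Q = X X′ the summands are Q^(i²) X^i for `φ` and Q^(i²-i) X^i for `ψ`. The argument `X′`
  -- stands for Q/X.
  φ ψ : ℕ → Carrier → Carrier → Carrier
  φ n X X′ = Θ n (X * X * X′) X′
  ψ n X X′ = Θ n X (X * (X′ * X′))

  φ-cong : ∀ n {X X′ Y Y′} → X ≈ Y → X′ ≈ Y′ → φ n X X′ ≈ φ n Y Y′
  φ-cong n p q = Θ-cong n (*-cong (*-cong p p) q) q

  ψ-cong : ∀ n {X X′ Y Y′} → X ≈ Y → X′ ≈ Y′ → ψ n X X′ ≈ ψ n Y Y′
  ψ-cong n p q = Θ-cong n p (*-cong p (*-cong q q))

  module _ (b : ℕ) (2≤b : 2 ≤ b) (c Z Y : Carrier) (c^b≈0 : c ^ b ≈ 0#) where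

    private
      -- All terms are monomials in c, Z and Y, so that identities between products of terms reduce
      -- to three identities of exponents. The power of the nilpotent `c` decides where terms
      -- vanish.
      mon : ℕ → ℕ → ℕ → Carrier
      mon k l m = c ^ k * (Z ^ l * Y ^ m)

      mon-^ : ∀ n k l m → mon k l m ^ n ≈ mon (n ℕ.* k) (n ℕ.* l) (n ℕ.* m)
      mon-^ n k l m = trans (^-distrib-* _ _ n) (*-cong (pow c k) (trans (^-distrib-* _ _ n) (*-cong (pow Z l) (pow Y m))))
        where
        pow : ∀ x a → (x ^ a) ^ n ≈ x ^ (n ℕ.* a)
        pow x a = trans (^-assocʳ x a n) (^-congʳ x (ℕₚ.*-comm a n))

      mon-* : ∀ k l m k′ l′ m′ → mon k l m * mon k′ l′ m′ ≈ mon (k ℕ.+ k′) (l ℕ.+ l′) (m ℕ.+ m′)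
      mon-* k l m k′ l′ m′ = trans (*-interchange _ _ _ _)
        (*-cong (sym (^-homo-* c k k′)) (trans (*-interchange _ _ _ _) (*-cong (sym (^-homo-* Z l l′)) (sym (^-homo-* Y m m′)))))

      mon-≡ : ∀ {k l m k′ l′ m′} → k ≡ k′ → l ≡ l′ → m ≡ m′ → mon k l m ≈ mon k′ l′ m′
      mon-≡ ≡.refl ≡.refl ≡.refl = refl

      mon-vanish : ∀ {k} l m → b ≤ k → mon k l m ≈ 0#
      mon-vanish l m b≤k = trans (*-congʳ (^-vanish c^b≈0 b≤k)) (zeroˡ _)

      module _ (k l m k′ l′ m′ : ℕ) where
        t : ℤ → Carrier
        t = term (mon k l m) (mon k′ l′ m′)

        t≈mon : ∀ i → t i ≈ mon (weight i k k′) (weight i l l′) (weight i m m′)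
        t≈mon i = trans (*-cong (mon-^ (Tri i) k l m) (mon-^ (Tri (ℤ.- i)) k′ l′ m′)) (mon-* (Tri i ℕ.* k) (Tri i ℕ.* l) (Tri i ℕ.* m) (Tri (ℤ.- i) ℕ.* k′) (Tri (ℤ.- i) ℕ.* l′) (Tri (ℤ.- i) ℕ.* m′))

        t-vanish : (∀ i → b ≤ ∣ i ∣ → b ≤ weight i k k′) → VanishesFrom b t
        t-vanish h i b≤∣i∣ = trans (t≈mon i) (mon-vanish (weight i l l′) (weight i m m′) (h i b≤∣i∣))

      t*t≈mon : ∀ i j k l m k′ l′ m′ p q r p′ q′ r′ → t k l m k′ l′ m′ i * t p q r p′ q′ r′ j ≈
                mon (weight i k k′ ℕ.+ weight j p p′) (weight i l l′ ℕ.+ weight j q q′) (weight i m m′ ℕ.+ weight j r r′)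
      t*t≈mon i j k l m k′ l′ m′ p q r p′ q′ r′ = trans (*-cong (t≈mon k l m k′ l′ m′ i) (t≈mon p q r p′ q′ r′ j))
        (mon-* (weight i k k′) (weight i l l′) (weight i m m′) (weight j p p′) (weight j q q′) (weight j r r′))

      tC tA u v u′ v′ : ℤ → Carrier
      tC = t 1 0 0 1 1 1
      tA = t 1 1 0 1 0 1
      u  = t 2 1 0 2 1 2
      v  = t 2 2 1 2 0 1
      u′ = t 4 2 1 0 0 1
      v′ = t 0 1 0 4 1 2

      even-step : ∀ e s → tC (s ℤ.- e) * tA (s ℤ.+ e) ≈ u s * v e
      even-step e s = trans (t*t≈mon (s ℤ.- e) (s ℤ.+ e) 1 0 0 1 1 1 1 1 0 1 0 1)
        (trans (mon-≡ (weight-even-c e s) (weight-even-Z e s) (weight-even-Y e s))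
               (sym (t*t≈mon s e 2 1 0 2 1 2 2 2 1 2 0 1)))

      odd-step : ∀ e s → tC (s ℤ.- e) * tA (s ℤ.+ e ℤ.+ + 1) ≈ c * (u′ s * v′ (e ℤ.+ + 1))
      odd-step e s = trans (t*t≈mon (s ℤ.- e) (s ℤ.+ e ℤ.+ + 1) 1 0 0 1 1 1 1 1 0 1 0 1)
        (trans (mon-≡ (weight-odd-c e s) (weight-odd-Z e s) (weight-odd-Y e s))
        (trans (*-assoc c _ _)
               (*-congˡ (sym (t*t≈mon s (e ℤ.+ + 1) 4 2 1 0 0 1 0 1 0 4 1 2)))))

      square : ∀ a i → b ≤ ∣ i ∣ → b ≤ weight i (suc a) (suc a)
      square a i b≤∣i∣ = ℕₚ.≤-trans b≤∣i∣ (ℕₚ.≤-trans (∣i∣≤T+T i)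
        (ℕₚ.+-mono-≤ (ℕₚ.m≤m*n (Tri i) (suc a)) (ℕₚ.m≤m*n (Tri (ℤ.- i)) (suc a))))

      triangle : ∀ i → b ≤ ∣ i ∣ → b ≤ Tri i ℕ.* 4
      triangle i b≤∣i∣ = ℕₚ.≤-trans b≤∣i∣ (∣i∣≤T*4 i (ℕₚ.≤-trans 2≤b b≤∣i∣))

      tC-vanish : VanishesFrom b tC
      tC-vanish = t-vanish 1 0 0 1 1 1 (square 0)
      tA-vanish : VanishesFrom b tA
      tA-vanish = t-vanish 1 1 0 1 0 1 (square 0)
      v-vanish : VanishesFrom b v
      v-vanish = t-vanish 2 2 1 2 0 1 (square 1)
      v′-vanish : VanishesFrom b v′
      v′-vanish = t-vanish 0 1 0 4 1 2 (λ i b≤∣i∣ → ℕₚ.m≤n⇒m≤o+n (Tri i ℕ.* 0)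
        (triangle (ℤ.- i) (ℕₚ.≤-trans b≤∣i∣ (ℕₚ.≤-reflexive (≡.sym (ℤₚ.∣-i∣≡∣i∣ i))))))
      -- The powers of `c` in `v′` come from Tri(-i) alone, and Tri(-(e + 1)) = Tri e, so the shift
      -- of the index does not enlarge the window.
      v′₁-vanish : VanishesFrom b (λ e → v′ (e ℤ.+ + 1))
      v′₁-vanish e b≤∣e∣ = trans (t≈mon 0 1 0 4 1 2 (e ℤ.+ + 1)) (mon-vanish (weight (e ℤ.+ + 1) 1 1) (weight (e ℤ.+ + 1) 0 2) (ℕₚ.m≤n⇒m≤o+n (Tri (e ℤ.+ + 1) ℕ.* 0)
        (ℕₚ.≤-trans (triangle e b≤∣e∣) (ℕₚ.≤-reflexive (≡.cong (ℕ._* 4) (≡.sym (T-neg-suc e)))))))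

      2b : ℕ
      2b = b ℕ.+ b

      b≤2b : b ≤ 2b
      b≤2b = ℕₚ.m≤m+n b b

      -- After rotation each summand is a function of s times a function of e, so each parity class
      -- becomes a product of two sums. The sums over e arise on the window b, those over s on 2b;
      -- the former are extended at the end.
      double-sum : bil 2b tC * bil 2b tA ≈ bil 2b u * bil 2b v + c * (bil 2b u′ * bil 2b v′)
      double-sum = begin
        bil 2b tC * bil 2b tA
          ≈⟨ *-cong (bil-extend 2b b tC tC-vanish b≤2b) (bil-extend 2b b tA tA-vanish b≤2b) ⟩
        bil b tC * bil b tA
          ≈⟨ bil-*ʳ b tC _ ⟨
        bil b (λ i → tC i * bil b tA)
          ≈⟨ bil-cong b (λ i → bil-*ˡ b (tC i) tA) ⟨
        bil b (λ i → bil b (λ j → tC i * tA j))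
          ≈⟨ bil-rotate b (λ i j → tC i * tA j)
               (λ i j b≤∣j∣ → trans (*-congˡ (tA-vanish j b≤∣j∣)) (zeroʳ _))
               (λ j i b≤∣i∣ → trans (*-congʳ (tC-vanish i b≤∣i∣)) (zeroˡ _)) ⟩
        bil b (λ e → bil 2b (λ s → tC (s ℤ.- e) * tA (s ℤ.+ e)) + bil 2b (λ s → tC (s ℤ.- e) * tA (s ℤ.+ e ℤ.+ + 1)))
          ≈⟨ bil-cong b (λ e → +-cong (trans (bil-cong 2b (even-step e)) (bil-*ʳ 2b u (v e)))
               (trans (bil-cong 2b (odd-step e)) (trans (bil-*ˡ 2b c (λ s → u′ s * v′ (e ℤ.+ + 1))) (*-congˡ (bil-*ʳ 2b u′ (v′ (e ℤ.+ + 1))))))) ⟩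
        bil b (λ e → bil 2b u * v e + c * (bil 2b u′ * v′ (e ℤ.+ + 1)))
          ≈⟨ bil-∙ b (λ e → bil 2b u * v e) (λ e → c * (bil 2b u′ * v′ (e ℤ.+ + 1))) ⟩
        bil b (λ e → bil 2b u * v e) + bil b (λ e → c * (bil 2b u′ * v′ (e ℤ.+ + 1)))
          ≈⟨ +-cong (bil-*ˡ b _ v) (trans (bil-*ˡ b c (λ e → bil 2b u′ * v′ (e ℤ.+ + 1))) (*-congˡ (bil-*ˡ b (bil 2b u′) (λ e → v′ (e ℤ.+ + 1))))) ⟩
        bil 2b u * bil b v + c * (bil 2b u′ * bil b (λ e → v′ (e ℤ.+ + 1)))
          ≈⟨ +-cong (*-congˡ (sym (bil-extend 2b b v v-vanish b≤2b))) (*-congˡ (*-congˡ shift)) ⟩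
        bil 2b u * bil 2b v + c * (bil 2b u′ * bil 2b v′) ∎
        where
        shift : bil b (λ e → v′ (e ℤ.+ + 1)) ≈ bil 2b v′
        shift = begin
          -- Translation by 1 requires half-width b + 1, so the window is widened before it and
          -- adjusted to 2b after it.
          bil b (λ e → v′ (e ℤ.+ + 1))       ≈⟨ bil-extend (suc b) b _ v′₁-vanish (ℕₚ.n≤1+n b) ⟨
          bil (suc b) (λ e → v′ (e ℤ.+ + 1)) ≈⟨ bil-translate (suc b) b v′ (+ 1) v′-vanish ℕₚ.≤-refl ⟩
          bil b v′                           ≈⟨ bil-extend 2b b v′ v′-vanish b≤2b ⟨
          bil 2b v′                          ∎

    Θ*Θ : Θ 2b (c * Z) (c * Y) * Θ 2b c (c * Y * Z) ≈
          ψ 2b (c * c * Z) Y * φ 2b Z (c * c * Y) + c * (φ 2b (c * c * Z) Y * ψ 2b Z (c * c * Y))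
    Θ*Θ = begin
      Θ 2b (c * Z) (c * Y) * Θ 2b c (c * Y * Z)
        ≈⟨ *-comm _ _ ⟩
      Θ 2b c (c * Y * Z) * Θ 2b (c * Z) (c * Y)
        ≈⟨ *-cong (Θ-cong 2b (solve 3 (λ c Z Y → c := c :^ 1 :* (Z :^ 0 :* Y :^ 0)) refl c Z Y)
                             (solve 3 (λ c Z Y → c :* Y :* Z := c :^ 1 :* (Z :^ 1 :* Y :^ 1)) refl c Z Y))
                  (Θ-cong 2b (solve 3 (λ c Z Y → c :* Z := c :^ 1 :* (Z :^ 1 :* Y :^ 0)) refl c Z Y)
                             (solve 3 (λ c Z Y → c :* Y := c :^ 1 :* (Z :^ 0 :* Y :^ 1)) refl c Z Y)) ⟩
      bil 2b tC * bil 2b tA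
        ≈⟨ double-sum ⟩
      bil 2b u * bil 2b v + c * (bil 2b u′ * bil 2b v′)
        ≈⟨ +-cong (*-cong (Θ-cong 2b (solve 3 (λ c Z Y → c :^ 2 :* (Z :^ 1 :* Y :^ 0) := c :* c :* Z) refl c Z Y)
                                     (solve 3 (λ c Z Y → c :^ 2 :* (Z :^ 1 :* Y :^ 2) := c :* c :* Z :* (Y :* Y)) refl c Z Y))
                          (Θ-cong 2b (solve 3 (λ c Z Y → c :^ 2 :* (Z :^ 2 :* Y :^ 1) := Z :* Z :* (c :* c :* Y)) refl c Z Y)
                                     (solve 3 (λ c Z Y → c :^ 2 :* (Z :^ 0 :* Y :^ 1) := c :* c :* Y) refl c Z Y)))
            (*-congˡ (*-cong (Θ-cong 2b (solve 3 (λ c Z Y → c :^ 4 :* (Z :^ 2 :* Y :^ 1) := c :* c :* Z :* (c :* c :* Z) :* Y) refl c Z Y)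
                                     (solve 3 (λ c Z Y → c :^ 0 :* (Z :^ 0 :* Y :^ 1) := Y) refl c Z Y))
                          (Θ-cong 2b (solve 3 (λ c Z Y → c :^ 0 :* (Z :^ 1 :* Y :^ 0) := Z) refl c Z Y)
                                     (solve 3 (λ c Z Y → c :^ 4 :* (Z :^ 1 :* Y :^ 2) := Z :* (c :* c :* Y :* (c :* c :* Y))) refl c Z Y)))) ⟩
      ψ 2b (c * c * Z) Y * φ 2b Z (c * c * Y) + c * (φ 2b (c * c * Z) Y * ψ 2b Z (c * c * Y)) ∎

-- Weierstrass' three-term relation for theta series.

module WeierstrassRelation (R : CommutativeRing 0ℓ 0ℓ) where

  open CommutativeRing R hiding (zero)
  open import Algebra.Properties.Ring ring using (-1*x≈-x; -‿involutive)
  open import Algebra.Properties.Semiring.Exp semiring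
  open import Algebra.Properties.CommutativeSemiring.Exp commutativeSemiring using (^-distrib-*)
  open import Algebra.Solver.Ring.NaturalCoefficients.Default commutativeSemiring using (solve; _:=_; _:+_; _:*_; con)
  open import Relation.Binary.Reasoning.Setoid setoid
  open ThetaSeries R

  -- Signs are written as factors -1#, so that all identities below are within reach of the semiring solver.
  -1# : Carrier
  -1# = - 1#

  1+-1≈0 : 1# + -1# ≈ 0#
  1+-1≈0 = -‿inverseʳ 1#

  -1*-1≈1 : -1# * -1# ≈ 1#
  -1*-1≈1 = trans (-1*x≈-x -1#) (-‿involutive 1#)

  module _ (b : ℕ) (2≤b : 2 ≤ b) where

    2b : ℕ
    2b = b ℕ.+ b

    -- j(xz) j(x/z) for m = x/z, Z = z² and Y = Q/x², where j(u) = Θ (-u) (-Q/u).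
    ΘΘ : Carrier → Carrier → Carrier → Carrier
    ΘΘ m Z Y = Θ 2b (-1# * (m * Z)) (-1# * (m * Y)) * Θ 2b (-1# * m) (-1# * (m * Y * Z))

    -- This is `Θ*Θ` for c = -m, whose square loses the sign. `X` = x² and `Z′` = Q/z² are separate
    -- arguments so that literally the same values of `ψ` and `φ` occur in all six determinants of
    -- the relation.
    ΘΘ-det : ∀ m Z Y X Z′ → m ^ b ≈ 0# → m * m * Z ≈ X → m * m * Y ≈ Z′ →
             ΘΘ m Z Y ≈ ψ 2b X Y * φ 2b Z Z′ + -1# * m * (φ 2b X Y * ψ 2b Z Z′)
    ΘΘ-det m Z Y X Z′ m^b≈0 mmZ≈X mmY≈Z′ = begin
      ΘΘ m Z Y
        ≈⟨ *-cong (Θ-cong 2b (*-assoc _ _ _) (*-assoc _ _ _))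
                  (Θ-cong 2b refl (solve 4 (λ e m Y Z → e :* m :* Y :* Z := e :* (m :* Y :* Z)) refl -1# m Y Z)) ⟨
      Θ 2b (-1# * m * Z) (-1# * m * Y) * Θ 2b (-1# * m) (-1# * m * Y * Z)
        ≈⟨ Θ*Θ b 2≤b (-1# * m) Z Y (trans (^-distrib-* -1# m b) (trans (*-congˡ m^b≈0) (zeroʳ _))) ⟩
      ψ 2b (c * c * Z) Y * φ 2b Z (c * c * Y) + c * (φ 2b (c * c * Z) Y * ψ 2b Z (c * c * Y))
        ≈⟨ +-cong (*-cong (ψ-cong 2b X≈ refl) (φ-cong 2b refl Z′≈))
                  (*-congˡ (*-cong (φ-cong 2b X≈ refl) (ψ-cong 2b refl Z′≈))) ⟩
      ψ 2b X Y * φ 2b Z Z′ + -1# * m * (φ 2b X Y * ψ 2b Z Z′) ∎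
      where
      c = -1# * m
      cc≈mm : c * c ≈ m * m
      cc≈mm = trans (solve 2 (λ e m → e :* m :* (e :* m) := e :* e :* (m :* m)) refl -1# m)
                    (trans (*-congʳ -1*-1≈1) (*-identityˡ _))
      X≈ : c * c * Z ≈ X
      X≈ = trans (*-congʳ cc≈mm) mmZ≈X
      Z′≈ : c * c * Y ≈ Z′
      Z′≈ = trans (*-congʳ cc≈mm) mmY≈Z′

    -- Each product of two theta values is a 2 × 2 determinant, so this is the Plücker relation.
    weierstrass-Θ : ∀ W V m₁ m₂ m₃ → m₁ ^ b ≈ 0# → m₂ ^ b ≈ 0# → m₃ ^ b ≈ 0# →
      ΘΘ (m₂ * m₃) (m₁ * m₁ * W) V * ΘΘ (m₁ * m₂) W (m₃ * m₃ * V)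
      + -1# * (ΘΘ (m₁ * m₂ * m₃) W V * ΘΘ m₂ (m₁ * m₁ * W) (m₃ * m₃ * V))
      + -1# * (m₂ * (ΘΘ m₃ (m₂ * m₂ * (m₁ * m₁ * W)) V * ΘΘ m₁ W (m₂ * m₂ * (m₃ * m₃ * V)))) ≈ 0#
    weierstrass-Θ W V m₁ m₂ m₃ n₁ n₂ n₃ = begin
      _ ≈⟨ +-cong (+-cong (*-cong xz yw) (*-congˡ (*-cong xw yz))) (*-congˡ (*-congˡ (*-cong xy zw))) ⟩
      _ ≈⟨ plücker -1# (ψ 2b xX V) (φ 2b xX V) (ψ 2b yX yX′) (φ 2b yX yX′) (ψ 2b zX zX′) (φ 2b zX zX′) (ψ 2b W wX′) (φ 2b W wX′) ⟩
      (1# + -1#) * _ ≈⟨ *-congʳ 1+-1≈0 ⟩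
      0# * _ ≈⟨ zeroˡ _ ⟩
      0# ∎
      where
      zX = m₁ * m₁ * W
      yX = m₂ * m₂ * zX
      xX = m₃ * m₃ * yX
      yX′ = m₃ * m₃ * V
      zX′ = m₂ * m₂ * yX′
      wX′ = m₁ * m₁ * zX′
      nil : ∀ {m} n → m ^ b ≈ 0# → (m * n) ^ b ≈ 0#
      nil n h = trans (^-distrib-* _ n b) (trans (*-congʳ h) (zeroˡ _))
      xz = ΘΘ-det (m₂ * m₃) zX V xX zX′ (nil m₃ n₂)
        (solve 4 (λ m₁ m₂ m₃ W → m₂ :* m₃ :* (m₂ :* m₃) :* (m₁ :* m₁ :* W) := m₃ :* m₃ :* (m₂ :* m₂ :* (m₁ :* m₁ :* W))) refl m₁ m₂ m₃ W)
        (solve 3 (λ m₂ m₃ V → m₂ :* m₃ :* (m₂ :* m₃) :* V := m₂ :* m₂ :* (m₃ :* m₃ :* V)) refl m₂ m₃ V)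
      yw = ΘΘ-det (m₁ * m₂) W yX′ yX wX′ (nil m₂ n₁)
        (solve 3 (λ m₁ m₂ W → m₁ :* m₂ :* (m₁ :* m₂) :* W := m₂ :* m₂ :* (m₁ :* m₁ :* W)) refl m₁ m₂ W)
        (solve 4 (λ m₁ m₂ m₃ V → m₁ :* m₂ :* (m₁ :* m₂) :* (m₃ :* m₃ :* V) := m₁ :* m₁ :* (m₂ :* m₂ :* (m₃ :* m₃ :* V))) refl m₁ m₂ m₃ V)
      xw = ΘΘ-det (m₁ * m₂ * m₃) W V xX wX′ (nil m₃ (nil m₂ n₁))
        (solve 4 (λ m₁ m₂ m₃ W → m₁ :* m₂ :* m₃ :* (m₁ :* m₂ :* m₃) :* W := m₃ :* m₃ :* (m₂ :* m₂ :* (m₁ :* m₁ :* W))) refl m₁ m₂ m₃ W)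
        (solve 4 (λ m₁ m₂ m₃ V → m₁ :* m₂ :* m₃ :* (m₁ :* m₂ :* m₃) :* V := m₁ :* m₁ :* (m₂ :* m₂ :* (m₃ :* m₃ :* V))) refl m₁ m₂ m₃ V)
      yz = ΘΘ-det m₂ zX yX′ yX zX′ n₂ refl refl
      xy = ΘΘ-det m₃ yX V xX yX′ n₃ refl refl
      zw = ΘΘ-det m₁ W zX′ zX wX′ n₁ refl refl
      -- A polynomial identity with `e` free: the left side vanishes at e = -1, and exhibiting the
      -- factor 1 + e brings it within the semiring solver. The vectors behind the determinants are
      -- (ψx, xφx) etc.; dividing out the points leaves m₂ = y/z on the last product.
      plücker : ∀ e ψx φx ψy φy ψz φz ψw φw →
        (ψx * φz + e * (m₂ * m₃) * (φx * ψz)) * (ψy * φw + e * (m₁ * m₂) * (φy * ψw))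
        + e * ((ψx * φw + e * (m₁ * m₂ * m₃) * (φx * ψw)) * (ψy * φz + e * m₂ * (φy * ψz)))
        + e * (m₂ * ((ψx * φy + e * m₃ * (φx * ψy)) * (ψz * φw + e * m₁ * (φz * ψw))))
        ≈ (1# + e) * (ψx * φz * ψy * φw + e * (m₁ * m₂ * (ψx * φz * φy * ψw) + m₂ * m₃ * (φx * ψz * ψy * φw) + m₂ * (ψx * φw * φy * ψz))
          + e * e * (m₁ * m₂ * m₂ * m₃ * (φx * ψz * φy * ψw) + m₁ * m₂ * m₃ * (φx * ψw * ψy * φz)))
      plücker e ψx φx ψy φy ψz φz ψw φw = solve 12 (λ e ψx φx ψy φy ψz φz ψw φw m₁ m₂ m₃ →
        (ψx :* φz :+ e :* (m₂ :* m₃) :* (φx :* ψz)) :* (ψy :* φw :+ e :* (m₁ :* m₂) :* (φy :* ψw))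
        :+ e :* ((ψx :* φw :+ e :* (m₁ :* m₂ :* m₃) :* (φx :* ψw)) :* (ψy :* φz :+ e :* m₂ :* (φy :* ψz)))
        :+ e :* (m₂ :* ((ψx :* φy :+ e :* m₃ :* (φx :* ψy)) :* (ψz :* φw :+ e :* m₁ :* (φz :* ψw))))
        := (con 1 :+ e) :* (ψx :* φz :* ψy :* φw :+ e :* (m₁ :* m₂ :* (ψx :* φz :* φy :* ψw) :+ m₂ :* m₃ :* (φx :* ψz :* ψy :* φw) :+ m₂ :* (ψx :* φw :* φy :* ψz))
          :+ e :* e :* (m₁ :* m₂ :* m₂ :* m₃ :* (φx :* ψz :* φy :* ψw) :+ m₁ :* m₂ :* m₃ :* (φx :* ψw :* ψy :* φz))))
        refl e ψx φx ψy φy ψz φz ψw φw m₁ m₂ m₃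

-- Units, Gaussian binomial coefficients and the finite triple product.

module FiniteTripleProduct (R : CommutativeRing 0ℓ 0ℓ) where

  open import Data.Integer using (+_)
  open CommutativeRing R hiding (zero)
  open import Algebra.Properties.Semiring.Exp semiring
  open import Algebra.Properties.CommutativeSemiring.Exp commutativeSemiring using (^-distrib-*)
  open import Algebra.Properties.CommutativeSemigroup *-commutativeSemigroup using () renaming (interchange to *-interchange; x∙yz≈y∙xz to *-swapˡ)
  open import Algebra.Solver.Ring.NaturalCoefficients.Default commutativeSemiring using (solve; _:=_; _:+_; _:*_; _:^_; con)
  open import Relation.Binary.Reasoning.Setoid setoid
  open Fold +-commutativeMonoid renaming (fold to ∑; fold-cong< to ∑-cong<; fold-cong to ∑-cong; fold-∙ to ∑-+; fold-cons to ∑-cons)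
  open Fold *-commutativeMonoid using () renaming (fold to ∏)
  open ThetaSeries R
  open WeierstrassRelation R using (-1#; 1+-1≈0)
  open TriangularExponents

  IsUnit : Carrier → Set
  IsUnit x = ∃ λ y → x * y ≈ 1#

  unit-* : ∀ {x y} → IsUnit x → IsUnit y → IsUnit (x * y)
  unit-* (x′ , xx′≈1) (y′ , yy′≈1) =
    x′ * y′ , trans (*-interchange _ _ _ _) (trans (*-cong xx′≈1 yy′≈1) (*-identityˡ 1#))

  unit-resp : ∀ {x y} → x ≈ y → IsUnit x → IsUnit y
  unit-resp x≈y (x′ , xx′≈1) = x′ , trans (*-congʳ (sym x≈y)) xx′≈1

  unit-cancel : ∀ {u x} → IsUnit u → u * x ≈ 0# → x ≈ 0#
  unit-cancel {u} {x} (v , uv≈1) ux≈0 = begin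
    x             ≈⟨ *-identityˡ x ⟨
    1# * x        ≈⟨ *-congʳ uv≈1 ⟨
    u * v * x     ≈⟨ solve 3 (λ u v x → u :* v :* x := v :* (u :* x)) refl u v x ⟩
    v * (u * x)   ≈⟨ *-congˡ ux≈0 ⟩
    v * 0#        ≈⟨ zeroʳ v ⟩
    0#            ∎

  unit-∏ : ∀ n f → (∀ k → IsUnit (f k)) → IsUnit (∏ n f)
  unit-∏ zero    f h = 1# , *-identityˡ 1#
  unit-∏ (suc n) f h = unit-* (unit-∏ n f h) (h n)

  -- The inverse is the geometric sum of (-x)^k over k < n, which `inv` evaluates by Horner's
  -- scheme.
  unipotent-unit : ∀ x n → x ^ n ≈ 0# → IsUnit (1# + x)
  unipotent-unit x n x^n≈0 = inv n , (begin
    (1# + x) * inv n                  ≈⟨ geometric n ⟩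
    1# + -1# * (-1# * x) ^ n          ≈⟨ +-congˡ (*-congˡ (trans (^-distrib-* -1# x n) (trans (*-congˡ x^n≈0) (zeroʳ _)))) ⟩
    1# + -1# * 0#                     ≈⟨ +-congˡ (zeroʳ -1#) ⟩
    1# + 0#                           ≈⟨ +-identityʳ 1# ⟩
    1#                                ∎)
    where
    inv : ℕ → Carrier
    inv zero    = 0#
    inv (suc n) = 1# + -1# * x * inv n
    geometric : ∀ n → (1# + x) * inv n ≈ 1# + -1# * (-1# * x) ^ n
    geometric zero    = trans (zeroʳ _) (sym (trans (+-congˡ (*-identityʳ -1#)) 1+-1≈0))
    geometric (suc n) = begin
      (1# + x) * (1# + -1# * x * inv n)
        ≈⟨ solve 3 (λ e x i → (con 1 :+ x) :* (con 1 :+ e :* x :* i) := con 1 :+ x :+ e :* x :* ((con 1 :+ x) :* i)) refl -1# x (inv n) ⟩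
      1# + x + -1# * x * ((1# + x) * inv n)
        ≈⟨ +-congˡ (*-congˡ (geometric n)) ⟩
      1# + x + -1# * x * (1# + -1# * (-1# * x) ^ n)
        ≈⟨ solve 3 (λ e x i → con 1 :+ x :+ e :* x :* (con 1 :+ e :* i) := (con 1 :+ e) :* x :+ (con 1 :+ e :* (e :* x :* i))) refl -1# x ((-1# * x) ^ n) ⟩
      (1# + -1#) * x + (1# + -1# * (-1# * x * (-1# * x) ^ n))
        ≈⟨ +-congʳ (trans (*-congʳ 1+-1≈0) (zeroˡ x)) ⟩
      0# + (1# + -1# * (-1# * x) ^ suc n)
        ≈⟨ +-identityˡ _ ⟩
      1# + -1# * (-1# * x) ^ suc n ∎

  +-cancel-neg : ∀ {x y u v} → x + -1# * u ≈ y + -1# * v → x + v ≈ y + u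
  +-cancel-neg {x} {y} {u} {v} h = begin
    x + v                              ≈⟨ +-identityʳ _ ⟨
    x + v + 0#                         ≈⟨ +-congˡ (trans (*-congʳ 1+-1≈0) (zeroˡ u)) ⟨
    x + v + (1# + -1#) * u             ≈⟨ solve 4 (λ e x u v → x :+ v :+ (con 1 :+ e) :* u := x :+ e :* u :+ (u :+ v)) refl -1# x u v ⟩
    x + -1# * u + (u + v)              ≈⟨ +-congʳ h ⟩
    y + -1# * v + (u + v)              ≈⟨ solve 4 (λ e y u v → y :+ e :* v :+ (u :+ v) := y :+ u :+ (con 1 :+ e) :* v) refl -1# y u v ⟩
    y + u + (1# + -1#) * v             ≈⟨ +-congˡ (trans (*-congʳ 1+-1≈0) (zeroˡ v)) ⟩
    y + u + 0#                         ≈⟨ +-identityʳ _ ⟩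
    y + u                              ∎

  module Gaussian (Q : Carrier) where

    binom : ℕ → ℕ → Carrier
    binom zero    zero    = 1#
    binom zero    (suc k) = 0#
    binom (suc L) zero    = 1#
    binom (suc L) (suc k) = binom L k + Q ^ suc k * binom L (suc k)

    binom-0 : ∀ L → binom L 0 ≈ 1#
    binom-0 zero    = refl
    binom-0 (suc L) = refl

    binom-above : ∀ L k → L < k → binom L k ≈ 0#
    binom-above zero    (suc k) _         = refl
    binom-above (suc L) (suc k) (s≤s L<k) =
      trans (+-cong (binom-above L k L<k) (trans (*-congˡ (binom-above L (suc k) (ℕₚ.m<n⇒m<1+n L<k))) (zeroʳ _))) (+-identityˡ 0#)

    -- Used twice: it turns the defining Pascal rule into the second one, and modulo a power of q it
    -- shows that neighbouring coefficients near the centre agree. It is the quotient of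
    -- neighbouring Gaussian coefficients with denominators cleared.
    binom-ratio : ∀ L k r → L ≡ k ℕ.+ r →
      binom L (suc k) + -1# * (Q ^ suc k * binom L (suc k)) ≈ binom L k + -1# * (Q ^ r * binom L k)
    binom-ratio L k zero L≡k = begin
      binom L (suc k) + -1# * (Q ^ suc k * binom L (suc k))
        ≈⟨ +-cong top (*-congˡ (*-congˡ top)) ⟩
      0# + -1# * (Q ^ suc k * 0#)
        ≈⟨ solve 2 (λ e z → con 0 :+ e :* (z :* con 0) := con 0) refl -1# (Q ^ suc k) ⟩
      0#
        ≈⟨ trans (*-congʳ 1+-1≈0) (zeroˡ _) ⟨
      (1# + -1#) * binom L k
        ≈⟨ solve 2 (λ e z → (con 1 :+ e) :* z := z :+ e :* (con 1 :* z)) refl -1# (binom L k) ⟩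
      binom L k + -1# * (1# * binom L k) ∎
      where top = binom-above L (suc k) (ℕₚ.≤-reflexive (≡.cong suc (≡.trans L≡k (ℕₚ.+-identityʳ k))))
    binom-ratio (suc L) zero (suc r) ≡.refl = begin
      binom L 0 + Q ^ 1 * z + -1# * (Q ^ 1 * (binom L 0 + Q ^ 1 * z))
        ≈⟨ +-cong (+-congʳ (binom-0 L)) (*-congˡ (*-congˡ (+-congʳ (binom-0 L)))) ⟩
      1# + Q ^ 1 * z + -1# * (Q ^ 1 * (1# + Q ^ 1 * z))
        ≈⟨ solve 3 (λ e a z → con 1 :+ a :* z :+ e :* (a :* (con 1 :+ a :* z)) := con 1 :+ e :* a :+ a :* (z :+ e :* (a :* z))) refl -1# (Q ^ 1) z ⟩
      1# + -1# * Q ^ 1 + Q ^ 1 * (z + -1# * (Q ^ 1 * z))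
        ≈⟨ +-congˡ (*-congˡ (trans (binom-ratio L zero L ≡.refl) (+-cong (binom-0 L) (*-congˡ (*-congˡ (binom-0 L)))))) ⟩
      1# + -1# * Q ^ 1 + Q ^ 1 * (1# + -1# * (Q ^ L * 1#))
        ≈⟨ solve 3 (λ e Q b → con 1 :+ e :* (Q :^ 1) :+ (Q :^ 1) :* (con 1 :+ e :* (b :* con 1)) := con 1 :+ e :* (Q :* b :* con 1) :+ (con 1 :+ e) :* Q) refl -1# Q (Q ^ L) ⟩
      1# + -1# * (Q * Q ^ L * 1#) + (1# + -1#) * Q
        ≈⟨ +-congˡ (trans (*-congʳ 1+-1≈0) (zeroˡ Q)) ⟩
      1# + -1# * (Q * Q ^ L * 1#) + 0#
        ≈⟨ +-identityʳ _ ⟩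
      1# + -1# * (Q * Q ^ L * 1#) ∎
      where z = binom L 1
    binom-ratio (suc L) (suc k) (suc r) L≡ = begin
      y + Q * a * z + -1# * (Q * a * (y + Q * a * z))
        ≈⟨ solve 4 (λ e s y z → y :+ s :* z :+ e :* (s :* (y :+ s :* z)) := y :+ e :* (s :* y) :+ s :* (z :+ e :* (s :* z))) refl -1# (Q * a) y z ⟩
      y + -1# * (Q * a * y) + Q * a * (z + -1# * (Q * a * z))
        ≈⟨ +-congˡ (*-congˡ (binom-ratio L (suc k) r (≡.trans (ℕₚ.suc-injective L≡) (ℕₚ.+-suc k r)))) ⟩
      y + -1# * (Q * a * y) + Q * a * (y + -1# * (c * y))
        ≈⟨ solve 5 (λ e Q a c y → y :+ e :* (Q :* a :* y) :+ Q :* a :* (y :+ e :* (c :* y)) := y :+ e :* (a :* (Q :* c) :* y) :+ (con 1 :+ e) :* (Q :* a :* y)) refl -1# Q a c y ⟩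
      y + -1# * (a * (Q * c) * y) + (1# + -1#) * (Q * a * y)
        ≈⟨ +-congˡ (vanish (Q * a * y)) ⟩
      y + -1# * (a * (Q * c) * y) + 0#
        ≈⟨ +-congˡ (vanish (a * y)) ⟨
      y + -1# * (a * (Q * c) * y) + (1# + -1#) * (a * y)
        ≈⟨ solve 4 (λ e a s y → y :+ e :* (a :* s :* y) :+ (con 1 :+ e) :* (a :* y) := (y :+ e :* (a :* y)) :+ (a :* y :+ e :* (s :* (a :* y)))) refl -1# a (Q * c) y ⟩
      (y + -1# * (a * y)) + (a * y + -1# * (Q * c * (a * y)))
        ≈⟨ +-congʳ (binom-ratio L k (suc r) (ℕₚ.suc-injective L≡)) ⟩
      (x + -1# * (Q * c * x)) + (a * y + -1# * (Q * c * (a * y)))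
        ≈⟨ solve 4 (λ e s x w → (x :+ e :* (s :* x)) :+ (w :+ e :* (s :* w)) := x :+ w :+ e :* (s :* (x :+ w))) refl -1# (Q * c) x (a * y) ⟩
      x + a * y + -1# * (Q * c * (x + a * y)) ∎
      where
      a = Q ^ suc k
      c = Q ^ r
      x = binom L k
      y = binom L (suc k)
      z = binom L (suc (suc k))
      vanish : ∀ w → (1# + -1#) * w ≈ 0#
      vanish w = trans (*-congʳ 1+-1≈0) (zeroˡ w)

    binom-pascal′ : ∀ L k r → L ≡ k ℕ.+ r → binom (suc L) (suc k) ≈ Q ^ r * binom L k + binom L (suc k)
    binom-pascal′ L k r L≡ = trans (sym (+-cancel-neg (binom-ratio L k r L≡))) (+-comm _ _)

  module Finite (A B : Carrier) where

    Q : Carrier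
    Q = A * B

    open Gaussian Q

    t : ℤ → Carrier
    t = term A B

    private
      Q^*AB : ∀ n k l → Q ^ n * (A ^ k * B ^ l) ≈ A ^ (n ℕ.+ k) * B ^ (n ℕ.+ l)
      Q^*AB n k l = trans (*-congʳ (^-distrib-* A B n)) (trans (*-interchange _ _ _ _) (*-cong (sym (^-homo-* A n k)) (sym (^-homo-* B n l))))

      AB-≡ : ∀ {k l k′ l′} → k ≡ k′ → l ≡ l′ → A ^ k * B ^ l ≈ A ^ k′ * B ^ l′
      AB-≡ ≡.refl ≡.refl = refl

    -- In the expansion j = i - m, so moving a term one index down costs Q^i, where i is the lower
    -- entry of its Gaussian coefficient: precisely the weight in the defining Pascal rule.
    B-step : ∀ i m j → + i ≡ j ℤ.+ + m → B * Q ^ m * t j ≈ Q ^ i * t (j ℤ.- + 1)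
    B-step i m j i≡j+m = begin
      B * Q ^ m * (A ^ Tri j * B ^ Tri (ℤ.- j))                        ≈⟨ solve 4 (λ b x y z → b :* x :* (y :* z) := x :* (y :* (b :* z))) refl B (Q ^ m) _ _ ⟩
      Q ^ m * (A ^ Tri j * B ^ suc (Tri (ℤ.- j)))                      ≈⟨ Q^*AB m _ _ ⟩
      A ^ (m ℕ.+ Tri j) * B ^ (m ℕ.+ suc (Tri (ℤ.- j)))                ≈⟨ AB-≡ eA eB ⟩
      A ^ (i ℕ.+ Tri (j ℤ.- + 1)) * B ^ (i ℕ.+ Tri (ℤ.- (j ℤ.- + 1)))  ≈⟨ Q^*AB i _ _ ⟨
      Q ^ i * t (j ℤ.- + 1) ∎
      where
      sA : ∀ j m → m ℤ.* + 2 ℤ.+ (j ℤ.* j ℤ.+ j) ≡ (j ℤ.+ m) ℤ.* + 2 ℤ.+ ((j ℤ.- + 1) ℤ.* (j ℤ.- + 1) ℤ.+ (j ℤ.- + 1))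
      sA = solve-∀
      sB : ∀ j m → m ℤ.* + 2 ℤ.+ (+ 2 ℤ.+ (ℤ.- j ℤ.* ℤ.- j ℤ.+ ℤ.- j)) ≡ (j ℤ.+ m) ℤ.* + 2 ℤ.+ (ℤ.- (j ℤ.- + 1) ℤ.* ℤ.- (j ℤ.- + 1) ℤ.+ ℤ.- (j ℤ.- + 1))
      sB = solve-∀
      eA : m ℕ.+ Tri j ≡ i ℕ.+ Tri (j ℤ.- + 1)
      eA = undouble (≡.trans (double-+ m (Tri j) ≡.refl (T-double j)) (sA j (+ m)))
                    (double-+ i (Tri (j ℤ.- + 1)) (≡.cong (ℤ._* + 2) i≡j+m) (T-double (j ℤ.- + 1)))
      eB : m ℕ.+ suc (Tri (ℤ.- j)) ≡ i ℕ.+ Tri (ℤ.- (j ℤ.- + 1))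
      eB = undouble (≡.trans (double-+ m (suc (Tri (ℤ.- j))) ≡.refl (double-+ 1 (Tri (ℤ.- j)) ≡.refl (T-double (ℤ.- j)))) (sB j (+ m)))
                    (double-+ i (Tri (ℤ.- (j ℤ.- + 1))) (≡.cong (ℤ._* + 2) i≡j+m) (T-double (ℤ.- (j ℤ.- + 1))))

    A-step : ∀ r n j → + n ≡ j ℤ.+ + r → A * Q ^ n * t j ≈ Q ^ r * t (j ℤ.+ + 1)
    A-step r n j n≡j+r = begin
      A * Q ^ n * (A ^ Tri j * B ^ Tri (ℤ.- j))                        ≈⟨ solve 4 (λ b x y z → b :* x :* (y :* z) := x :* (b :* y :* z)) refl A (Q ^ n) _ _ ⟩
      Q ^ n * (A ^ suc (Tri j) * B ^ Tri (ℤ.- j))                      ≈⟨ Q^*AB n (suc (Tri j)) _ ⟩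
      A ^ (n ℕ.+ suc (Tri j)) * B ^ (n ℕ.+ Tri (ℤ.- j))                ≈⟨ AB-≡ eA eB ⟩
      A ^ (r ℕ.+ Tri (j ℤ.+ + 1)) * B ^ (r ℕ.+ Tri (ℤ.- (j ℤ.+ + 1)))  ≈⟨ Q^*AB r _ _ ⟨
      Q ^ r * t (j ℤ.+ + 1) ∎
      where
      sA : ∀ j r → (j ℤ.+ r) ℤ.* + 2 ℤ.+ (+ 2 ℤ.+ (j ℤ.* j ℤ.+ j)) ≡ r ℤ.* + 2 ℤ.+ ((j ℤ.+ + 1) ℤ.* (j ℤ.+ + 1) ℤ.+ (j ℤ.+ + 1))
      sA = solve-∀
      sB : ∀ j r → (j ℤ.+ r) ℤ.* + 2 ℤ.+ (ℤ.- j ℤ.* ℤ.- j ℤ.+ ℤ.- j) ≡ r ℤ.* + 2 ℤ.+ (ℤ.- (j ℤ.+ + 1) ℤ.* ℤ.- (j ℤ.+ + 1) ℤ.+ ℤ.- (j ℤ.+ + 1))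
      sB = solve-∀
      eA : n ℕ.+ suc (Tri j) ≡ r ℕ.+ Tri (j ℤ.+ + 1)
      eA = undouble (≡.trans (double-+ n (suc (Tri j)) (≡.cong (ℤ._* + 2) n≡j+r) (double-+ 1 (Tri j) ≡.refl (T-double j))) (sA j (+ r)))
                    (double-+ r (Tri (j ℤ.+ + 1)) ≡.refl (T-double (j ℤ.+ + 1)))
      eB : n ℕ.+ Tri (ℤ.- j) ≡ r ℕ.+ Tri (ℤ.- (j ℤ.+ + 1))
      eB = undouble (≡.trans (double-+ n (Tri (ℤ.- j)) (≡.cong (ℤ._* + 2) n≡j+r) (T-double (ℤ.- j))) (sB j (+ r)))
                    (double-+ r (Tri (ℤ.- (j ℤ.+ + 1))) ≡.refl (T-double (ℤ.- (j ℤ.+ + 1))))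

    -- The sum side of Cauchy's finite form of the triple product, for L factors of which m involve
    -- B.
    expansion : ℕ → ℕ → Carrier
    expansion L m = ∑ (suc L) (λ i → binom L i * t (+ i ℤ.- + m))

    private
      ∑-*ˡ = fold-*ˡ

      last-0 : ∀ L (f : ℕ → Carrier) → ∑ L (λ i → binom L (suc i) * f i) ≈ ∑ (suc L) (λ i → binom L (suc i) * f i)
      last-0 L f = sym (trans (+-congˡ (trans (*-congʳ (binom-above L (suc L) ℕₚ.≤-refl)) (zeroˡ _))) (+-identityʳ _))

    expand-B : ∀ L m → (1# + B * Q ^ m) * expansion L m ≈ expansion (suc L) (suc m)
    expand-B L m = begin
      (1# + B * Q ^ m) * expansion L m
        ≈⟨ trans (distribʳ _ _ _) (+-congʳ (*-identityˡ _)) ⟩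
      expansion L m + B * Q ^ m * expansion L m
        ≈⟨ +-congˡ (∑-*ˡ (suc L) (B * Q ^ m) _) ⟨
      expansion L m + ∑ (suc L) (λ i → B * Q ^ m * (binom L i * t (+ i ℤ.- + m)))
        ≈⟨ +-congˡ (∑-cong (suc L) moveB) ⟩
      expansion L m + ∑ (suc L) (λ i → binom L i * (Q ^ i * s i))
        ≈⟨ +-congˡ (trans (∑-cons L _) (+-congˡ (last-0 L (λ i → Q ^ suc i * s (suc i))))) ⟩
      expansion L m + (binom L 0 * (1# * s 0) + ∑ (suc L) (λ i → binom L (suc i) * (Q ^ suc i * s (suc i))))
        ≈⟨ solve 3 (λ x y z → x :+ (y :+ z) := y :+ (x :+ z)) refl _ _ _ ⟩
      binom L 0 * (1# * s 0) + (expansion L m + ∑ (suc L) (λ i → binom L (suc i) * (Q ^ suc i * s (suc i))))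
        ≈⟨ +-cong (*-cong (binom-0 L) (*-identityˡ _)) (sym (∑-+ (suc L) _ _)) ⟩
      1# * s 0 + ∑ (suc L) (λ i → binom L i * t (+ i ℤ.- + m) + binom L (suc i) * (Q ^ suc i * s (suc i)))
        ≈⟨ +-congˡ (∑-cong (suc L) pascal) ⟩
      1# * s 0 + ∑ (suc L) (λ i → binom (suc L) (suc i) * s (suc i))
        ≈⟨ ∑-cons (suc L) _ ⟨
      expansion (suc L) (suc m) ∎
      where
      s : ℕ → Carrier
      s i = t (+ i ℤ.- + suc m)
      down : ∀ i m → i ℤ.- m ℤ.- + 1 ≡ i ℤ.- (+ 1 ℤ.+ m)
      down = solve-∀
      shift : ∀ i m → i ℤ.- m ≡ (+ 1 ℤ.+ i) ℤ.- (+ 1 ℤ.+ m)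
      shift = solve-∀
      undo : ∀ i m → i ≡ i ℤ.- m ℤ.+ m
      undo = solve-∀
      moveB : ∀ i → B * Q ^ m * (binom L i * t (+ i ℤ.- + m)) ≈ binom L i * (Q ^ i * s i)
      moveB i = trans (*-swapˡ _ _ _) (*-congˡ (trans (B-step i m (+ i ℤ.- + m) (undo (+ i) (+ m)))
                      (*-congˡ (reflexive (≡.cong t (down (+ i) (+ m)))))))
      pascal : ∀ i → binom L i * t (+ i ℤ.- + m) + binom L (suc i) * (Q ^ suc i * s (suc i)) ≈ binom (suc L) (suc i) * s (suc i)
      pascal i = trans (+-congʳ (*-congˡ (reflexive (≡.cong t (shift (+ i) (+ m))))))
        (solve 4 (λ x y q s → x :* s :+ y :* (q :* s) := (x :+ q :* y) :* s) refl (binom L i) (binom L (suc i)) (Q ^ suc i) (s (suc i)))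

    -- A factor with A moves terms one index up with weight Q^(L-i), which calls for the second
    -- Pascal rule, whereas `expand-B` rests on the defining one.
    expand-A : ∀ L m n → L ≡ m ℕ.+ n → (1# + A * Q ^ n) * expansion L m ≈ expansion (suc L) m
    expand-A L m n L≡ = begin
      (1# + A * Q ^ n) * expansion L m
        ≈⟨ trans (distribʳ _ _ _) (+-cong (*-identityˡ _) (sym (∑-*ˡ (suc L) (A * Q ^ n) _))) ⟩
      expansion L m + ∑ (suc L) (λ i → A * Q ^ n * (binom L i * s i))
        ≈⟨ +-cong (trans (∑-cons L _) (+-congˡ (last-0 L (λ i → s (suc i))))) (∑-cong< (suc L) moveA) ⟩
      binom L 0 * s 0 + ∑ (suc L) (λ i → binom L (suc i) * s (suc i)) + ∑ (suc L) (λ i → Q ^ (L ℕ.∸ i) * binom L i * s (suc i))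
        ≈⟨ trans (+-assoc _ _ _) (+-cong (*-congʳ (binom-0 L)) (sym (∑-+ (suc L) _ _))) ⟩
      1# * s 0 + ∑ (suc L) (λ i → binom L (suc i) * s (suc i) + Q ^ (L ℕ.∸ i) * binom L i * s (suc i))
        ≈⟨ +-congˡ (∑-cong< (suc L) pascal) ⟩
      1# * s 0 + ∑ (suc L) (λ i → binom (suc L) (suc i) * s (suc i))
        ≈⟨ ∑-cons (suc L) _ ⟨
      expansion (suc L) m ∎
      where
      s : ℕ → Carrier
      s i = t (+ i ℤ.- + m)
      up : ∀ i m → i ℤ.- m ℤ.+ + 1 ≡ + 1 ℤ.+ i ℤ.- m
      up = solve-∀
      cancel : ∀ i m n r → m ℤ.+ n ≡ i ℤ.+ r → n ≡ i ℤ.- m ℤ.+ r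
      cancel i m n r h = ≡.trans (e₁ m n) (≡.trans (≡.cong (ℤ._- m) h) (e₂ i m r))
        where
        e₁ : ∀ m n → n ≡ m ℤ.+ n ℤ.- m
        e₁ = solve-∀
        e₂ : ∀ i m r → i ℤ.+ r ℤ.- m ≡ i ℤ.- m ℤ.+ r
        e₂ = solve-∀
      split : ∀ i → i < suc L → L ≡ i ℕ.+ (L ℕ.∸ i)
      split i i<1+L = ≡.sym (ℕₚ.m+[n∸m]≡n (ℕₚ.≤-pred i<1+L))
      moveA : ∀ i → i < suc L → A * Q ^ n * (binom L i * s i) ≈ Q ^ (L ℕ.∸ i) * binom L i * s (suc i)
      moveA i i<1+L = trans (*-swapˡ _ _ _) (trans (*-congˡ (trans
        (A-step (L ℕ.∸ i) n (+ i ℤ.- + m) (cancel (+ i) (+ m) (+ n) (+ (L ℕ.∸ i)) (≡.cong +_ (≡.trans (≡.sym L≡) (split i i<1+L)))))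
        (*-congˡ (reflexive (≡.cong t (up (+ i) (+ m)))))))
        (trans (*-swapˡ _ _ _) (sym (*-assoc _ _ _))))
      pascal : ∀ i → i < suc L → binom L (suc i) * s (suc i) + Q ^ (L ℕ.∸ i) * binom L i * s (suc i) ≈ binom (suc L) (suc i) * s (suc i)
      pascal i i<1+L = trans (sym (distribʳ _ _ _)) (*-congʳ (trans (+-comm _ _) (sym (binom-pascal′ L i (L ℕ.∸ i) (split i i<1+L)))))

    finite-tripleProduct : ∀ m n → ∏ m (λ k → 1# + B * Q ^ k) * ∏ n (λ k → 1# + A * Q ^ k) ≈ expansion (m ℕ.+ n) m
    finite-tripleProduct zero zero = solve 0 (con 1 :* con 1 := con 0 :+ con 1 :* (con 1 :* con 1)) refl
    finite-tripleProduct (suc m) zero = begin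
      ∏ m (λ k → 1# + B * Q ^ k) * (1# + B * Q ^ m) * 1#   ≈⟨ solve 2 (λ x y → x :* y :* con 1 := y :* (x :* con 1)) refl _ _ ⟩
      (1# + B * Q ^ m) * (∏ m (λ k → 1# + B * Q ^ k) * 1#) ≈⟨ *-congˡ (finite-tripleProduct m zero) ⟩
      (1# + B * Q ^ m) * expansion (m ℕ.+ 0) m             ≈⟨ expand-B (m ℕ.+ 0) m ⟩
      expansion (suc m ℕ.+ 0) (suc m)                      ∎
    finite-tripleProduct m (suc n) = begin
      ∏ m (λ k → 1# + B * Q ^ k) * (∏ n (λ k → 1# + A * Q ^ k) * (1# + A * Q ^ n))
        ≈⟨ solve 3 (λ x y z → x :* (y :* z) := z :* (x :* y)) refl _ _ _ ⟩
      (1# + A * Q ^ n) * (∏ m (λ k → 1# + B * Q ^ k) * ∏ n (λ k → 1# + A * Q ^ k))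
        ≈⟨ *-congˡ (finite-tripleProduct m n) ⟩
      (1# + A * Q ^ n) * expansion (m ℕ.+ n) m
        ≈⟨ expand-A (m ℕ.+ n) m n ≡.refl ⟩
      expansion (suc (m ℕ.+ n)) m
        ≈⟨ reflexive (≡.cong (λ L → expansion L m) (≡.sym (ℕₚ.+-suc m n))) ⟩
      expansion (m ℕ.+ suc n) m ∎

-- The triple product identity modulo a power of q.

module TripleProduct (R : CommutativeRing 0ℓ 0ℓ) where

  open import Data.Integer using (+_; ∣_∣)
  open CommutativeRing R hiding (zero)
  open import Algebra.Properties.Semiring.Exp semiring
  open import Algebra.Properties.CommutativeSemiring.Exp commutativeSemiring using (^-distrib-*)
  open import Algebra.Properties.CommutativeSemigroup *-commutativeSemigroup using () renaming (interchange to *-interchange)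
  open import Algebra.Solver.Ring.NaturalCoefficients.Default commutativeSemiring using (solve; _:=_; _:*_; _:^_)
  open import Relation.Binary.Reasoning.Setoid setoid
  open Fold +-commutativeMonoid using () renaming (fold to ∑; fold-cong< to ∑-cong<)
  open Fold *-commutativeMonoid using () renaming (fold to ∏)
  open ThetaSeries R
  open WeierstrassRelation R using (-1#)
  open FiniteTripleProduct R
  open TriangularExponents
  open Gaussian

  binom-cong : ∀ {Q Q′} → Q ≈ Q′ → ∀ L k → binom Q L k ≈ binom Q′ L k
  binom-cong Q≈Q′ zero    zero    = refl
  binom-cong Q≈Q′ zero    (suc k) = refl
  binom-cong Q≈Q′ (suc L) zero    = refl
  binom-cong Q≈Q′ (suc L) (suc k) =
    +-cong (binom-cong Q≈Q′ L k) (*-cong (^-congˡ (suc k) Q≈Q′) (binom-cong Q≈Q′ L (suc k)))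

  module _ (q : Carrier) (N : ℕ) (q^N≈0 : q ^ N ≈ 0#) where

    q-vanish : ∀ {m n} x y → N ≤ m ℕ.+ n → q ^ m * (x * (q ^ n * y)) ≈ 0#
    q-vanish {m} {n} x y le = trans (solve 4 (λ a x b y → a :* (x :* (b :* y)) := a :* b :* (x :* y)) refl (q ^ m) x (q ^ n) y)
      (trans (*-congʳ (trans (sym (^-homo-* q m n)) (^-vanish q^N≈0 le))) (zeroˡ _))

    module _ {Q Q′ : Carrier} (Q≈qQ′ : Q ≈ q * Q′) where

      Q^≈ : ∀ n → Q ^ n ≈ q ^ n * Q′ ^ n
      Q^≈ n = trans (^-congˡ n Q≈qQ′) (^-distrib-* q Q′ n)

      private
        kill : ∀ f n z → N ≤ f ℕ.+ n → q ^ f * (-1# * (Q ^ n * z)) ≈ 0#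
        kill f n z le = trans (*-congˡ (*-congˡ (trans (*-congʳ (Q^≈ n)) (*-assoc _ _ _)))) (q-vanish {f} {n} -1# _ le)

        drop : ∀ f n z → N ≤ f ℕ.+ n → q ^ f * (z + -1# * (Q ^ n * z)) ≈ q ^ f * z
        drop f n z le = trans (distribˡ _ _ _) (trans (+-congˡ (kill f n z le)) (+-identityʳ _))

      -- By `binom-ratio` the two coefficients differ only by multiples of Q^(k+1) and Q^r. As Q is
      -- a multiple of q, the prefactor q^f pushes both past q^N.
      binom-step : ∀ f L k r → L ≡ k ℕ.+ r → N ≤ f ℕ.+ suc k → N ≤ f ℕ.+ r →
                   q ^ f * binom Q L (suc k) ≈ q ^ f * binom Q L k
      binom-step f L k r L≡ le₁ le₂ = trans (sym (drop f (suc k) _ le₁))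
        (trans (*-congˡ (binom-ratio Q L k r L≡)) (drop f r _ le₂))

      module _ (J : ℕ) (N≤K : N ≤ suc J) where
        private
          K L : ℕ
          K = suc J
          L = K ℕ.+ J

        -- The approximation to the central coefficient gets worse with the distance `f`, but q^f
        -- compensates: `f` plus either error exponent stays at least N at every step towards the
        -- centre.
        below-centre : ∀ f i → i ℕ.+ f ≡ K → q ^ f * binom Q L i ≈ q ^ f * binom Q L K
        below-centre zero    i eq rewrite ≡.trans (≡.sym (ℕₚ.+-identityʳ i)) eq = refl
        below-centre (suc f) i eq = begin
          q ^ suc f * binom Q L i         ≈⟨ binom-step (suc f) L i (suc f ℕ.+ J) (≡.trans (≡.cong (ℕ._+ J) (≡.sym eq)) (ℕₚ.+-assoc i (suc f) J))
                                               (ℕₚ.≤-trans N≤K (ℕₚ.≤-trans (ℕₚ.≤-reflexive (≡.trans (≡.sym eq) (ℕₚ.+-comm i (suc f)))) (ℕₚ.+-monoʳ-≤ (suc f) (ℕₚ.n≤1+n i))))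
                                               (ℕₚ.m≤n⇒m≤o+n (suc f) (ℕₚ.≤-trans N≤K (s≤s (ℕₚ.m≤n+m J f)))) ⟨
          q * q ^ f * binom Q L (suc i)   ≈⟨ *-assoc _ _ _ ⟩
          q * (q ^ f * binom Q L (suc i)) ≈⟨ *-congˡ (below-centre f (suc i) (≡.trans (≡.sym (ℕₚ.+-suc i f)) eq)) ⟩
          q * (q ^ f * binom Q L K)       ≈⟨ *-assoc _ _ _ ⟨
          q ^ suc f * binom Q L K         ∎

        above-centre : ∀ f r → f ℕ.+ r ≡ J → q ^ f * binom Q L (K ℕ.+ f) ≈ q ^ f * binom Q L K
        above-centre zero    r eq rewrite ℕₚ.+-identityʳ J = refl
        above-centre (suc f) r eq = begin
          q ^ suc f * binom Q L (K ℕ.+ suc f)   ≈⟨ *-congˡ (reflexive (≡.cong (binom Q L) (ℕₚ.+-suc K f))) ⟩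
          q ^ suc f * binom Q L (suc (K ℕ.+ f)) ≈⟨ binom-step (suc f) L (K ℕ.+ f) (suc r) (≡.trans (≡.cong (K ℕ.+_) (≡.trans (≡.sym eq) (≡.sym (ℕₚ.+-suc f r)))) (≡.sym (ℕₚ.+-assoc K f (suc r))))
                                                     (ℕₚ.≤-trans N≤K (ℕₚ.m≤n⇒m≤o+n (suc f) (ℕₚ.m≤n⇒m≤1+n (ℕₚ.m≤m+n K f))))
                                                     (ℕₚ.≤-trans N≤K (ℕₚ.≤-reflexive (≡.trans (≡.cong suc (≡.sym eq)) (≡.sym (ℕₚ.+-suc (suc f) r))))) ⟩
          q * q ^ f * binom Q L (K ℕ.+ f)       ≈⟨ *-assoc _ _ _ ⟩
          q * (q ^ f * binom Q L (K ℕ.+ f))     ≈⟨ *-congˡ (above-centre f (suc r) (≡.trans (ℕₚ.+-suc f r) eq)) ⟩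
          q * (q ^ f * binom Q L K)             ≈⟨ *-assoc _ _ _ ⟨
          q ^ suc f * binom Q L K               ∎

        near-centre : ∀ i → i < suc L → q ^ ∣ + i ℤ.- + K ∣ * binom Q L i ≈ q ^ ∣ + i ℤ.- + K ∣ * binom Q L K
        near-centre i i≤L with ℕₚ.≤-total i K
        ... | inj₁ i≤K = trans (*-congʳ (^-congʳ q eq)) (trans (below-centre (K ℕ.∸ i) i (ℕₚ.m+[n∸m]≡n i≤K)) (*-congʳ (^-congʳ q (≡.sym eq))))
          where
          eq : ∣ + i ℤ.- + K ∣ ≡ K ℕ.∸ i
          eq = ≡.trans (≡.cong ∣_∣ (ℤₚ.m-n≡m⊖n i K)) (ℤₚ.∣⊖∣-≤ i≤K)
        ... | inj₂ K≤i with ℕₚ.m≤n⇒∃[o]m+o≡n K≤i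
        ... | f , ≡.refl = trans (*-congʳ (^-congʳ q eq)) (trans (above-centre f (J ℕ.∸ f) (ℕₚ.m+[n∸m]≡n f≤J)) (*-congʳ (^-congʳ q (≡.sym eq))))
          where
          eq : ∣ + (K ℕ.+ f) ℤ.- + K ∣ ≡ f
          eq = ≡.cong ∣_∣ (≡.trans (ℤₚ.m-n≡m⊖n (K ℕ.+ f) K) (≡.trans (ℤₚ.⊖-≥ (ℕₚ.m≤m+n K f)) (≡.cong +_ (ℕₚ.m+n∸m≡n K f))))
          f≤J : f ≤ J
          f≤J = ℕₚ.+-cancelˡ-≤ K f J (ℕₚ.≤-pred i≤L)

    module _ {A A′ B B′ : Carrier} (A≈qA′ : A ≈ q * A′) (B≈qB′ : B ≈ q * B′) where

      private
        -- Both A and B are multiples of q, and Tri i + Tri(-i) ≥ |i|. This supplies the power of q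
        -- that `near-centre` asks for.
        term-divisible : ∀ i → ∃ λ s → term A B i ≈ q ^ ∣ i ∣ * s
        term-divisible i with ℕₚ.m≤n⇒∃[o]m+o≡n (∣i∣≤T+T i)
        ... | o , eq = q ^ o * (A′ ^ Tri i * B′ ^ Tri (ℤ.- i)) , (begin
          A ^ Tri i * B ^ Tri (ℤ.- i)
            ≈⟨ *-cong (trans (^-congˡ (Tri i) A≈qA′) (^-distrib-* q A′ (Tri i))) (trans (^-congˡ (Tri (ℤ.- i)) B≈qB′) (^-distrib-* q B′ (Tri (ℤ.- i)))) ⟩
          q ^ Tri i * A′ ^ Tri i * (q ^ Tri (ℤ.- i) * B′ ^ Tri (ℤ.- i))
            ≈⟨ *-interchange _ _ _ _ ⟩
          q ^ Tri i * q ^ Tri (ℤ.- i) * (A′ ^ Tri i * B′ ^ Tri (ℤ.- i))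
            ≈⟨ *-congʳ (trans (sym (^-homo-* q (Tri i) (Tri (ℤ.- i)))) (trans (^-congʳ q (≡.sym eq)) (^-homo-* q ∣ i ∣ o))) ⟩
          q ^ ∣ i ∣ * q ^ o * (A′ ^ Tri i * B′ ^ Tri (ℤ.- i))
            ≈⟨ *-assoc _ _ _ ⟩
          q ^ ∣ i ∣ * (q ^ o * (A′ ^ Tri i * B′ ^ Tri (ℤ.- i))) ∎)

        Q≈ : A * B ≈ q * (A′ * B)
        Q≈ = trans (*-congʳ A≈qA′) (*-assoc _ _ _)

      -- Every Gaussian coefficient of the finite identity may be replaced by the central one, which
      -- represents 1/(Q; Q)_∞ modulo q^N. The upper entry K + J = 2K - 1 makes the finite sum run
      -- over -K ≤ i < K, the window of `Θ K`.
      tripleProduct : ∀ J → N ≤ suc J → let K = suc J; Q = A * B in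
        binom Q (K ℕ.+ J) K * Θ K A B ≈ ∏ K (λ k → 1# + A * Q ^ k) * ∏ K (λ k → 1# + B * Q ^ k)
      tripleProduct J N≤K = begin
        C * ∑ (K ℕ.+ K) (λ i → term A B (+ i ℤ.- + K))
          ≈⟨ *-congˡ (reflexive (≡.cong (λ n → ∑ n (λ i → term A B (+ i ℤ.- + K))) (ℕₚ.+-suc K J))) ⟩
        C * ∑ (suc L) (λ i → term A B (+ i ℤ.- + K))
          ≈⟨ fold-*ˡ (suc L) C _ ⟨
        ∑ (suc L) (λ i → C * term A B (+ i ℤ.- + K))
          ≈⟨ ∑-cong< (suc L) centre ⟨
        ∑ (suc L) (λ i → binom Q L i * term A B (+ i ℤ.- + K))
          ≈⟨ Finite.finite-tripleProduct A B K J ⟨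
        ∏ K (λ k → 1# + B * Q ^ k) * ∏ J (λ k → 1# + A * Q ^ k)
          ≈⟨ *-comm _ _ ⟩
        ∏ J (λ k → 1# + A * Q ^ k) * ∏ K (λ k → 1# + B * Q ^ k)
          ≈⟨ *-congʳ (trans (*-congˡ last≈1) (*-identityʳ _)) ⟨
        ∏ K (λ k → 1# + A * Q ^ k) * ∏ K (λ k → 1# + B * Q ^ k) ∎
        where
        K = suc J
        L = K ℕ.+ J
        Q = A * B
        C = binom Q L K
        -- The finite identity has J factors with A; the one missing is 1 because A Q^J is a
        -- multiple of q^(1+J).
        last≈1 : 1# + A * Q ^ J ≈ 1#
        last≈1 = trans (+-congˡ (begin
          A * Q ^ J                                     ≈⟨ *-cong A≈qA′ (Q^≈ Q≈ J) ⟩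
          q * A′ * (q ^ J * (A′ * B) ^ J)               ≈⟨ solve 3 (λ q a z → q :* a :* z := q :^ 1 :* (a :* z)) refl q A′ _ ⟩
          q ^ 1 * (A′ * (q ^ J * (A′ * B) ^ J))         ≈⟨ q-vanish {1} {J} A′ _ N≤K ⟩
          0#                                            ∎)) (+-identityʳ 1#)
        centre : ∀ i → i < suc L → binom Q L i * term A B (+ i ℤ.- + K) ≈ C * term A B (+ i ℤ.- + K)
        centre i i≤L with term-divisible (+ i ℤ.- + K)
        ... | s , eq = begin
          binom Q L i * term A B (+ i ℤ.- + K)             ≈⟨ *-congˡ eq ⟩
          binom Q L i * (q ^ ∣ + i ℤ.- + K ∣ * s)          ≈⟨ solve 3 (λ x y z → x :* (y :* z) := y :* x :* z) refl _ _ s ⟩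
          q ^ ∣ + i ℤ.- + K ∣ * binom Q L i * s            ≈⟨ *-congʳ (near-centre Q≈ J N≤K i i≤L) ⟩
          q ^ ∣ + i ℤ.- + K ∣ * C * s                      ≈⟨ solve 3 (λ x y z → x :* (y :* z) := y :* x :* z) refl _ _ s ⟨
          C * (q ^ ∣ + i ℤ.- + K ∣ * s)                    ≈⟨ *-congˡ eq ⟨
          C * term A B (+ i ℤ.- + K)                       ∎

-- Certificates: relations between monomials in (q^t; q^72)_∞ as data.

module Certificates where

  open import Data.Nat using (_+_; _*_)

  infix 4 _~_

  insert : ℕ → List ℕ → List ℕ
  insert x []       = x ∷ []
  insert x (y ∷ ys) = if x ≤ᵇ y then x ∷ y ∷ ys else y ∷ insert x ys

  -- Sorting turns equality of multisets of residues into a computation, so that `refl` checks it.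
  sort : List ℕ → List ℕ
  sort []       = []
  sort (x ∷ xs) = insert x (sort xs)

  -- (σ , k , ts) stands for σ q^k ∏_{t ∈ ts} (q^t; q^72)_∞.
  Monomial : Set
  Monomial = Sign × ℕ × List ℕ

  residues : Monomial → List ℕ
  residues (_ , _ , ts) = ts

  _⊗_ : Monomial → Monomial → Monomial
  (σ , k , ts) ⊗ (τ , l , us) = σ · τ , k + l , ts ++ us

  ⊖_ : Monomial → Monomial
  ⊖ (σ , k , ts) = flip σ , k , ts

  _~_ : Monomial → Monomial → Set
  (σ , k , ts) ~ (τ , l , us) = σ ≡ τ × k ≡ l × sort ts ≡ sort us

  -- Read as the assertion that the three monomials sum to zero.
  Relation : Set
  Relation = Monomial × Monomial × Monomial

  swapˡ swapʳ : Relation → Relation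
  swapˡ (a , b , c) = b , a , c
  swapʳ (a , b , c) = a , c , b

  -- (q^u, q^(36-u); q^36)_∞ in base q^72: each of the two products is split by the parity of its
  -- index.
  quad : ℕ → List ℕ
  quad u = u ∷ 36 + u ∷ 36 ∸ u ∷ 72 ∸ u ∷ []

  -- (numerator , denominator)
  Fraction : Set
  Fraction = List ℕ × List ℕ

  _⊙_ : Fraction → Fraction → Fraction
  (n , d) ⊙ (n′ , d′) = n ++ n′ , d ++ d′

  -- (σ q^u, σ q^(36-u); q^36)_∞
  θ : Sign → ℕ → Fraction
  θ pos u = quad u , []
  θ neg u = 2 * u ∷ 72 ∸ 2 * u ∷ [] , quad u

  -- The shape x₁ - x₂ - σ q^k x₃ = 0 of the three-term relation for three fractions, multiplied by
  -- all their denominators.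
  clear : Sign → ℕ → Fraction → Fraction → Fraction → Relation
  clear σ k (n₁ , d₁) (n₂ , d₂) (n₃ , d₃) =
    (pos , 0 , n₁ ++ d₂ ++ d₃) , (neg , 0 , n₂ ++ d₁ ++ d₃) , (flip σ , k , n₃ ++ d₁ ++ d₂)

  -- The points x, y, z, w of the three-term relation satisfy w² = q^W, z/w = σ₁ q^d₁, y/z = σ₂ q^d₂ and x/y = σ₃ q^d₃.
  record Parameters : Set where
    constructor params
    field
      W d₁ d₂ d₃ : ℕ
      σ₁ σ₂ σ₃   : Sign

  -- Positive dᵢ make the ratios of the points nilpotent. The last condition leaves room for V with
  -- q^V = q^36/x², since x² = q^(2d₁+2d₂+2d₃+W).
  valid : Parameters → Bool
  valid (params W d₁ d₂ d₃ _ _ _) = (1 ≤ᵇ d₁) ∧ (1 ≤ᵇ d₂) ∧ (1 ≤ᵇ d₃) ∧ (d₁ + d₁ + (d₂ + d₂) + (d₃ + d₃) + W ≤ᵇ 36)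

  θ-pair : Sign → ℕ → ℕ → Fraction
  θ-pair σ d z = θ σ (d + z) ⊙ θ σ d

  -- The terms are j(xz)j(x/z)j(yw)j(y/w), j(xw)j(x/w)j(yz)j(y/z) and y/z times
  -- j(xy)j(x/y)j(zw)j(z/w). Exponents such as that of xz come from xz = (x/z) z² with z² =
  -- q^(2d₁+W); squares carry no sign.
  weierstrass : Parameters → Relation
  weierstrass (params W d₁ d₂ d₃ σ₁ σ₂ σ₃) = clear σ₂ d₂
    (θ-pair (σ₂ · σ₃) (d₂ + d₃) (d₁ + d₁ + W) ⊙ θ-pair (σ₁ · σ₂) (d₁ + d₂) W)
    (θ-pair (σ₁ · σ₂ · σ₃) (d₁ + d₂ + d₃) W ⊙ θ-pair σ₂ d₂ (d₁ + d₁ + W))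
    (θ-pair σ₃ d₃ (d₂ + d₂ + (d₁ + d₁ + W)) ⊙ θ-pair σ₁ d₁ W)

  -- The quotient of U ⊗ X by A, where `us` lists the leading residues of the other two relations.
  -- Truncated subtraction is safe: `Combines` compares the exponents of the product with those of U
  -- ⊗ X.
  multiplier : Monomial → Monomial → List ℕ → Monomial
  multiplier (σ , k , ts) (τ , l , _) us = σ · τ , k ∸ l , ts ++ us

  leading : Relation → Relation → Relation → List ℕ
  leading (A₁ , _) (A₂ , _) (A₃ , _) = residues A₁ ++ residues A₂ ++ residues A₃

  -- X + Y + Z = 0 follows from relations A₁ + B₁ + C₁ = 0 etc. when multiples of A₁, A₂, A₃ are a common
  -- multiple of X, Y, Z and the remaining six terms cancel in pairs.
  Combines : Relation → Relation → Relation → Relation → Set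
  Combines (X , Y , Z) r₁@(A₁ , B₁ , C₁) r₂@(A₂ , B₂ , C₂) r₃@(A₃ , B₃ , C₃) =
    μ₁ ⊗ A₁ ~ U ⊗ X × μ₂ ⊗ A₂ ~ U ⊗ Y × μ₃ ⊗ A₃ ~ U ⊗ Z ×
    μ₁ ⊗ B₁ ~ ⊖ (μ₂ ⊗ B₂) × μ₁ ⊗ C₁ ~ ⊖ (μ₃ ⊗ B₃) × μ₂ ⊗ C₂ ~ ⊖ (μ₃ ⊗ C₃)
    where
    U μ₁ μ₂ μ₃ : Monomial
    U  = pos , 0 , leading r₁ r₂ r₃
    μ₁ = multiplier X A₁ (residues A₂ ++ residues A₃)
    μ₂ = multiplier Y A₂ (residues A₁ ++ residues A₃)
    μ₃ = multiplier Z A₃ (residues A₁ ++ residues A₂)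

  members : List ℕ → List ℕ
  members rs = filter (T? ∘ pmSet72 rs) (applyUpTo suc 72)

  -- 1 / ∏_S (1 - q^n) - q^κ / ∏_S′ (1 - q^n) = σ q^ℓ with denominators cleared.
  target : List ℕ → List ℕ → ℕ → Sign → ℕ → Relation
  target S S′ κ σ ℓ = (pos , 0 , members S′) , (neg , κ , members S) , (flip σ , ℓ , members S ++ members S′)

  -- Reordering brings the leading monomial and the two cancelling ones into the positions that
  -- `Combines` prescribes.
  data Derivable : Relation → Set where
    basic : ∀ w → T (valid w) → Derivable (weierstrass w)
    left  : ∀ {r} → Derivable r → Derivable (swapˡ r)
    right : ∀ {r} → Derivable r → Derivable (swapʳ r)

  -- `positive` excludes the residue 0, whose product contains the factor 1 - q^0. The common
  -- multiple is then a unit and can be cancelled.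
  record Certificate (S S′ : List ℕ) (κ : ℕ) (σ : Sign) (ℓ : ℕ) : Set where
    field
      {r₁ r₂ r₃} : Relation
      d₁         : Derivable r₁
      d₂         : Derivable r₂
      d₃         : Derivable r₃
      positive   : T (all (1 ≤ᵇ_) (leading r₁ r₂ r₃))
      combines   : Combines (target S S′ κ σ ℓ) r₁ r₂ r₃

-- From theta values to products in base q^72.

module ThetaQuotients (R : CommutativeRing 0ℓ 0ℓ) where

  open CommutativeRing R hiding (zero)
  open import Algebra.Properties.Semiring.Exp semiring
  open import Algebra.Properties.CommutativeSemiring.Exp commutativeSemiring using (^-distrib-*)
  open import Algebra.Properties.CommutativeSemigroup *-commutativeSemigroup using () renaming (interchange to *-interchange; x∙yz≈y∙xz to *-swapˡ)
  open import Algebra.Solver.Ring.NaturalCoefficients.Default commutativeSemiring using (solve; _:=_; _:+_; _:*_; con)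
  open import Relation.Binary.Reasoning.Setoid setoid
  open Fold *-commutativeMonoid using () renaming (fold to ∏; fold-cong to ∏-cong; fold-∙ to ∏-*; fold-+ to ∏-+; fold-ε to ∏-1; fold-evenOdd to ∏-evenOdd)
  open ThetaSeries R
  open WeierstrassRelation R
  open FiniteTripleProduct R
  open TripleProduct R
  open Certificates

  module Truncated (q : Carrier) (n : ℕ) (q^M≈0 : q ^ suc (suc n) ≈ 0#) where

    -- The theta relation with b = M has windows of half-width 2M = K, and `J` is written so that
    -- `K` reduces to `suc J`. Having 2M factors in base q^36 lets them regroup by parity into M
    -- factors in base q^72.
    M K J : ℕ
    M = suc (suc n)
    K = M ℕ.+ M
    J = suc n ℕ.+ M

    C : Carrier
    C = Gaussian.binom (q ^ 36) (K ℕ.+ J) K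

    sgn : Sign → Carrier
    sgn pos = 1#
    sgn neg = -1#

    sgn-· : ∀ σ τ → sgn (σ · τ) ≈ sgn σ * sgn τ
    sgn-· pos τ   = sym (*-identityˡ _)
    sgn-· neg pos = sym (*-identityʳ _)
    sgn-· neg neg = sym -1*-1≈1

    sgn-square : ∀ σ → sgn σ * sgn σ ≈ 1#
    sgn-square pos = *-identityˡ 1#
    sgn-square neg = -1*-1≈1

    sgn-flip : ∀ σ → sgn (flip σ) ≈ -1# * sgn σ
    sgn-flip pos = sym (*-identityʳ -1#)
    sgn-flip neg = sym -1*-1≈1

    infixr 8 _q^_
    _q^_ : Sign → ℕ → Carrier
    σ q^ k = sgn σ * q ^ k

    q^-* : ∀ σ k τ l → σ q^ k * τ q^ l ≈ (σ · τ) q^ (k ℕ.+ l)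
    q^-* σ k τ l = trans (*-interchange _ _ _ _) (*-cong (sym (sgn-· σ τ)) (sym (^-homo-* q k l)))

    factor : Sign → ℕ → Carrier
    factor σ m = 1# + -1# * σ q^ m

    factor-≡ : ∀ σ {k l} → k ≡ l → factor σ k ≈ factor σ l
    factor-≡ σ ≡.refl = refl

    jacobi : Sign → ℕ → Carrier
    jacobi σ u = ∏ K (λ k → factor σ (k ℕ.* 36 ℕ.+ u)) * ∏ K (λ k → factor σ (k ℕ.* 36 ℕ.+ (36 ∸ u)))

    -- The sign σ occurs in both arguments and cancels in their product, so the base is q^36 for
    -- either sign and one constant `C` serves all theta values.
    C*Θ : ∀ σ u v {A B} → A ≈ -1# * σ q^ suc u → B ≈ -1# * σ q^ suc v → suc u ℕ.+ suc v ≡ 36 →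
          C * Θ K A B ≈ jacobi σ (suc u)
    C*Θ σ u v {A} {B} A≈ B≈ u+v≡36 = begin
      C * Θ K A B
        ≈⟨ *-congʳ (binom-cong AB≈ (K ℕ.+ J) K) ⟨
      Gaussian.binom (A * B) (K ℕ.+ J) K * Θ K A B
        ≈⟨ tripleProduct q M q^M≈0 (trans A≈ (pull u)) (trans B≈ (pull v)) J (ℕₚ.m≤m+n M M) ⟩
      ∏ K (λ k → 1# + A * (A * B) ^ k) * ∏ K (λ k → 1# + B * (A * B) ^ k)
        ≈⟨ *-cong (∏-cong K (λ k → +-congˡ (shift A (suc u) A≈ k)))
                  (∏-cong K (λ k → trans (+-congˡ (shift B (suc v) B≈ k)) (factor-≡ σ (≡.cong (k ℕ.* 36 ℕ.+_) v≡)))) ⟩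
      jacobi σ (suc u) ∎
      where
      v≡ : suc v ≡ 36 ∸ suc u
      v≡ = ≡.trans (≡.sym (ℕₚ.m+n∸m≡n (suc u) (suc v))) (≡.cong (_∸ suc u) u+v≡36)
      pull : ∀ a → -1# * σ q^ suc a ≈ q * (-1# * σ q^ a)
      pull a = solve 4 (λ e s q a → e :* (s :* (q :* a)) := q :* (e :* (s :* a))) refl -1# (sgn σ) q (q ^ a)
      AB≈ : A * B ≈ q ^ 36
      AB≈ = begin
        A * B                                             ≈⟨ *-cong A≈ B≈ ⟩
        -1# * σ q^ suc u * (-1# * σ q^ suc v)             ≈⟨ solve 4 (λ e s x y → e :* (s :* x) :* (e :* (s :* y)) := (e :* e) :* (s :* s) :* (x :* y)) refl -1# (sgn σ) (q ^ suc u) (q ^ suc v) ⟩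
        (-1# * -1#) * (sgn σ * sgn σ) * (q ^ suc u * q ^ suc v) ≈⟨ *-cong (trans (*-cong -1*-1≈1 (sgn-square σ)) (*-identityˡ 1#)) (sym (^-homo-* q (suc u) (suc v))) ⟩
        1# * q ^ (suc u ℕ.+ suc v)                        ≈⟨ trans (*-identityˡ _) (^-congʳ q u+v≡36) ⟩
        q ^ 36                                            ∎
      shift : ∀ D a → D ≈ -1# * σ q^ a → ∀ k → D * (A * B) ^ k ≈ -1# * σ q^ (k ℕ.* 36 ℕ.+ a)
      shift D a D≈ k = begin
        D * (A * B) ^ k                    ≈⟨ *-cong D≈ (trans (^-congˡ k AB≈) (trans (^-assocʳ q 36 k) (^-congʳ q (ℕₚ.*-comm 36 k)))) ⟩
        -1# * σ q^ a * q ^ (k ℕ.* 36)      ≈⟨ solve 4 (λ e s x y → e :* (s :* x) :* y := e :* (s :* (y :* x))) refl -1# (sgn σ) (q ^ a) (q ^ (k ℕ.* 36)) ⟩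
        -1# * (sgn σ * (q ^ (k ℕ.* 36) * q ^ a)) ≈⟨ *-congˡ (*-congˡ (^-homo-* q (k ℕ.* 36) a)) ⟨
        -1# * σ q^ (k ℕ.* 36 ℕ.+ a) ∎

    jacobi₂ : Sign → ℕ → ℕ → Carrier
    jacobi₂ σ u d = jacobi σ u * jacobi σ d

    CC*ΘΘ : ∀ σ d z y {m Z Y} → m ≈ σ q^ suc d → Z ≈ q ^ z → Y ≈ q ^ y → suc d ℕ.+ z ℕ.+ (suc d ℕ.+ y) ≡ 36 →
            C * C * ΘΘ M (s≤s (s≤s z≤n)) m Z Y ≈ jacobi₂ σ (suc d ℕ.+ z) (suc d)
    CC*ΘΘ σ d z y {m} {Z} {Y} m≈ Z≈ Y≈ sum≡36 = trans (*-interchange _ _ _ _)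
      (*-cong (C*Θ σ (d ℕ.+ z) (d ℕ.+ y) (*-congˡ (times Z≈)) (*-congˡ (times Y≈)) sum≡36)
              (C*Θ σ d (d ℕ.+ y ℕ.+ z) (*-congˡ m≈)
                 (*-congˡ (trans (*-cong (times Y≈) Z≈) (trans (*-assoc _ _ _) (*-congˡ (sym (^-homo-* q (suc (d ℕ.+ y)) z))))))
                 (≡.trans (rearrange (suc d) z y) sum≡36)))
      where
      rearrange : ∀ d z y → d ℕ.+ (d ℕ.+ y ℕ.+ z) ≡ d ℕ.+ z ℕ.+ (d ℕ.+ y)
      rearrange = solveℕ
      times : ∀ {X x} → X ≈ q ^ x → m * X ≈ σ q^ (suc d ℕ.+ x)
      times {x = x} X≈ = trans (*-cong m≈ X≈) (trans (*-assoc _ _ _) (*-congˡ (sym (^-homo-* q (suc d) x))))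

    -- The exponents add up to 36 because Q = m₁² m₂² m₃² W V. Every term contains four theta
    -- values, so C⁴ times the relation for theta series is the relation for products.
    weierstrass-jacobi : ∀ W V d₁ d₂ d₃ σ₁ σ₂ σ₃ →
      suc d₁ ℕ.+ suc d₁ ℕ.+ (suc d₂ ℕ.+ suc d₂) ℕ.+ (suc d₃ ℕ.+ suc d₃) ℕ.+ W ℕ.+ V ≡ 36 →
      let e₁ = suc d₁; e₂ = suc d₂; e₃ = suc d₃ in
      jacobi₂ (σ₂ · σ₃) (e₂ ℕ.+ e₃ ℕ.+ (e₁ ℕ.+ e₁ ℕ.+ W)) (e₂ ℕ.+ e₃) * jacobi₂ (σ₁ · σ₂) (e₁ ℕ.+ e₂ ℕ.+ W) (e₁ ℕ.+ e₂)
      + -1# * (jacobi₂ (σ₁ · σ₂ · σ₃) (e₁ ℕ.+ e₂ ℕ.+ e₃ ℕ.+ W) (e₁ ℕ.+ e₂ ℕ.+ e₃) * jacobi₂ σ₂ (e₂ ℕ.+ (e₁ ℕ.+ e₁ ℕ.+ W)) e₂)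
      + -1# * (σ₂ q^ e₂ * (jacobi₂ σ₃ (e₃ ℕ.+ (e₂ ℕ.+ e₂ ℕ.+ (e₁ ℕ.+ e₁ ℕ.+ W))) e₃ * jacobi₂ σ₁ (e₁ ℕ.+ W) e₁)) ≈ 0#
    weierstrass-jacobi W V d₁ d₂ d₃ σ₁ σ₂ σ₃ sum≡36 = begin
      _ ≈⟨ +-cong (+-cong (*-cong xz yw) (*-congˡ (*-cong xw yz))) (*-congˡ (*-congˡ (*-cong xy zw))) ⟨
      _ ≈⟨ solve 9 (λ c e m a b x y u v →
             c :* a :* (c :* b) :+ e :* (c :* x :* (c :* y)) :+ e :* (m :* (c :* u :* (c :* v)))
             := c :* c :* (a :* b :+ e :* (x :* y) :+ e :* (m :* (u :* v)))) refl (C * C) -1# m₂ _ _ _ _ _ _ ⟩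
      _ ≈⟨ *-congˡ (weierstrass-Θ M (s≤s (s≤s z≤n)) (q ^ W) (q ^ V) m₁ m₂ m₃ (nil σ₁ d₁) (nil σ₂ d₂) (nil σ₃ d₃)) ⟩
      C * C * (C * C) * 0# ≈⟨ zeroʳ _ ⟩
      0# ∎
      where
      e₁ = suc d₁
      e₂ = suc d₂
      e₃ = suc d₃
      m₁ = σ₁ q^ e₁
      m₂ = σ₂ q^ e₂
      m₃ = σ₃ q^ e₃
      nil : ∀ σ d → (σ q^ suc d) ^ M ≈ 0#
      nil σ d = trans (^-distrib-* (sgn σ) (q ^ suc d) M) (trans (*-congˡ (trans (^-assocʳ q (suc d) M)
        (^-vanish {q} {M} q^M≈0 (ℕₚ.m≤m+n M (d ℕ.* M))))) (zeroʳ _))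
      square : ∀ σ e {X x} → X ≈ q ^ x → σ q^ e * σ q^ e * X ≈ q ^ (e ℕ.+ e ℕ.+ x)
      square σ e {X} {x} X≈ = begin
        σ q^ e * σ q^ e * X                    ≈⟨ *-congˡ X≈ ⟩
        σ q^ e * σ q^ e * q ^ x                ≈⟨ solve 3 (λ s a x → s :* a :* (s :* a) :* x := s :* s :* (a :* a :* x)) refl (sgn σ) (q ^ e) (q ^ x) ⟩
        sgn σ * sgn σ * (q ^ e * q ^ e * q ^ x) ≈⟨ *-cong (sgn-square σ) (trans (*-congʳ (sym (^-homo-* q e e))) (sym (^-homo-* q (e ℕ.+ e) x))) ⟩
        1# * q ^ (e ℕ.+ e ℕ.+ x)               ≈⟨ *-identityˡ _ ⟩
        q ^ (e ℕ.+ e ℕ.+ x)                    ∎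
      m₁₂ : m₁ * m₂ ≈ (σ₁ · σ₂) q^ (e₁ ℕ.+ e₂)
      m₁₂ = q^-* σ₁ e₁ σ₂ e₂
      zX = square σ₁ e₁ {q ^ W} {W} refl
      yX = square σ₂ e₂ zX
      yX′ = square σ₃ e₃ {q ^ V} {V} refl
      zX′ = square σ₂ e₂ yX′
      xz = CC*ΘΘ (σ₂ · σ₃) (d₂ ℕ.+ e₃) (e₁ ℕ.+ e₁ ℕ.+ W) V (q^-* σ₂ e₂ σ₃ e₃) zX refl (≡.trans (eq e₁ e₂ e₃ W V) sum≡36)
        where
        eq : ∀ e₁ e₂ e₃ W V → e₂ ℕ.+ e₃ ℕ.+ (e₁ ℕ.+ e₁ ℕ.+ W) ℕ.+ (e₂ ℕ.+ e₃ ℕ.+ V) ≡ e₁ ℕ.+ e₁ ℕ.+ (e₂ ℕ.+ e₂) ℕ.+ (e₃ ℕ.+ e₃) ℕ.+ W ℕ.+ V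
        eq = solveℕ
      yw = CC*ΘΘ (σ₁ · σ₂) (d₁ ℕ.+ e₂) W (e₃ ℕ.+ e₃ ℕ.+ V) m₁₂ refl yX′ (≡.trans (eq e₁ e₂ e₃ W V) sum≡36)
        where
        eq : ∀ e₁ e₂ e₃ W V → e₁ ℕ.+ e₂ ℕ.+ W ℕ.+ (e₁ ℕ.+ e₂ ℕ.+ (e₃ ℕ.+ e₃ ℕ.+ V)) ≡ e₁ ℕ.+ e₁ ℕ.+ (e₂ ℕ.+ e₂) ℕ.+ (e₃ ℕ.+ e₃) ℕ.+ W ℕ.+ V
        eq = solveℕ
      xw = CC*ΘΘ (σ₁ · σ₂ · σ₃) (d₁ ℕ.+ e₂ ℕ.+ e₃) W V (trans (*-congʳ m₁₂) (q^-* (σ₁ · σ₂) (e₁ ℕ.+ e₂) σ₃ e₃)) refl refl (≡.trans (eq e₁ e₂ e₃ W V) sum≡36)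
        where
        eq : ∀ e₁ e₂ e₃ W V → e₁ ℕ.+ e₂ ℕ.+ e₃ ℕ.+ W ℕ.+ (e₁ ℕ.+ e₂ ℕ.+ e₃ ℕ.+ V) ≡ e₁ ℕ.+ e₁ ℕ.+ (e₂ ℕ.+ e₂) ℕ.+ (e₃ ℕ.+ e₃) ℕ.+ W ℕ.+ V
        eq = solveℕ
      yz = CC*ΘΘ σ₂ d₂ (e₁ ℕ.+ e₁ ℕ.+ W) (e₃ ℕ.+ e₃ ℕ.+ V) refl zX yX′ (≡.trans (eq e₁ e₂ e₃ W V) sum≡36)
        where
        eq : ∀ e₁ e₂ e₃ W V → e₂ ℕ.+ (e₁ ℕ.+ e₁ ℕ.+ W) ℕ.+ (e₂ ℕ.+ (e₃ ℕ.+ e₃ ℕ.+ V)) ≡ e₁ ℕ.+ e₁ ℕ.+ (e₂ ℕ.+ e₂) ℕ.+ (e₃ ℕ.+ e₃) ℕ.+ W ℕ.+ V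
        eq = solveℕ
      xy = CC*ΘΘ σ₃ d₃ (e₂ ℕ.+ e₂ ℕ.+ (e₁ ℕ.+ e₁ ℕ.+ W)) V refl yX refl (≡.trans (eq e₁ e₂ e₃ W V) sum≡36)
        where
        eq : ∀ e₁ e₂ e₃ W V → e₃ ℕ.+ (e₂ ℕ.+ e₂ ℕ.+ (e₁ ℕ.+ e₁ ℕ.+ W)) ℕ.+ (e₃ ℕ.+ V) ≡ e₁ ℕ.+ e₁ ℕ.+ (e₂ ℕ.+ e₂) ℕ.+ (e₃ ℕ.+ e₃) ℕ.+ W ℕ.+ V
        eq = solveℕ
      zw = CC*ΘΘ σ₁ d₁ W (e₂ ℕ.+ e₂ ℕ.+ (e₃ ℕ.+ e₃ ℕ.+ V)) refl refl zX′ (≡.trans (eq e₁ e₂ e₃ W V) sum≡36)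
        where
        eq : ∀ e₁ e₂ e₃ W V → e₁ ℕ.+ W ℕ.+ (e₁ ℕ.+ (e₂ ℕ.+ e₂ ℕ.+ (e₃ ℕ.+ e₃ ℕ.+ V))) ≡ e₁ ℕ.+ e₁ ℕ.+ (e₂ ℕ.+ e₂) ℕ.+ (e₃ ℕ.+ e₃) ℕ.+ W ℕ.+ V
        eq = solveℕ

    g : ℕ → Carrier
    g t = ∏ M (λ k → factor pos (k ℕ.* 72 ℕ.+ t))

    mono : List ℕ → Carrier
    mono []       = 1#
    mono (t ∷ ts) = g t * mono ts

    mono-++ : ∀ ts us → mono (ts ++ us) ≈ mono ts * mono us
    mono-++ []       us = sym (*-identityˡ _)
    mono-++ (t ∷ ts) us = trans (*-congˡ (mono-++ ts us)) (sym (*-assoc _ _ _))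

    mono-insert : ∀ x ts → mono (insert x ts) ≈ g x * mono ts
    mono-insert x []       = refl
    mono-insert x (y ∷ ts) with x ≤ᵇ y
    ... | true  = refl
    ... | false = trans (*-congˡ (mono-insert x ts)) (*-swapˡ _ _ _)

    mono-sort : ∀ ts → mono (sort ts) ≈ mono ts
    mono-sort []       = refl
    mono-sort (t ∷ ts) = trans (mono-insert t (sort ts)) (*-congˡ (mono-sort ts))

    ∏-halves : ∀ u → ∏ K (λ k → factor pos (k ℕ.* 36 ℕ.+ u)) ≈ g u * g (36 ℕ.+ u)
    ∏-halves u = trans (∏-evenOdd M _)
      (*-cong (∏-cong M (λ k → factor-≡ pos (even k u))) (∏-cong M (λ k → factor-≡ pos (odd k u))))
      where
      even : ∀ k u → (k ℕ.+ k) ℕ.* 36 ℕ.+ u ≡ k ℕ.* 72 ℕ.+ u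
      even = solveℕ
      odd : ∀ k u → suc (k ℕ.+ k) ℕ.* 36 ℕ.+ u ≡ k ℕ.* 72 ℕ.+ (36 ℕ.+ u)
      odd = solveℕ

    jacobi-pos : ∀ u → u ≤ 36 → jacobi pos u ≈ mono (quad u)
    jacobi-pos u u≤36 = begin
      jacobi pos u
        ≈⟨ *-cong (∏-halves u) (∏-halves (36 ∸ u)) ⟩
      g u * g (36 ℕ.+ u) * (g (36 ∸ u) * g (36 ℕ.+ (36 ∸ u)))
        ≈⟨ *-congˡ (*-congˡ (reflexive (≡.cong g (≡.sym (ℕₚ.+-∸-assoc 36 u≤36))))) ⟩
      g u * g (36 ℕ.+ u) * (g (36 ∸ u) * g (72 ∸ u))
        ≈⟨ solve 4 (λ a b c d → a :* b :* (c :* d) := a :* (b :* (c :* (d :* con 1)))) refl (g u) (g (36 ℕ.+ u)) (g (36 ∸ u)) (g (72 ∸ u)) ⟩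
      mono (quad u) ∎

    factor-double : ∀ m → factor pos m * factor neg m ≈ factor pos (m ℕ.+ m)
    factor-double m = begin
      (1# + -1# * (1# * x)) * (1# + -1# * (-1# * x))
        ≈⟨ solve 2 (λ e x → (con 1 :+ e :* (con 1 :* x)) :* (con 1 :+ e :* (e :* x)) := con 1 :+ (con 1 :+ e) :* (e :* x) :+ e :* (e :* e) :* (con 1 :* (x :* x))) refl -1# x ⟩
      1# + (1# + -1#) * (-1# * x) + -1# * (-1# * -1#) * (1# * (x * x))
        ≈⟨ +-cong (trans (+-congˡ (trans (*-congʳ 1+-1≈0) (zeroˡ _))) (+-identityʳ 1#))
                  (*-cong (trans (*-congˡ -1*-1≈1) (*-identityʳ -1#)) (*-congˡ (sym (^-homo-* q m m)))) ⟩
      1# + -1# * (1# * q ^ (m ℕ.+ m)) ∎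
      where x = q ^ m

    -- Differences of squares double the base to q^72 but leave K = 2M factors; those after the
    -- first M have exponents at least M and equal 1.
    ∏-double : ∀ u → ∏ K (λ k → factor pos (k ℕ.* 36 ℕ.+ u)) * ∏ K (λ k → factor neg (k ℕ.* 36 ℕ.+ u)) ≈ g (2 ℕ.* u)
    ∏-double u = begin
      ∏ K (λ k → factor pos (k ℕ.* 36 ℕ.+ u)) * ∏ K (λ k → factor neg (k ℕ.* 36 ℕ.+ u))
        ≈⟨ ∏-* K _ _ ⟨
      ∏ K (λ k → factor pos (k ℕ.* 36 ℕ.+ u) * factor neg (k ℕ.* 36 ℕ.+ u))
        ≈⟨ ∏-cong K (λ k → trans (factor-double (k ℕ.* 36 ℕ.+ u)) (factor-≡ pos (twice k u))) ⟩
      ∏ (M ℕ.+ M) (λ k → factor pos (k ℕ.* 72 ℕ.+ 2 ℕ.* u))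
        ≈⟨ ∏-+ M M _ ⟩
      g (2 ℕ.* u) * ∏ M (λ k → factor pos ((M ℕ.+ k) ℕ.* 72 ℕ.+ 2 ℕ.* u))
        ≈⟨ *-congˡ (∏-1 M (λ k _ → trans (+-congˡ (trans (*-congˡ (trans (*-congˡ (^-vanish {q} {M} q^M≈0 (large k))) (zeroʳ _))) (zeroʳ _))) (+-identityʳ 1#))) ⟩
      g (2 ℕ.* u) * 1#
        ≈⟨ *-identityʳ _ ⟩
      g (2 ℕ.* u) ∎
      where
      twice : ∀ k u → k ℕ.* 36 ℕ.+ u ℕ.+ (k ℕ.* 36 ℕ.+ u) ≡ k ℕ.* 72 ℕ.+ 2 ℕ.* u
      twice = solveℕ
      large : ∀ k → M ≤ (M ℕ.+ k) ℕ.* 72 ℕ.+ 2 ℕ.* u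
      large k = ℕₚ.≤-trans (ℕₚ.≤-trans (ℕₚ.m≤m+n M k) (ℕₚ.m≤m*n (M ℕ.+ k) 72)) (ℕₚ.m≤m+n _ (2 ℕ.* u))

    -- Cross-multiplied, because a denominator may fail to be a unit: `quad u` contains the residue
    -- 0 for u = 0 and u = 36.
    _represents_ : Fraction → Carrier → Set
    (n , d) represents x = mono d * x ≈ mono n

    ⊙-represents : ∀ f f′ {x x′} → f represents x → f′ represents x′ → (f ⊙ f′) represents (x * x′)
    ⊙-represents (n , d) (n′ , d′) h h′ = trans (*-congʳ (mono-++ d d′))
      (trans (*-interchange _ _ _ _) (trans (*-cong h h′) (sym (mono-++ n n′))))

    θ-represents : ∀ σ u → u ≤ 36 → θ σ u represents jacobi σ u
    θ-represents pos u u≤36 = trans (*-identityˡ _) (jacobi-pos u u≤36)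
    θ-represents neg u u≤36 = begin
      mono (quad u) * jacobi neg u
        ≈⟨ *-congʳ (jacobi-pos u u≤36) ⟨
      jacobi pos u * jacobi neg u
        ≈⟨ *-interchange _ _ _ _ ⟩
      _ ≈⟨ *-cong (∏-double u) (∏-double (36 ∸ u)) ⟩
      g (2 ℕ.* u) * g (2 ℕ.* (36 ∸ u))
        ≈⟨ *-congˡ (reflexive (≡.cong g (ℕₚ.*-distribˡ-∸ 2 36 u))) ⟩
      g (2 ℕ.* u) * g (72 ∸ 2 ℕ.* u)
        ≈⟨ *-congˡ (*-identityʳ _) ⟨
      mono (2 ℕ.* u ∷ 72 ∸ 2 ℕ.* u ∷ []) ∎

    ⟦_⟧ : Monomial → Carrier
    ⟦ σ , k , ts ⟧ = σ q^ k * mono ts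

    ⟦⟧-⊗ : ∀ a b → ⟦ a ⊗ b ⟧ ≈ ⟦ a ⟧ * ⟦ b ⟧
    ⟦⟧-⊗ (σ , k , ts) (τ , l , us) =
      trans (*-cong (sym (q^-* σ k τ l)) (mono-++ ts us)) (*-interchange _ _ _ _)

    ⟦⟧-⊖ : ∀ a → ⟦ ⊖ a ⟧ ≈ -1# * ⟦ a ⟧
    ⟦⟧-⊖ (σ , k , ts) = trans (*-congʳ (*-congʳ (sgn-flip σ))) (trans (*-congʳ (*-assoc _ _ _)) (*-assoc _ _ _))

    ⟦⟧-~ : ∀ a b → a ~ b → ⟦ a ⟧ ≈ ⟦ b ⟧
    ⟦⟧-~ (σ , k , ts) (.σ , .k , us) (≡.refl , ≡.refl , eq) =
      *-congˡ (trans (sym (mono-sort ts)) (trans (reflexive (≡.cong mono eq)) (mono-sort us)))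

    Holds : Relation → Set
    Holds (a , b , c) = ⟦ a ⟧ + ⟦ b ⟧ + ⟦ c ⟧ ≈ 0#

    swapˡ-holds : ∀ r → Holds r → Holds (swapˡ r)
    swapˡ-holds r h = trans (+-congʳ (+-comm _ _)) h

    swapʳ-holds : ∀ r → Holds r → Holds (swapʳ r)
    swapʳ-holds r h = trans (solve 3 (λ a b c → a :+ c :+ b := a :+ b :+ c) refl _ _ _) h

    clear-holds : ∀ σ k f₁ f₂ f₃ {x₁ x₂ x₃} → f₁ represents x₁ → f₂ represents x₂ → f₃ represents x₃ →
      x₁ + -1# * x₂ + -1# * (σ q^ k * x₃) ≈ 0# → Holds (clear σ k f₁ f₂ f₃)
    clear-holds σ k (n₁ , d₁) (n₂ , d₂) (n₃ , d₃) {x₁} {x₂} {x₃} h₁ h₂ h₃ sum≈0 = begin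
      1# * 1# * mono (n₁ ++ d₂ ++ d₃) + -1# * 1# * mono (n₂ ++ d₁ ++ d₃) + sgn (flip σ) * q ^ k * mono (n₃ ++ d₁ ++ d₂)
        ≈⟨ +-cong (+-cong (*-congˡ (split n₁ d₁ d₂ d₃ h₁)) (*-congˡ (split n₂ d₂ d₁ d₃ h₂)))
                  (*-cong (*-congʳ (sgn-flip σ)) (split n₃ d₃ d₁ d₂ h₃)) ⟩
      1# * 1# * (D₁ * x₁ * (D₂ * D₃)) + -1# * 1# * (D₂ * x₂ * (D₁ * D₃)) + -1# * sgn σ * q ^ k * (D₃ * x₃ * (D₁ * D₂))
        ≈⟨ solve 9 (λ e s p a b c x y z →
             con 1 :* con 1 :* (a :* x :* (b :* c)) :+ e :* con 1 :* (b :* y :* (a :* c)) :+ e :* s :* p :* (c :* z :* (a :* b))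
             := a :* b :* c :* (x :+ e :* y :+ e :* (s :* p :* z))) refl -1# (sgn σ) (q ^ k) D₁ D₂ D₃ x₁ x₂ x₃ ⟩
      D₁ * D₂ * D₃ * (x₁ + -1# * x₂ + -1# * (σ q^ k * x₃))
        ≈⟨ *-congˡ sum≈0 ⟩
      D₁ * D₂ * D₃ * 0#
        ≈⟨ zeroʳ _ ⟩
      0# ∎
      where
      D₁ = mono d₁
      D₂ = mono d₂
      D₃ = mono d₃
      split : ∀ n d d′ d″ {x} → (n , d) represents x → mono (n ++ d′ ++ d″) ≈ mono d * x * (mono d′ * mono d″)
      split n d d′ d″ h = trans (mono-++ n (d′ ++ d″)) (*-cong (sym h) (mono-++ d′ d″))

    weierstrass-holds : ∀ p → T (valid p) → Holds (weierstrass p)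
    weierstrass-holds (params W (suc d₁) (suc d₂) (suc d₃) σ₁ σ₂ σ₃) ok
      with ℕₚ.m≤n⇒∃[o]m+o≡n (ℕₚ.≤ᵇ⇒≤ (suc d₁ ℕ.+ suc d₁ ℕ.+ (suc d₂ ℕ.+ suc d₂) ℕ.+ (suc d₃ ℕ.+ suc d₃) ℕ.+ W) 36 ok)
    ... | V , sum≡36 = clear-holds σ₂ e₂
      (θ-pair (σ₂ · σ₃) (e₂ ℕ.+ e₃) (e₁ ℕ.+ e₁ ℕ.+ W) ⊙ θ-pair (σ₁ · σ₂) (e₁ ℕ.+ e₂) W)
      (θ-pair (σ₁ · σ₂ · σ₃) (e₁ ℕ.+ e₂ ℕ.+ e₃) W ⊙ θ-pair σ₂ e₂ (e₁ ℕ.+ e₁ ℕ.+ W))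
      (θ-pair σ₃ e₃ (e₂ ℕ.+ e₂ ℕ.+ (e₁ ℕ.+ e₁ ℕ.+ W)) ⊙ θ-pair σ₁ e₁ W)
      (both (σ₂ · σ₃) (e₂ ℕ.+ e₃) (e₁ ℕ.+ e₁ ℕ.+ W) (σ₁ · σ₂) (e₁ ℕ.+ e₂) W
        (bound (e₂ ℕ.+ e₃ ℕ.+ V) (s₁ e₁ e₂ e₃ W V)) (bound (e₃ ℕ.+ e₃ ℕ.+ e₁ ℕ.+ e₂ ℕ.+ V) (s₂ e₁ e₂ e₃ W V)))
      (both (σ₁ · σ₂ · σ₃) (e₁ ℕ.+ e₂ ℕ.+ e₃) W σ₂ e₂ (e₁ ℕ.+ e₁ ℕ.+ W)
        (bound (e₁ ℕ.+ e₂ ℕ.+ e₃ ℕ.+ V) (s₃ e₁ e₂ e₃ W V)) (bound (e₂ ℕ.+ e₃ ℕ.+ e₃ ℕ.+ V) (s₄ e₁ e₂ e₃ W V)))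
      (both σ₃ e₃ (e₂ ℕ.+ e₂ ℕ.+ (e₁ ℕ.+ e₁ ℕ.+ W)) σ₁ e₁ W
        (bound (e₃ ℕ.+ V) (s₅ e₁ e₂ e₃ W V)) (bound (e₁ ℕ.+ e₂ ℕ.+ e₂ ℕ.+ e₃ ℕ.+ e₃ ℕ.+ V) (s₆ e₁ e₂ e₃ W V)))
      (weierstrass-jacobi W V d₁ d₂ d₃ σ₁ σ₂ σ₃ sum≡36)
      where
      e₁ = suc d₁
      e₂ = suc d₂
      e₃ = suc d₃
      bound : ∀ {m} o → m ℕ.+ o ≡ e₁ ℕ.+ e₁ ℕ.+ (e₂ ℕ.+ e₂) ℕ.+ (e₃ ℕ.+ e₃) ℕ.+ W ℕ.+ V → m ≤ 36
      bound {m} o eq = ≡.subst (m ≤_) (≡.trans eq sum≡36) (ℕₚ.m≤m+n m o)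
      s₁ : ∀ e₁ e₂ e₃ W V → e₂ ℕ.+ e₃ ℕ.+ (e₁ ℕ.+ e₁ ℕ.+ W) ℕ.+ (e₂ ℕ.+ e₃ ℕ.+ V) ≡ e₁ ℕ.+ e₁ ℕ.+ (e₂ ℕ.+ e₂) ℕ.+ (e₃ ℕ.+ e₃) ℕ.+ W ℕ.+ V
      s₁ = solveℕ
      s₂ : ∀ e₁ e₂ e₃ W V → e₁ ℕ.+ e₂ ℕ.+ W ℕ.+ (e₃ ℕ.+ e₃ ℕ.+ e₁ ℕ.+ e₂ ℕ.+ V) ≡ e₁ ℕ.+ e₁ ℕ.+ (e₂ ℕ.+ e₂) ℕ.+ (e₃ ℕ.+ e₃) ℕ.+ W ℕ.+ V
      s₂ = solveℕ
      s₃ : ∀ e₁ e₂ e₃ W V → e₁ ℕ.+ e₂ ℕ.+ e₃ ℕ.+ W ℕ.+ (e₁ ℕ.+ e₂ ℕ.+ e₃ ℕ.+ V) ≡ e₁ ℕ.+ e₁ ℕ.+ (e₂ ℕ.+ e₂) ℕ.+ (e₃ ℕ.+ e₃) ℕ.+ W ℕ.+ V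
      s₃ = solveℕ
      s₄ : ∀ e₁ e₂ e₃ W V → e₂ ℕ.+ (e₁ ℕ.+ e₁ ℕ.+ W) ℕ.+ (e₂ ℕ.+ e₃ ℕ.+ e₃ ℕ.+ V) ≡ e₁ ℕ.+ e₁ ℕ.+ (e₂ ℕ.+ e₂) ℕ.+ (e₃ ℕ.+ e₃) ℕ.+ W ℕ.+ V
      s₄ = solveℕ
      s₅ : ∀ e₁ e₂ e₃ W V → e₃ ℕ.+ (e₂ ℕ.+ e₂ ℕ.+ (e₁ ℕ.+ e₁ ℕ.+ W)) ℕ.+ (e₃ ℕ.+ V) ≡ e₁ ℕ.+ e₁ ℕ.+ (e₂ ℕ.+ e₂) ℕ.+ (e₃ ℕ.+ e₃) ℕ.+ W ℕ.+ V
      s₅ = solveℕ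
      s₆ : ∀ e₁ e₂ e₃ W V → e₁ ℕ.+ W ℕ.+ (e₁ ℕ.+ e₂ ℕ.+ e₂ ℕ.+ e₃ ℕ.+ e₃ ℕ.+ V) ≡ e₁ ℕ.+ e₁ ℕ.+ (e₂ ℕ.+ e₂) ℕ.+ (e₃ ℕ.+ e₃) ℕ.+ W ℕ.+ V
      s₆ = solveℕ
      single : ∀ σ d z → d ℕ.+ z ≤ 36 → θ-pair σ d z represents jacobi₂ σ (d ℕ.+ z) d
      single σ d z le = ⊙-represents (θ σ (d ℕ.+ z)) (θ σ d) (θ-represents σ (d ℕ.+ z) le) (θ-represents σ d (ℕₚ.≤-trans (ℕₚ.m≤m+n d z) le))
      both : ∀ σ d z τ c y → d ℕ.+ z ≤ 36 → c ℕ.+ y ≤ 36 →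
             (θ-pair σ d z ⊙ θ-pair τ c y) represents (jacobi₂ σ (d ℕ.+ z) d * jacobi₂ τ (c ℕ.+ y) c)
      both σ d z τ c y le le′ = ⊙-represents (θ-pair σ d z) (θ-pair τ c y) (single σ d z le) (single τ c y le′)

    factor-unit : ∀ m → IsUnit (factor pos (suc m))
    factor-unit m = unipotent-unit _ M (trans (^-congˡ M (solve 3 (λ e q x → e :* (con 1 :* (q :* x)) := q :* (e :* x)) refl -1# q (q ^ m)))
      (trans (^-distrib-* q _ M) (trans (*-congʳ q^M≈0) (zeroˡ _))))

    mono-unit : ∀ ts → T (all (1 ≤ᵇ_) ts) → IsUnit (mono ts)
    mono-unit []           _  = 1# , *-identityˡ 1#
    mono-unit (suc t ∷ ts) ok = unit-*
      (unit-∏ M _ (λ k → unit-resp (factor-≡ pos (≡.sym (ℕₚ.+-suc (k ℕ.* 72) t))) (factor-unit (k ℕ.* 72 ℕ.+ t))))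
      (mono-unit ts ok)

    combine : ∀ r r₁ r₂ r₃ → T (all (1 ≤ᵇ_) (leading r₁ r₂ r₃)) → Combines r r₁ r₂ r₃ →
              Holds r₁ → Holds r₂ → Holds r₃ → Holds r
    combine (X , Y , Z) r₁@(A₁ , B₁ , C₁) r₂@(A₂ , B₂ , C₂) r₃@(A₃ , B₃ , C₃) positive (x , y , z , b , c , d) h₁ h₂ h₃ =
      unit-cancel (unit-resp (sym (trans (*-congʳ (*-identityˡ 1#)) (*-identityˡ _))) (mono-unit (leading r₁ r₂ r₃) positive)) (begin
        u * (⟦ X ⟧ + ⟦ Y ⟧ + ⟦ Z ⟧)
          ≈⟨ trans (distribˡ _ _ _) (+-congʳ (distribˡ _ _ _)) ⟩
        u * ⟦ X ⟧ + u * ⟦ Y ⟧ + u * ⟦ Z ⟧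
          ≈⟨ +-cong (+-cong (scale μ₁ A₁ X x) (scale μ₂ A₂ Y y)) (scale μ₃ A₃ Z z) ⟨
        m₁ * ⟦ A₁ ⟧ + m₂ * ⟦ A₂ ⟧ + m₃ * ⟦ A₃ ⟧
          -- Zero is inserted as (1 - 1) times the terms of B₂, B₃ and C₃: the positive copies
          -- complete the second and third relation, the negative ones become the terms of B₁, C₁
          -- and C₂.
          ≈⟨ trans (+-congˡ (trans (*-congʳ 1+-1≈0) (zeroˡ _))) (+-identityʳ _) ⟨
        m₁ * ⟦ A₁ ⟧ + m₂ * ⟦ A₂ ⟧ + m₃ * ⟦ A₃ ⟧ + (1# + -1#) * (m₂ * ⟦ B₂ ⟧ + m₃ * ⟦ B₃ ⟧ + m₃ * ⟦ C₃ ⟧)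
          ≈⟨ solve 7 (λ e a₁ a₂ a₃ b₂ b₃ c₃ →
               a₁ :+ a₂ :+ a₃ :+ (con 1 :+ e) :* (b₂ :+ b₃ :+ c₃)
               := (a₁ :+ e :* b₂ :+ e :* b₃) :+ (a₂ :+ b₂ :+ e :* c₃) :+ (a₃ :+ b₃ :+ c₃)) refl -1#
               (m₁ * ⟦ A₁ ⟧) (m₂ * ⟦ A₂ ⟧) (m₃ * ⟦ A₃ ⟧) (m₂ * ⟦ B₂ ⟧) (m₃ * ⟦ B₃ ⟧) (m₃ * ⟦ C₃ ⟧) ⟩
        (m₁ * ⟦ A₁ ⟧ + -1# * (m₂ * ⟦ B₂ ⟧) + -1# * (m₃ * ⟦ B₃ ⟧)) + (m₂ * ⟦ A₂ ⟧ + m₂ * ⟦ B₂ ⟧ + -1# * (m₃ * ⟦ C₃ ⟧))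
          + (m₃ * ⟦ A₃ ⟧ + m₃ * ⟦ B₃ ⟧ + m₃ * ⟦ C₃ ⟧)
          ≈⟨ +-congʳ (+-cong (+-cong (+-congˡ (cancel μ₁ B₁ μ₂ B₂ b)) (cancel μ₁ C₁ μ₃ B₃ c)) (+-congˡ (cancel μ₂ C₂ μ₃ C₃ d))) ⟨
        (m₁ * ⟦ A₁ ⟧ + m₁ * ⟦ B₁ ⟧ + m₁ * ⟦ C₁ ⟧) + (m₂ * ⟦ A₂ ⟧ + m₂ * ⟦ B₂ ⟧ + m₂ * ⟦ C₂ ⟧)
          + (m₃ * ⟦ A₃ ⟧ + m₃ * ⟦ B₃ ⟧ + m₃ * ⟦ C₃ ⟧)
          ≈⟨ +-cong (+-cong (vanish m₁ h₁) (vanish m₂ h₂)) (vanish m₃ h₃) ⟩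
        0# + 0# + 0#
          ≈⟨ trans (+-identityʳ _) (+-identityʳ 0#) ⟩
        0# ∎)
      where
      U μ₁ μ₂ μ₃ : Monomial
      U  = pos , 0 , leading r₁ r₂ r₃
      μ₁ = multiplier X A₁ (residues A₂ ++ residues A₃)
      μ₂ = multiplier Y A₂ (residues A₁ ++ residues A₃)
      μ₃ = multiplier Z A₃ (residues A₁ ++ residues A₂)
      u m₁ m₂ m₃ : Carrier
      u  = ⟦ U ⟧
      m₁ = ⟦ μ₁ ⟧
      m₂ = ⟦ μ₂ ⟧
      m₃ = ⟦ μ₃ ⟧
      scale : ∀ μ A X → μ ⊗ A ~ U ⊗ X → ⟦ μ ⟧ * ⟦ A ⟧ ≈ u * ⟦ X ⟧
      scale μ A X h = trans (sym (⟦⟧-⊗ μ A)) (trans (⟦⟧-~ (μ ⊗ A) (U ⊗ X) h) (⟦⟧-⊗ U X))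
      cancel : ∀ μ B ν C → μ ⊗ B ~ ⊖ (ν ⊗ C) → ⟦ μ ⟧ * ⟦ B ⟧ ≈ -1# * (⟦ ν ⟧ * ⟦ C ⟧)
      cancel μ B ν C h = trans (sym (⟦⟧-⊗ μ B)) (trans (⟦⟧-~ (μ ⊗ B) (⊖ (ν ⊗ C)) h) (trans (⟦⟧-⊖ (ν ⊗ C)) (*-congˡ (⟦⟧-⊗ ν C))))
      vanish : ∀ m {a b c} → a + b + c ≈ 0# → m * a + m * b + m * c ≈ 0#
      vanish m {a} {b} {c} h = trans (solve 4 (λ m a b c → m :* a :+ m :* b :+ m :* c := m :* (a :+ b :+ c)) refl m a b c)
        (trans (*-congˡ h) (zeroʳ m))

-- Integer power series modulo q^N.

module PowerSeries where

  open import Data.Integer using (_+_; _*_; -_; 0ℤ; 1ℤ)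
  open ≡ using (refl; sym; trans; cong; cong₂; module ≡-Reasoning)

  Series : Set
  Series = ℕ → ℤ

  infixl 7 _⋆_
  _⋆_ : Series → Series → Series
  (f ⋆ g) zero    = f 0 * g 0
  (f ⋆ g) (suc n) = f 0 * g (suc n) + (f ∘ suc ⋆ g) n

  one X : Series
  one zero    = 1ℤ
  one (suc _) = 0ℤ
  X zero    = 0ℤ
  X (suc n) = one n

  ⋆-cong≤ : ∀ n {f f′ g g′} → (∀ k → k ≤ n → f k ≡ f′ k) → (∀ k → k ≤ n → g k ≡ g′ k) → (f ⋆ g) n ≡ (f′ ⋆ g′) n
  ⋆-cong≤ zero    p q = cong₂ _*_ (p 0 z≤n) (q 0 z≤n)
  ⋆-cong≤ (suc n) p q = cong₂ _+_ (cong₂ _*_ (p 0 z≤n) (q (suc n) ℕₚ.≤-refl))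
    (⋆-cong≤ n (λ k k≤n → p (suc k) (s≤s k≤n)) (λ k k≤n → q k (ℕₚ.m≤n⇒m≤1+n k≤n)))

  ⋆-zeroˡ : ∀ g n → ((λ _ → 0ℤ) ⋆ g) n ≡ 0ℤ
  ⋆-zeroˡ g zero    = refl
  ⋆-zeroˡ g (suc n) = trans (ℤₚ.+-identityˡ _) (⋆-zeroˡ g n)

  ⋆-identityˡ : ∀ g n → (one ⋆ g) n ≡ g n
  ⋆-identityˡ g zero    = ℤₚ.*-identityˡ (g 0)
  ⋆-identityˡ g (suc n) = trans (cong₂ _+_ (ℤₚ.*-identityˡ (g (suc n))) (⋆-zeroˡ g n)) (ℤₚ.+-identityʳ _)

  ⋆-distribʳ : ∀ h f g n → ((λ k → f k + g k) ⋆ h) n ≡ (f ⋆ h) n + (g ⋆ h) n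
  ⋆-distribʳ h f g zero    = ℤₚ.*-distribʳ-+ (h 0) (f 0) (g 0)
  ⋆-distribʳ h f g (suc n) = trans (cong (λ z → (f 0 + g 0) * h (suc n) + z) (⋆-distribʳ h (f ∘ suc) (g ∘ suc) n))
    (step (f 0) (g 0) (h (suc n)) _ _)
    where
    step : ∀ a b c x y → (a + b) * c + (x + y) ≡ a * c + x + (b * c + y)
    step = solve-∀

  ⋆-scaleˡ : ∀ c f g n → ((λ k → c * f k) ⋆ g) n ≡ c * (f ⋆ g) n
  ⋆-scaleˡ c f g zero    = ℤₚ.*-assoc c (f 0) (g 0)
  ⋆-scaleˡ c f g (suc n) = trans (cong (λ z → c * f 0 * g (suc n) + z) (⋆-scaleˡ c (f ∘ suc) g n)) (step c (f 0) (g (suc n)) _)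
    where
    step : ∀ c a b x → c * a * b + c * x ≡ c * (a * b + x)
    step = solve-∀

  ⋆-sucʳ : ∀ f g n → (f ⋆ g) (suc n) ≡ g 0 * f (suc n) + (f ⋆ g ∘ suc) n
  ⋆-sucʳ f g zero    = step (f 0) (g 1) (f 1) (g 0)
    where
    step : ∀ a b c d → a * b + c * d ≡ d * c + a * b
    step = solve-∀
  ⋆-sucʳ f g (suc n) = trans (cong (λ z → f 0 * g (suc (suc n)) + z) (⋆-sucʳ (f ∘ suc) g n)) (step (f 0 * g (suc (suc n))) (g 0 * f (suc (suc n))) _)
    where
    step : ∀ a b c → a + (b + c) ≡ b + (a + c)
    step = solve-∀

  ⋆-comm : ∀ f g n → (f ⋆ g) n ≡ (g ⋆ f) n
  ⋆-comm f g zero    = ℤₚ.*-comm (f 0) (g 0)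
  ⋆-comm f g (suc n) = trans (cong (λ z → f 0 * g (suc n) + z) (⋆-comm (f ∘ suc) g n)) (sym (⋆-sucʳ g f n))

  ⋆-assoc : ∀ f g h n → ((f ⋆ g) ⋆ h) n ≡ (f ⋆ (g ⋆ h)) n
  ⋆-assoc f g h zero    = ℤₚ.*-assoc (f 0) (g 0) (h 0)
  ⋆-assoc f g h (suc n) = begin
    f 0 * g 0 * h (suc n) + ((λ k → f 0 * g (suc k) + (f ∘ suc ⋆ g) k) ⋆ h) n
      ≡⟨ cong (λ z → f 0 * g 0 * h (suc n) + z) (⋆-distribʳ h (λ k → f 0 * g (suc k)) (f ∘ suc ⋆ g) n) ⟩
    f 0 * g 0 * h (suc n) + (((λ k → f 0 * g (suc k)) ⋆ h) n + ((f ∘ suc ⋆ g) ⋆ h) n)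
      ≡⟨ cong (λ z → f 0 * g 0 * h (suc n) + z) (cong₂ _+_ (⋆-scaleˡ (f 0) (g ∘ suc) h n) (⋆-assoc (f ∘ suc) g h n)) ⟩
    f 0 * g 0 * h (suc n) + (f 0 * (g ∘ suc ⋆ h) n + (f ∘ suc ⋆ (g ⋆ h)) n)
      ≡⟨ step (f 0) (g 0) (h (suc n)) _ _ ⟩
    f 0 * (g 0 * h (suc n) + (g ∘ suc ⋆ h) n) + (f ∘ suc ⋆ (g ⋆ h)) n ∎
    where
    open ≡-Reasoning
    step : ∀ a b c x y → a * b * c + (a * x + y) ≡ a * (b * c + x) + y
    step = solve-∀

  X-⋆ : ∀ f n → (X ⋆ f) (suc n) ≡ f n
  X-⋆ f n = trans (ℤₚ.+-identityˡ _) (⋆-identityˡ f n)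

  -- The quotient ℤ[[q]]/(q^N) as a setoid: operations are those of full series and only equality is
  -- truncated, so an equation directly yields the coefficients below N.
  truncatedSeries : ℕ → CommutativeRing 0ℓ 0ℓ
  truncatedSeries N = record
    { Carrier = Series
    ; _≈_ = λ f g → ∀ n → n < N → f n ≡ g n
    ; _+_ = λ f g n → f n + g n
    ; _*_ = _⋆_
    ; -_ = λ f n → - f n
    ; 0# = λ _ → 0ℤ
    ; 1# = one
    ; isCommutativeRing = record
      { isRing = record
        { +-isAbelianGroup = record
          { isGroup = record
            { isMonoid = record
              { isSemigroup = record
                { isMagma = record
                  { isEquivalence = record
                    { refl = λ _ _ → refl
                    ; sym = λ p n n<N → sym (p n n<N)
                    ; trans = λ p q n n<N → trans (p n n<N) (q n n<N) }
                  ; ∙-cong = λ p q n n<N → cong₂ _+_ (p n n<N) (q n n<N) }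
                ; assoc = λ f g h n _ → ℤₚ.+-assoc (f n) (g n) (h n) }
              ; identity = (λ f n _ → ℤₚ.+-identityˡ (f n)) , (λ f n _ → ℤₚ.+-identityʳ (f n)) }
            ; inverse = (λ f n _ → ℤₚ.+-inverseˡ (f n)) , (λ f n _ → ℤₚ.+-inverseʳ (f n))
            ; ⁻¹-cong = λ p n n<N → cong -_ (p n n<N) }
          ; comm = λ f g n _ → ℤₚ.+-comm (f n) (g n) }
        ; *-cong = λ p q n n<N → ⋆-cong≤ n (λ k k≤n → p k (ℕₚ.≤-<-trans k≤n n<N)) (λ k k≤n → q k (ℕₚ.≤-<-trans k≤n n<N))
        ; *-assoc = λ f g h n _ → ⋆-assoc f g h n
        ; *-identity = (λ f n _ → ⋆-identityˡ f n) , (λ f n _ → trans (⋆-comm f one n) (⋆-identityˡ f n))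
        ; distrib = (λ h f g n _ → trans (⋆-comm h (λ k → f k + g k) n)
                      (trans (⋆-distribʳ h f g n) (cong₂ _+_ (⋆-comm f h n) (⋆-comm g h n))))
                  , (λ h f g n _ → ⋆-distribʳ h f g n) }
      ; *-comm = λ f g n _ → ⋆-comm f g n } }

  module Shift (N : ℕ) where
    open CommutativeRing (truncatedSeries N) using (semiring)
    open import Algebra.Properties.Semiring.Exp semiring using (_^_)

    X^-⋆-suc : ∀ k f n → (X ^ suc k ⋆ f) (suc n) ≡ (X ^ k ⋆ f) n
    X^-⋆-suc k f n = trans (⋆-assoc X (X ^ k) f (suc n)) (X-⋆ (X ^ k ⋆ f) n)

    X^-⋆-above : ∀ k f n → (X ^ k ⋆ f) (k ℕ.+ n) ≡ f n
    X^-⋆-above zero    f n = ⋆-identityˡ f n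
    X^-⋆-above (suc k) f n = trans (X^-⋆-suc k f (k ℕ.+ n)) (X^-⋆-above k f n)

    X^-⋆-below : ∀ k f n → n < k → (X ^ k ⋆ f) n ≡ 0ℤ
    X^-⋆-below (suc k) f zero    _         = trans (⋆-assoc X (X ^ k) f 0) refl
    X^-⋆-below (suc k) f (suc n) (s≤s n<k) = trans (X^-⋆-suc k f n) (X^-⋆-below k f n n<k)

    X^-coefficient : ∀ k n → n ≢ k → (X ^ k) n ≡ 0ℤ
    X^-coefficient zero    zero    n≢k = ⊥-elim (n≢k refl)
    X^-coefficient zero    (suc n) n≢k = refl
    X^-coefficient (suc k) zero    n≢k = refl
    X^-coefficient (suc k) (suc n) n≢k = trans (X-⋆ (X ^ k) n) (X^-coefficient k n (n≢k ∘ cong suc))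

-- Counting partitions by their largest part.

module Partitions (S : ℕ → Bool) where

  open import Data.Nat using (_+_)
  open ≡ using (refl; sym; trans; cong; cong₂; module ≡-Reasoning)
  open Fold ℕₚ.+-0-commutativeMonoid using () renaming (fold to ∑; fold-cong< to ∑-cong<; fold-ε to ∑-0; fold-+ to ∑-+; fold-cons to ∑-cons)

  count : List (List ℕ) → ℕ
  count = length ∘ filter (λ λs → T? (all S λs))

  count-++ : ∀ xs ys → count (xs ++ ys) ≡ count xs + count ys
  count-++ xs ys = trans (cong length (filter-++ _ xs ys)) (length-++ (filter _ xs))

  count-concatMap : ∀ (F : ℕ → List (List ℕ)) ks → count (concatMap F ks) ≡ sum (map (count ∘ F) ks)
  count-concatMap F []       = refl
  count-concatMap F (k ∷ ks) = trans (count-++ (F k) (concatMap F ks)) (cong (λ z → count (F k) + z) (count-concatMap F ks))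

  count-∷ : ∀ a xs → count (map (a ∷_) xs) ≡ (if S a then count xs else 0)
  count-∷ a xs with S a in eq
  ... | true  = kept xs
    where
    kept : ∀ xs → count (map (a ∷_) xs) ≡ count xs
    kept []       = refl
    kept (x ∷ xs) rewrite eq with all S x
    ... | true  = cong suc (kept xs)
    ... | false = kept xs
  ... | false = removed xs
    where
    removed : ∀ xs → count (map (a ∷_) xs) ≡ 0
    removed []       = refl
    removed (x ∷ xs) rewrite eq = removed xs

  sum-filter : ∀ (h : ℕ → ℕ) (b : ℕ → Bool) (f : ℕ → ℕ) n →
               sum (map h (filter (T? ∘ b) (applyUpTo f n))) ≡ ∑ n (λ k → if b (f k) then h (f k) else 0)
  sum-filter h b f zero    = refl
  sum-filter h b f (suc n) = trans step (sym (∑-cons n _))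
    where
    step : sum (map h (filter (T? ∘ b) (f 0 ∷ applyUpTo (f ∘ suc) n))) ≡
           (if b (f 0) then h (f 0) else 0) + ∑ n (λ k → if b (f (suc k)) then h (f (suc k)) else 0)
    step with b (f 0)
    ... | true  = cong (λ z → h (f 0) + z) (sum-filter h b (f ∘ suc) n)
    ... | false = sum-filter h b (f ∘ suc) n

  ≤ᵇ-true : ∀ {m n} → m ≤ n → (m ≤ᵇ n) ≡ true
  ≤ᵇ-true {m} {n} m≤n = dec-true (m ℕₚ.≤? n) m≤n

  ≤ᵇ-false : ∀ {m n} → n < m → (m ≤ᵇ n) ≡ false
  ≤ᵇ-false {m} {n} n<m = dec-false (m ℕₚ.≤? n) (ℕₚ.<⇒≱ n<m)

  bounded : ℕ → ℕ → ℕ → ℕ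
  bounded f m n = count (partitionsBounded f m n)

  largest : ℕ → ℕ → ℕ → ℕ
  largest f n k = if S (suc k) then bounded f (suc k) (n ∸ k) else 0

  bounded-∑ : ∀ f m n → bounded (suc f) m (suc n) ≡ ∑ (suc n) (λ k → if (suc k ≤ᵇ m) ∧ (suc k ≤ᵇ suc n) then largest f n k else 0)
  bounded-∑ f m n = trans (count-concatMap F (filter (T? ∘ admissible) (upTo (suc n))))
    (trans (sum-filter (count ∘ F) admissible id (suc n))
      (∑-cong< (suc n) (λ k _ → cong (λ z → if admissible k then z else 0) (count-∷ (suc k) (partitionsBounded f (suc k) (n ∸ k))))))
    where
    admissible : ℕ → Bool
    admissible k = (suc k ≤ᵇ m) ∧ (suc k ≤ᵇ suc n)
    F : ℕ → List (List ℕ)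
    F k = map (suc k ∷_) (partitionsBounded f (suc k) (n ∸ k))

  bounded-all : ∀ f m n → suc n ≤ m → bounded (suc f) m (suc n) ≡ ∑ (suc n) (largest f n)
  bounded-all f m n n<m = trans (bounded-∑ f m n) (∑-cong< (suc n) (λ k k≤n →
    cong₂ (λ x y → if x ∧ y then largest f n k else 0) (≤ᵇ-true (ℕₚ.≤-trans k≤n n<m)) (≤ᵇ-true k≤n)))

  bounded-some : ∀ f m n → m ≤ suc n → bounded (suc f) m (suc n) ≡ ∑ m (largest f n)
  bounded-some f m n m≤1+n with ℕₚ.m≤n⇒∃[o]m+o≡n m≤1+n
  ... | o , eq = begin
    bounded (suc f) m (suc n)                ≡⟨ bounded-∑ f m n ⟩
    ∑ (suc n) h                              ≡⟨ cong (λ l → ∑ l h) eq ⟨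
    ∑ (m + o) h                              ≡⟨ ∑-+ m o h ⟩
    ∑ m h + ∑ o (λ k → h (m + k))            ≡⟨ cong₂ _+_ (∑-cong< m below) (∑-0 o above) ⟩
    ∑ m (largest f n) + 0                    ≡⟨ ℕₚ.+-identityʳ _ ⟩
    ∑ m (largest f n)                        ∎
    where
    open ≡-Reasoning
    h : ℕ → ℕ
    h k = if (suc k ≤ᵇ m) ∧ (suc k ≤ᵇ suc n) then largest f n k else 0
    below : ∀ k → k < m → h k ≡ largest f n k
    below k k<m = cong₂ (λ x y → if x ∧ y then largest f n k else 0) (≤ᵇ-true k<m) (≤ᵇ-true (ℕₚ.≤-trans k<m m≤1+n))
    above : ∀ k → k < o → h (m + k) ≡ 0
    above k _ = cong (λ x → if x ∧ (suc (m + k) ≤ᵇ suc n) then largest f n (m + k) else 0) (≤ᵇ-false (s≤s (ℕₚ.m≤m+n m k)))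

  bounded-fuel : ∀ f f′ m n → n ≤ f → n ≤ f′ → bounded f m n ≡ bounded f′ m n
  bounded-fuel f       f′       m zero    _         _          = refl
  bounded-fuel (suc f) (suc f′) m (suc n) (s≤s n≤f) (s≤s n≤f′) = trans (bounded-∑ f m n) (trans
    (∑-cong< (suc n) (λ k _ → cong (λ z → if (suc k ≤ᵇ m) ∧ (suc k ≤ᵇ suc n) then (if S (suc k) then z else 0) else 0)
      (bounded-fuel f f′ (suc k) (n ∸ k) (ℕₚ.≤-trans (ℕₚ.m∸n≤m n k) n≤f) (ℕₚ.≤-trans (ℕₚ.m∸n≤m n k) n≤f′))))
    (sym (bounded-∑ f′ m n)))

  -- The fuel n is large enough to count all partitions of n into parts of S not exceeding m.
  P≤ : ℕ → ℕ → ℕ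
  P≤ m n = bounded n m n

  P≤-none : ∀ n → P≤ 0 (suc n) ≡ 0
  P≤-none n = bounded-some n 0 n z≤n

  -- Removing one copy of the part `suc m` is a bijection onto the partitions of `r` into parts up
  -- to `suc m`. As the enumeration goes by the largest part, the two counts of partitions of suc m
  -- + r differ by one summand only.
  P≤-step : ∀ m r → P≤ (suc m) (suc m + r) ≡ P≤ m (suc m + r) + (if S (suc m) then P≤ (suc m) r else 0)
  P≤-step m r = trans (bounded-some n (suc m) n (s≤s (ℕₚ.m≤m+n m r)))
    (cong₂ _+_ (sym (bounded-some n m n (ℕₚ.m≤n⇒m≤1+n (ℕₚ.m≤m+n m r))))
      (cong (λ z → if S (suc m) then z else 0) (trans (cong (bounded n (suc m)) (ℕₚ.m+n∸m≡n m r)) (bounded-fuel n r (suc m) r (ℕₚ.m≤n+m r m) ℕₚ.≤-refl))))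
    where n = m + r

  P≤-stable : ∀ m n → n ≤ m → P≤ (suc m) n ≡ P≤ m n
  P≤-stable m zero    _   = refl
  P≤-stable m (suc n) n<m = trans (bounded-all n (suc m) n (ℕₚ.m≤n⇒m≤1+n n<m)) (sym (bounded-all n m n n<m))

  P≤-p : ∀ m n → n ≤ m → P≤ m n ≡ p S n
  P≤-p m zero    _   = refl
  P≤-p m (suc n) n<m = trans (bounded-all n m n n<m) (sym (bounded-all n (suc n) n ℕₚ.≤-refl))

-- Generating functions of partitions as products.

module GeneratingFunctions (n : ℕ) where

  open import Data.Integer using (+_; 0ℤ)
  open PowerSeries
  open Partitions
  open Certificates

  -- Large enough to see the coefficient of q^n, and at least 2 as the theta relation requires.
  N : ℕ
  N = suc (suc n)

  open Shift N
  open CommutativeRing (truncatedSeries N) hiding (zero)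
  open import Algebra.Properties.Ring ring using (-1*x≈-x)
  open import Algebra.Properties.Semiring.Exp semiring using (_^_)
  open import Algebra.Solver.Ring.NaturalCoefficients.Default commutativeSemiring using (solve; _:=_; _:+_; _:*_; con)
  open import Relation.Binary.Reasoning.Setoid setoid
  open Fold *-commutativeMonoid using () renaming (fold to ∏; fold-cong to ∏-cong; fold-* to ∏-blocks; fold-swap to ∏-swap; fold-cons to ∏-cons; fold-ε to ∏-1)
  open WeierstrassRelation (truncatedSeries N) using (-1#; 1+-1≈0)

  X^M≈0 : X ^ N ≈ 0#
  X^M≈0 k k<M = X^-coefficient N k (ℕₚ.<⇒≢ k<M)

  open ThetaQuotients (truncatedSeries N)
  open Truncated X n X^M≈0

  module _ (S : ℕ → Bool) where

    series : ℕ → Series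
    series m k = + P≤ S m k

    euler : ℕ → Carrier
    euler k = if S k then factor pos k else 1#

    -- Parts up to 72M cover every exponent below M, and 72M is a whole number of periods of the
    -- residue sets.
    partitions-p : series (M ℕ.* 72) ≈ λ k → + p S k
    partitions-p k k<M = ≡.cong +_ (P≤-p S (M ℕ.* 72) k (ℕₚ.≤-trans (ℕₚ.<⇒≤ k<M) (ℕₚ.m≤m*n M 72)))

    series-step : ∀ m → series (suc m) ≈ series m + (if S (suc m) then X ^ suc m * series (suc m) else 0#)
    series-step m k _ with suc m ℕₚ.≤? k
    series-step m k _ | yes m<k with ℕₚ.m≤n⇒∃[o]m+o≡n m<k
    ... | r , ≡.refl = ≡.trans (≡.cong +_ (P≤-step S m r)) (≡.cong (λ z → + P≤ S m (suc m ℕ.+ r) ℤ.+ z) (part r))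
      where
      part : ∀ r → + (if S (suc m) then P≤ S (suc m) r else 0) ≡ (if S (suc m) then X ^ suc m * series (suc m) else 0#) (suc m ℕ.+ r)
      part r with S (suc m)
      ... | true  = ≡.sym (X^-⋆-above (suc m) (series (suc m)) r)
      ... | false = ≡.refl
    series-step m k _ | no m≮k = ≡.trans (≡.cong +_ (P≤-stable S m k k≤m)) (≡.sym (≡.trans (≡.cong (λ z → + P≤ S m k ℤ.+ z) part) (ℤₚ.+-identityʳ _)))
      where
      k≤m : k ≤ m
      k≤m = ℕₚ.≤-pred (ℕₚ.≰⇒> m≮k)
      part : (if S (suc m) then X ^ suc m * series (suc m) else 0#) k ≡ 0ℤ
      part with S (suc m)
      ... | true  = X^-⋆-below (suc m) (series (suc m)) k (s≤s k≤m)
      ... | false = ≡.refl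

    series-euler : ∀ m → series (suc m) * euler (suc m) ≈ series m
    series-euler m with S (suc m) | series-step m
    ... | false | h = trans (*-identityʳ _) (trans h (+-identityʳ _))
    ... | true  | h = begin
      series (suc m) * (1# + -1# * (1# * X ^ suc m))
        ≈⟨ solve 3 (λ e x s → s :* (con 1 :+ e :* (con 1 :* x)) := s :+ e :* (x :* s)) refl -1# (X ^ suc m) (series (suc m)) ⟩
      series (suc m) + -1# * (X ^ suc m * series (suc m))
        ≈⟨ +-congʳ h ⟩
      series m + X ^ suc m * series (suc m) + -1# * (X ^ suc m * series (suc m))
        ≈⟨ solve 3 (λ e s x → s :+ x :+ e :* x := s :+ (con 1 :+ e) :* x) refl -1# (series m) (X ^ suc m * series (suc m)) ⟩
      series m + (1# + -1#) * (X ^ suc m * series (suc m))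
        ≈⟨ +-congˡ {series m} (trans (*-congʳ {X ^ suc m * series (suc m)} 1+-1≈0) (zeroˡ (X ^ suc m * series (suc m)))) ⟩
      series m + 0#
        ≈⟨ +-identityʳ _ ⟩
      series m ∎

    -- Euler's product by telescoping: `series-euler` removes one part size at a time, and the
    -- product is kept on the left so that no inverse appears.
    series-∏ : ∀ m → series m * ∏ m (euler ∘ suc) ≈ 1#
    series-∏ zero    = trans (*-identityʳ _) empty
      where
      empty : series 0 ≈ 1#
      empty zero    _ = ≡.refl
      empty (suc k) _ = ≡.cong +_ (P≤-none S k)
    series-∏ (suc m) = trans (solve 3 (λ s a b → s :* (a :* b) := s :* b :* a) refl (series (suc m)) (∏ m (euler ∘ suc)) (euler (suc m)))
      (trans (*-congʳ (series-euler m)) (series-∏ m))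

    mono-filter : ∀ f l → mono (filter (T? ∘ S) (applyUpTo f l)) ≈ ∏ l (λ j → if S (f j) then g (f j) else 1#)
    mono-filter f zero    = refl
    mono-filter f (suc l) = trans step (sym (∏-cons l _))
      where
      step : mono (filter (T? ∘ S) (f 0 ∷ applyUpTo (f ∘ suc) l)) ≈
             (if S (f 0) then g (f 0) else 1#) * ∏ l (λ j → if S (f (suc j)) then g (f (suc j)) else 1#)
      step with S (f 0)
      ... | true  = *-congˡ (mono-filter (f ∘ suc) l)
      ... | false = trans (mono-filter (f ∘ suc) l) (sym (*-identityˡ _))

    -- The part sizes form M rows of length 72. By periodicity the column of a residue t is either
    -- the truncation of (q^t; q^72)_∞ or constantly 1.
    euler-∏ : (∀ i j → S (suc (i ℕ.* 72 ℕ.+ j)) ≡ S (suc j)) →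
              ∏ (M ℕ.* 72) (euler ∘ suc) ≈ mono (filter (T? ∘ S) (applyUpTo suc 72))
    euler-∏ periodic = begin
      ∏ (M ℕ.* 72) (euler ∘ suc)                                  ≈⟨ ∏-blocks M 72 (euler ∘ suc) ⟩
      ∏ M (λ i → ∏ 72 (λ j → euler (suc (i ℕ.* 72 ℕ.+ j))))        ≈⟨ ∏-swap M 72 (λ i j → euler (suc (i ℕ.* 72 ℕ.+ j))) ⟩
      ∏ 72 (λ j → ∏ M (λ i → euler (suc (i ℕ.* 72 ℕ.+ j))))        ≈⟨ ∏-cong 72 column ⟩
      ∏ 72 (λ j → if S (suc j) then g (suc j) else 1#)            ≈⟨ mono-filter suc 72 ⟨
      mono (filter (T? ∘ S) (applyUpTo suc 72))                   ∎
      where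
      column : ∀ j → ∏ M (λ i → euler (suc (i ℕ.* 72 ℕ.+ j))) ≈ (if S (suc j) then g (suc j) else 1#)
      column j with S (suc j) in eq
      ... | true  = ∏-cong M entry
        where
        entry : ∀ i → euler (suc (i ℕ.* 72 ℕ.+ j)) ≈ factor pos (i ℕ.* 72 ℕ.+ suc j)
        entry i rewrite periodic i j | eq = factor-≡ pos (≡.sym (ℕₚ.+-suc (i ℕ.* 72) j))
      ... | false = ∏-1 M entry
        where
        entry : ∀ i → i < M → euler (suc (i ℕ.* 72 ℕ.+ j)) ≈ 1#
        entry i _ rewrite periodic i j | eq = refl

    p-∏ : (∀ i j → S (suc (i ℕ.* 72 ℕ.+ j)) ≡ S (suc j)) →
          (λ k → + p S k) * mono (filter (T? ∘ S) (applyUpTo suc 72)) ≈ 1#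
    p-∏ periodic = trans (*-cong (sym partitions-p) (sym (euler-∏ periodic))) (series-∏ (M ℕ.* 72))

  pmSet72-periodic : ∀ rs i j → pmSet72 rs (suc (i ℕ.* 72 ℕ.+ j)) ≡ pmSet72 rs (suc j)
  pmSet72-periodic rs i j = any-cong rs (λ r → ≡.cong₂ (λ x y → (x ℕ.≡ᵇ (r % 72)) ∨ (y ℕ.≡ᵇ 0))
      (≡.trans (≡.cong (_% 72) (arrange₀ i j)) ([m+kn]%n≡m%n (suc j) i 72))
      (≡.trans (≡.cong (_% 72) (arrange i j r)) ([m+kn]%n≡m%n (suc j ℕ.+ r) i 72)))
    where
    any-cong : ∀ rs {f h : ℕ → Bool} → (∀ r → f r ≡ h r) → any f rs ≡ any h rs
    any-cong []       eq = ≡.refl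
    any-cong (r ∷ rs) eq = ≡.cong₂ _∨_ (eq r) (any-cong rs eq)
    arrange₀ : ∀ i j → suc (i ℕ.* 72 ℕ.+ j) ≡ suc j ℕ.+ i ℕ.* 72
    arrange₀ = solveℕ
    arrange : ∀ i j r → suc (i ℕ.* 72 ℕ.+ j) ℕ.+ r ≡ suc j ℕ.+ r ℕ.+ i ℕ.* 72
    arrange = solveℕ

  derivable-holds : ∀ {r} → Derivable r → Holds r
  derivable-holds (basic w ok)  = weierstrass-holds w ok
  derivable-holds (left {r} d)  = swapˡ-holds r (derivable-holds d)
  derivable-holds (right {r} d) = swapʳ-holds r (derivable-holds d)

  module _ {S S′ : List ℕ} {κ : ℕ} {σ : Sign} {ℓ : ℕ} (cert : Certificate S S′ κ σ ℓ) where

    private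
      open Certificate cert
      x y a b : Carrier
      x = λ k → + p (pmSet72 S) k
      y = λ k → + p (pmSet72 S′) k
      a = mono (members S)
      b = mono (members S′)
      xa≈1 : x * a ≈ 1#
      xa≈1 = p-∏ (pmSet72 S) (pmSet72-periodic S)
      yb≈1 : y * b ≈ 1#
      yb≈1 = p-∏ (pmSet72 S′) (pmSet72-periodic S′)
      cleared : 1# * 1# * b + -1# * X ^ κ * a + sgn (flip σ) * X ^ ℓ * mono (members S ++ members S′) ≈ 0#
      cleared = combine (target S S′ κ σ ℓ) r₁ r₂ r₃ positive combines (derivable-holds d₁) (derivable-holds d₂) (derivable-holds d₃)
      w : Carrier
      w = X ^ κ * y + σ q^ ℓ
      vanish : x + -1# * w ≈ 0#
      vanish = begin
        x + -1# * (X ^ κ * y + σ q^ ℓ)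
          ≈⟨ solve 5 (λ e k x y l → x :+ e :* (k :* y :+ l) := x :* con 1 :+ e :* k :* y :* con 1 :+ e :* l :* (con 1 :* con 1)) refl -1# (X ^ κ) x y (σ q^ ℓ) ⟩
        x * 1# + -1# * X ^ κ * y * 1# + -1# * σ q^ ℓ * (1# * 1#)
          -- Writing each 1 as x a or y b exposes the factor x y in front of the cleared relation.
          ≈⟨ +-cong (+-cong (*-congˡ yb≈1) (*-congˡ xa≈1)) (*-congˡ (*-cong xa≈1 yb≈1)) ⟨
        x * (y * b) + -1# * X ^ κ * y * (x * a) + -1# * σ q^ ℓ * (x * a * (y * b))
          ≈⟨ solve 8 (λ e x y a b k s l →
               x :* (y :* b) :+ e :* k :* y :* (x :* a) :+ e :* (s :* l) :* (x :* a :* (y :* b))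
               := x :* y :* (con 1 :* con 1 :* b :+ e :* k :* a :+ e :* s :* l :* (a :* b))) refl -1# x y a b (X ^ κ) (sgn σ) (X ^ ℓ) ⟩
        x * y * (1# * 1# * b + -1# * X ^ κ * a + -1# * sgn σ * X ^ ℓ * (a * b))
          ≈⟨ *-congˡ (+-congˡ {1# * 1# * b + -1# * X ^ κ * a} (*-cong (*-congʳ {X ^ ℓ} (sym (sgn-flip σ))) (sym (mono-++ (members S) (members S′))))) ⟩
        x * y * (1# * 1# * b + -1# * X ^ κ * a + sgn (flip σ) * X ^ ℓ * mono (members S ++ members S′))
          ≈⟨ *-congˡ cleared ⟩
        x * y * 0#
          ≈⟨ zeroʳ (x * y) ⟩
        0# ∎

    generating-identity : (λ k → + p (pmSet72 S) k) ≈ X ^ κ * (λ k → + p (pmSet72 S′) k) + σ q^ ℓ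
    generating-identity = begin
      x                      ≈⟨ +-identityʳ x ⟨
      x + 0#                 ≈⟨ +-congˡ {x} (trans (*-congʳ {w} 1+-1≈0) (zeroˡ w)) ⟨
      x + (1# + -1#) * w     ≈⟨ solve 3 (λ e x w → x :+ (con 1 :+ e) :* w := x :+ e :* w :+ w) refl -1# x w ⟩
      x + -1# * w + w        ≈⟨ +-congʳ {w} vanish ⟩
      0# + w                 ≈⟨ +-identityˡ w ⟩
      w                      ∎

  σq^-coefficient : ∀ σ ℓ k → k < M → k ≢ ℓ → (σ q^ ℓ) k ≡ 0ℤ
  σq^-coefficient pos ℓ k _   k≢ℓ = ≡.trans (⋆-identityˡ (X ^ ℓ) k) (X^-coefficient ℓ k k≢ℓ)
  σq^-coefficient neg ℓ k k<M k≢ℓ = ≡.trans (-1*x≈-x (X ^ ℓ) k k<M) (≡.cong ℤ.-_ (X^-coefficient ℓ k k≢ℓ))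

-- The six partition identities and their certificates.

open Certificates
open PowerSeries
open import Data.Nat using (_+_)
open ≡ using (refl; trans; cong; cong₂; sym)

-- Comparison of coefficients of q^(n+κ), in the ring truncated just beyond that power; the monomial
-- σ q^ℓ is seen at ℓ only.
shifted-identity : ∀ {S S′ κ σ ℓ} → Certificate S S′ κ σ ℓ → ∀ n → n + κ ≢ ℓ → p (pmSet72 S) (n + κ) ≡ p (pmSet72 S′) n
shifted-identity {S} {S′} {κ} {σ} {ℓ} cert n n+κ≢ℓ = ℤₚ.+-injective (trans
  (generating-identity cert (n + κ) n+κ<M)
  (trans (cong₂ ℤ._+_ (trans (cong (X ^ κ ⋆ (λ k → ℤ.+ p (pmSet72 S′) k)) (ℕₚ.+-comm n κ)) (X^-⋆-above κ _ n))
                      (σq^-coefficient σ ℓ (n + κ) n+κ<M n+κ≢ℓ))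
         (ℤₚ.+-identityʳ _)))
  where
  open GeneratingFunctions (n + κ)
  open Shift (suc (suc (n + κ)))
  n+κ<M : n + κ ℕ.< suc (suc (n + κ))
  n+κ<M = s≤s (ℕₚ.n≤1+n (n + κ))
  open import Algebra.Properties.Semiring.Exp (CommutativeRing.semiring (truncatedSeries (suc (suc (n + κ))))) using (_^_)

n+suc≢0 : ∀ n k → n + suc k ≢ 0
n+suc≢0 n k eq with ℕₚ.m+n≡0⇒n≡0 n eq
... | ()

shiftless-identity : ∀ {S S′ σ ℓ} → Certificate S S′ 0 σ ℓ → ∀ n → n ≢ ℓ → p (pmSet72 S) n ≡ p (pmSet72 S′) n
shiftless-identity {S} {ℓ = ℓ} cert n n≢ℓ = trans (cong (p (pmSet72 S)) (sym (ℕₚ.+-identityʳ n)))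
  (shifted-identity cert n (λ eq → n≢ℓ (trans (sym (ℕₚ.+-identityʳ n)) eq)))

-- The generating functions satisfy P_S = q P_T + 1; the 1 accounts for the empty partition counted
-- by p(S, 0), which the shifted series misses.
certificate-i : Certificate
  (1 ∷ 5 ∷ 9 ∷ 12 ∷ 13 ∷ 14 ∷ 16 ∷ 23 ∷ 27 ∷ 31 ∷ 34 ∷ 35 ∷ [])
  (1 ∷ 4 ∷ 9 ∷ 11 ∷ 13 ∷ 14 ∷ 23 ∷ 25 ∷ 27 ∷ 30 ∷ 32 ∷ 35 ∷ []) 1 pos 0
certificate-i = record
  -- The points are w = q, z = -q^7, y = q^8, x = q^14.
  { d₁ = right (left (basic (params 2 6 1 6 neg neg pos) tt))
  ; d₂ = basic (params 8 1 1 3 pos pos neg) tt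
  ; d₃ = left (basic (params 2 8 2 3 neg pos neg) tt)
  ; positive = tt
  ; combines = (refl , refl , refl) , (refl , refl , refl) , (refl , refl , refl) , (refl , refl , refl) , (refl , refl , refl) , (refl , refl , refl) }

-- P_S = P_T + q^6: the exception n = 6 stems from 6 = 2 + 2 + 2, where 6 itself is a part in S but
-- not in T.
certificate-ii : Certificate
  (2 ∷ 5 ∷ 6 ∷ 7 ∷ 9 ∷ 16 ∷ 17 ∷ 19 ∷ 20 ∷ 27 ∷ 29 ∷ 31 ∷ [])
  (2 ∷ 5 ∷ 7 ∷ 8 ∷ 9 ∷ 11 ∷ 12 ∷ 25 ∷ 26 ∷ 27 ∷ 29 ∷ 31 ∷ []) 0 pos 6
certificate-ii = record
  { d₁ = basic (params 2 7 6 2 pos pos pos) tt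
  ; d₂ = basic (params 2 1 11 1 neg pos pos) tt
  ; d₃ = basic (params 2 5 5 3 neg neg neg) tt
  ; positive = tt
  ; combines = (refl , refl , refl) , (refl , refl , refl) , (refl , refl , refl) , (refl , refl , refl) , (refl , refl , refl) , (refl , refl , refl) }

-- P_S = q^5 P_T + 1. Here, as in the other shifted cases, the shift is the least element of S,
-- since P_S - 1 starts with that power of q and P_T starts with 1.
certificate-iii : Certificate
  (5 ∷ 6 ∷ 7 ∷ 8 ∷ 9 ∷ 17 ∷ 19 ∷ 26 ∷ 27 ∷ 28 ∷ 29 ∷ 31 ∷ [])
  (1 ∷ 7 ∷ 9 ∷ 12 ∷ 17 ∷ 19 ∷ 22 ∷ 26 ∷ 27 ∷ 29 ∷ 32 ∷ 35 ∷ []) 5 pos 0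
certificate-iii = record
  { d₁ = right (left (basic (params 2 2 5 6 neg neg pos) tt))
  ; d₂ = basic (params 2 11 1 1 neg pos pos) tt
  ; d₃ = basic (params 2 2 6 7 neg neg neg) tt
  ; positive = tt
  ; combines = (refl , refl , refl) , (refl , refl , refl) , (refl , refl , refl) , (refl , refl , refl) , (refl , refl , refl) , (refl , refl , refl) }

certificate-iv : Certificate
  (1 ∷ 9 ∷ 10 ∷ 11 ∷ 12 ∷ 14 ∷ 17 ∷ 19 ∷ 25 ∷ 27 ∷ 32 ∷ 35 ∷ [])
  (1 ∷ 8 ∷ 9 ∷ 10 ∷ 11 ∷ 13 ∷ 23 ∷ 25 ∷ 27 ∷ 28 ∷ 30 ∷ 35 ∷ []) 1 pos 0
certificate-iv = record
  { d₁ = right (left (basic (params 2 6 1 6 neg neg pos) tt))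
  ; d₂ = basic (params 6 9 1 1 neg pos pos) tt
  ; d₃ = basic (params 4 9 2 2 neg neg neg) tt
  ; positive = tt
  ; combines = (refl , refl , refl) , (refl , refl , refl) , (refl , refl , refl) , (refl , refl , refl) , (refl , refl , refl) , (refl , refl , refl) }

certificate-v : Certificate
  (7 ∷ 8 ∷ 9 ∷ 10 ∷ 11 ∷ 12 ∷ 13 ∷ 23 ∷ 25 ∷ 27 ∷ 29 ∷ 34 ∷ [])
  (1 ∷ 9 ∷ 11 ∷ 13 ∷ 16 ∷ 20 ∷ 23 ∷ 25 ∷ 27 ∷ 30 ∷ 34 ∷ 35 ∷ []) 7 pos 0
certificate-v = record
  { d₁ = right (basic (params 2 3 9 3 neg pos pos) tt)
  ; d₂ = right (basic (params 2 1 2 6 pos pos pos) tt)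
  ; d₃ = basic (params 2 3 7 1 neg neg neg) tt
  ; positive = tt
  ; combines = (refl , refl , refl) , (refl , refl , refl) , (refl , refl , refl) , (refl , refl , refl) , (refl , refl , refl) , (refl , refl , refl) }

-- P_S = P_T - q^2, with a negative sign because 2 belongs to T only: p(S, 2) = 0 and p(T, 2) = 1.
certificate-vi : Certificate
  (4 ∷ 5 ∷ 6 ∷ 7 ∷ 9 ∷ 17 ∷ 19 ∷ 22 ∷ 27 ∷ 29 ∷ 31 ∷ 32 ∷ [])
  (2 ∷ 5 ∷ 9 ∷ 12 ∷ 13 ∷ 16 ∷ 17 ∷ 19 ∷ 22 ∷ 23 ∷ 27 ∷ 31 ∷ []) 0 neg 2
certificate-vi = record
  { d₁ = left (basic (params 4 5 1 6 pos pos pos) tt)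
  ; d₂ = basic (params 2 9 1 3 pos neg neg) tt
  ; d₃ = left (right (left (basic (params 8 4 1 2 pos neg pos) tt)))
  ; positive = tt
  ; combines = (refl , refl , refl) , (refl , refl , refl) , (refl , refl , refl) , (refl , refl , refl) , (refl , refl , refl) , (refl , refl , refl) }

theorem18p3 :
    ((n : ℕ) → p (pmSet72 (1 ∷ 5 ∷ 9 ∷ 12 ∷ 13 ∷ 14 ∷ 16 ∷ 23 ∷ 27 ∷ 31 ∷ 34 ∷ 35 ∷ [])) (n + 1)
             ≡ p (pmSet72 (1 ∷ 4 ∷ 9 ∷ 11 ∷ 13 ∷ 14 ∷ 23 ∷ 25 ∷ 27 ∷ 30 ∷ 32 ∷ 35 ∷ [])) n)
    × ((n : ℕ) → n ≢ 6 → p (pmSet72 (2 ∷ 5 ∷ 6 ∷ 7 ∷ 9 ∷ 16 ∷ 17 ∷ 19 ∷ 20 ∷ 27 ∷ 29 ∷ 31 ∷ [])) n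
             ≡ p (pmSet72 (2 ∷ 5 ∷ 7 ∷ 8 ∷ 9 ∷ 11 ∷ 12 ∷ 25 ∷ 26 ∷ 27 ∷ 29 ∷ 31 ∷ [])) n)
    × ((n : ℕ) → p (pmSet72 (5 ∷ 6 ∷ 7 ∷ 8 ∷ 9 ∷ 17 ∷ 19 ∷ 26 ∷ 27 ∷ 28 ∷ 29 ∷ 31 ∷ [])) (n + 5)
             ≡ p (pmSet72 (1 ∷ 7 ∷ 9 ∷ 12 ∷ 17 ∷ 19 ∷ 22 ∷ 26 ∷ 27 ∷ 29 ∷ 32 ∷ 35 ∷ [])) n)
    × ((n : ℕ) → p (pmSet72 (1 ∷ 9 ∷ 10 ∷ 11 ∷ 12 ∷ 14 ∷ 17 ∷ 19 ∷ 25 ∷ 27 ∷ 32 ∷ 35 ∷ [])) (n + 1)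
             ≡ p (pmSet72 (1 ∷ 8 ∷ 9 ∷ 10 ∷ 11 ∷ 13 ∷ 23 ∷ 25 ∷ 27 ∷ 28 ∷ 30 ∷ 35 ∷ [])) n)
    × ((n : ℕ) → p (pmSet72 (7 ∷ 8 ∷ 9 ∷ 10 ∷ 11 ∷ 12 ∷ 13 ∷ 23 ∷ 25 ∷ 27 ∷ 29 ∷ 34 ∷ [])) (n + 7)
             ≡ p (pmSet72 (1 ∷ 9 ∷ 11 ∷ 13 ∷ 16 ∷ 20 ∷ 23 ∷ 25 ∷ 27 ∷ 30 ∷ 34 ∷ 35 ∷ [])) n)
    × ((n : ℕ) → n ≢ 2 → p (pmSet72 (4 ∷ 5 ∷ 6 ∷ 7 ∷ 9 ∷ 17 ∷ 19 ∷ 22 ∷ 27 ∷ 29 ∷ 31 ∷ 32 ∷ [])) n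
             ≡ p (pmSet72 (2 ∷ 5 ∷ 9 ∷ 12 ∷ 13 ∷ 16 ∷ 17 ∷ 19 ∷ 22 ∷ 23 ∷ 27 ∷ 31 ∷ [])) n)
theorem18p3 =
    (λ n → shifted-identity certificate-i n (n+suc≢0 n 0))
  , shiftless-identity certificate-ii
  , (λ n → shifted-identity certificate-iii n (n+suc≢0 n 4))
  , (λ n → shifted-identity certificate-iv n (n+suc≢0 n 0))
  , (λ n → shifted-identity certificate-v n (n+suc≢0 n 6))
  , shiftless-identity certificate-vi
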